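{- Let $\sigma=(M_1,M_2)$ be a schedule of $n$ jobs on two identical machines and let $k\ge 1$. Running the randomized $k$-swap algorithm (described in the context) $O(\sqrt{k})$ times independently for each of the parameter values $\tilde k\in\{1,2,\dots,k\}$ (i.e. with $\tilde k$ in place of $k$) takes $O(k^{3/2}\cdot n^{\lceil k/2\rceil}\cdot \log n)$ steps in total, and, if $\sigma$ has an improving neighbor in the $k$-swap neighborhood, this procedure finds an improving solution in the $k$-swap neighborhood with probability of success at least $1-\frac1e$.
   Context: Problem $P2\|C_{\max}$: we are given $n$ jobs with processing times $p_j>0$ and two identical machines. A schedule $\sigma=(M_1,M_2)$ is a partition of the jobs into the sets $M_1,M_2$ of jobs processed on machine 1 and machine 2. The load of machine $i$ is $L_i=\sum_{j\in M_i}p_j$; the makespan is $L_{\max}=\max_i L_i$, $L_{\min}=\min_i L_i$, and $\Delta=L_{\max}-L_{\min}$. A machine with load $L_{\max}$ is critical; one with load $L_{\min}$ is the min-load machine. A $k$-swap neighbor of $\sigma$ is obtained by selecting $k'$ jobs on one machine and $k''$ jobs on the other machine with $k'+k''\le k$ and interchanging the machine assignments of these jobs. A neighbor is improving (a better solution) if its makespan is strictly smaller than that of $\sigma$; equivalently, there are a set $S'$ of jobs on the critical machine and a set $S''$ of jobs on the min-load machine with $|S'|+|S''|\le k$ and $0<\sum_{j\in S'}p_j-\sum_{j\in S''}p_j<\Delta$, which are interchanged. Randomized $k$-swap algorithm (input: $\sigma$ and $k$; label the machines so that machine 1 is critical): (1) assign each job independently and uniformly at random to one of two sets $A$ or $B$;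 (2) for every $S_1\subseteq A$ with $|S_1|=\lceil k/2\rceil$ put the value $\sum_{j\in S_1\cap M_1}p_j-\sum_{j\in S_1\cap M_2}p_j$ (with a reference to $S_1$) into $A_\Sigma$; (3) for every $S_2\subseteq B$ with $|S_2|=\lfloor k/2\rfloor$ put $\sum_{j\in S_2\cap M_1}p_j-\sum_{j\in S_2\cap M_2}p_j$ (with a reference to $S_2$) into $B_\Sigma$; (4) sort $B_\Sigma$ in non-decreasing order; (5) for each $x\in A_\Sigma$, search (by binary search) for a $y\in B_\Sigma$ with $-x<y<\Delta-x$; if found, update $\sigma$ by interchanging the machine assignments of all jobs in the corresponding $S_1\cup S_2$ and return True; (6) otherwise return False. Whenever the algorithm returns True, the updated schedule has strictly smaller makespan. -}

module Defs where

open import Algebra.Bundles using (AbelianGroup)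
open import Algebra.Structures using (IsAbelianGroup)
open import Data.Bool.Base using (Bool; true; false; not; if_then_else_)
import Data.Bool.Properties as Bool
open import Data.Fin.Base using (Fin; fromℕ<)
open import Data.Fin.Subset using (Subset; _⊆_; _─_; _∪_; ∁; ∣_∣)
open import Data.Fin.Subset.Properties using (_⊆?_; anySubset?)
open import Data.List.Base using (List; []; _∷_; allFin; length)
open import Data.Maybe.Base using (Maybe; just; nothing; _<∣>_)
open import Data.Maybe.Relation.Unary.Any as Maybe using (Any)
open import Data.Nat.Base as ℕ using (ℕ; zero; suc; ⌊_/2⌋; ⌈_/2⌉; _!)
import Data.Nat.Properties as ℕ
open import Data.Product.Base using (∃; _×_; _,_; proj₁; proj₂)
open import Data.Rational.Base as ℚ using (ℚ; 0ℚ; 1ℚ; ½; 1/_; Positive)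
import Data.Rational.Properties as ℚ
open import Data.Unit.Base using (⊤; tt)
open import Data.Vec.Base as Vec using (Vec; lookup; updateAt; fromList)
import Data.Vec.Properties as Vec
open import Data.Vec.Functional using (Vector)
open import Level as ℓ using (Level; _⊔_)
open import Relation.Binary.Core using (Rel)
open import Relation.Binary.PropositionalEquality.Core using (_≡_)
open import Relation.Binary.Structures using (IsStrictTotalOrder)
open import Relation.Nullary.Decidable.Core using (Dec; yes; no; does; _×-dec_)
open import Relation.Unary using (Pred; Decidable)

------------------------------------------------------------------------
-- Processing times live in an arbitrary linearly ordered abelian group
-- with decidable comparison.

record OrderedAbelianGroup c ℓ₁ ℓ₂ : Set (ℓ.suc (c ⊔ ℓ₁ ⊔ ℓ₂)) where
  infix  8 -_
  infixl 6 _+_ _-_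
  infix  4 _≈_ _<_
  field
    Carrier            : Set c
    _≈_                : Rel Carrier ℓ₁
    _<_                : Rel Carrier ℓ₂
    _+_                : Carrier → Carrier → Carrier
    0#                 : Carrier
    -_                 : Carrier → Carrier
    isAbelianGroup     : IsAbelianGroup _≈_ _+_ 0# -_
    isStrictTotalOrder : IsStrictTotalOrder _≈_ _<_
    +-monoˡ-<          : ∀ z {x y} → x < y → x + z < y + z

  abelianGroup : AbelianGroup c ℓ₁
  abelianGroup = record { isAbelianGroup = isAbelianGroup }

  open IsStrictTotalOrder isStrictTotalOrder public using (_<?_)

  _-_ : Carrier → Carrier → Carrier
  x - y = x + - y

  max : Carrier → Carrier → Carrier
  max x y = if does (x <? y) then y else x

  open import Algebra.Properties.Monoid.Sum
    (AbelianGroup.monoid abelianGroup) public using (sum)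

------------------------------------------------------------------------
-- Deterministic computations with a step counter.  Arithmetic on group
-- elements and indices, comparisons, list constructors, array reads and
-- writes are elementary; every clause of a recursive function below
-- charges at least one step, covering a bounded number of these.

module Timed where

  infix 2 _after_

  record Timed {a} (A : Set a) : Set a where
    constructor _after_
    field
      value : A
      cost  : ℕ

  open Timed public

  private variable
    a b : Level
    A : Set a
    B : Set b

  return : A → Timed A
  return x = x after 0

  step : A → Timed A
  step x = x after 1

  infixl 1 _>>=_

  _>>=_ : Timed A → (A → Timed B) → Timed B
  m >>= f = value (f (value m)) after (cost m ℕ.+ cost (f (value m)))

  mapT : (A → Timed B) → List A → Timed (List B)
  mapT f []       = step []
  mapT f (x ∷ xs) = do
    y  ← f x
    ys ← mapT f xs
    step (y ∷ ys)

  append : List A → List A → Timed (List A)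
  append []       ys = step ys
  append (x ∷ xs) ys = do
    zs ← append xs ys
    step (x ∷ zs)

  -- All sublists of the given length.
  subsets : ℕ → List A → Timed (List (List A))
  subsets zero    xs       = step ([] ∷ [])
  subsets (suc h) []       = step []
  subsets (suc h) (x ∷ xs) = do
    ys ← subsets h xs
    us ← mapT (λ y → step (x ∷ y)) ys
    vs ← subsets (suc h) xs
    append us vs

  toArray : (xs : List A) → Timed (Vec A (length xs))
  toArray xs = fromList xs after suc (length xs)

------------------------------------------------------------------------
-- Randomized computations: finite trees of independent fair coin tosses.

module Randomized where

  data Alg {a} (A : Set a) : Set a where
    return : A → Alg A
    charge : ℕ → Alg A → Alg A
    toss   : (Bool → Alg A) → Alg A

  private variable
    a b : Level
    A : Set a
    B : Set b

  lift : Timed.Timed A → Alg A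
  lift t = charge (Timed.cost t) (return (Timed.value t))

  infixl 1 _>>=_ _>>_

  _>>=_ : Alg A → (A → Alg B) → Alg B
  return x   >>= f = f x
  charge c t >>= f = charge c (t >>= f)
  toss t     >>= f = toss (λ b → t b >>= f)

  _>>_ : Alg A → Alg B → Alg B
  t >> u = t >>= λ _ → u

  tick : Alg ⊤
  tick = charge 1 (return tt)

  -- Number of steps on the worst sequence of coin tosses.
  steps : Alg A → ℕ
  steps (return x)   = 0
  steps (charge c t) = c ℕ.+ steps t
  steps (toss t)     = suc (steps (t true) ℕ.⊔ steps (t false))

  Pr : ∀ {p} {P : Pred A p} → Decidable P → Alg A → ℚ
  Pr P? (return x)   = if does (P? x) then 1ℚ else 0ℚ
  Pr P? (charge c t) = Pr P? t
  Pr P? (toss t)     = ½ ℚ.* (Pr P? (t true) ℚ.+ Pr P? (t false))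

  split : List A → Alg (List A × List A)
  split []       = do
    tick
    return ([] , [])
  split (x ∷ xs) = toss λ inA → do
    (as , bs) ← split xs
    tick
    return (if inA then (x ∷ as , bs) else (as , x ∷ bs))

  -- All r runs are executed; the first success is reported.
  repeat : ℕ → Alg (Maybe A) → Alg (Maybe A)
  repeat zero    t = do
    tick
    return nothing
  repeat (suc r) t = do
    x ← t
    y ← repeat r t
    tick
    return (x <∣> y)

------------------------------------------------------------------------
-- Schedules on two machines.  A partition (M₁ , M₂) of the jobs is
-- given by the set M₁; M₂ is its complement.

data Machine : Set where
  m₁ m₂ : Machine

other : Machine → Machine
other m₁ = m₂
other m₂ = m₁

Schedule : ℕ → Set
Schedule n = Subset n

jobs : ∀ {n} → Schedule n → Machine → Subset n
jobs σ m₁ = σ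
jobs σ m₂ = ∁ σ

-- σ′ arises from σ by moving S₁ ⊆ M₁ to machine 2 and S₂ ⊆ M₂ to
-- machine 1, at most k jobs in total.
Neighbor : ∀ {n} → ℕ → Schedule n → Schedule n → Set
Neighbor k σ σ′ = ∃ λ S₁ → ∃ λ S₂ →
  S₁ ⊆ jobs σ m₁ × S₂ ⊆ jobs σ m₂ × ∣ S₁ ∣ ℕ.+ ∣ S₂ ∣ ℕ.≤ k ×
  σ′ ≡ (jobs σ m₁ ─ S₁) ∪ S₂

neighbor? : ∀ {n} k (σ σ′ : Schedule n) → Dec (Neighbor k σ σ′)
neighbor? k σ σ′ = anySubset? λ S₁ → anySubset? λ S₂ →
  S₁ ⊆? jobs σ m₁ ×-dec S₂ ⊆? jobs σ m₂ ×-dec (∣ S₁ ∣ ℕ.+ ∣ S₂ ∣) ℕ.≤? k ×-dec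
  Vec.≡-dec Bool._≟_ σ′ ((jobs σ m₁ ─ S₁) ∪ S₂)

mid<hi : ∀ {lo hi} → lo ℕ.< hi → ⌊ lo ℕ.+ hi /2⌋ ℕ.< hi
mid<hi {lo} {hi} lo<hi = begin
  suc ⌊ lo ℕ.+ hi /2⌋         ≡⟨⟩
  ⌊ suc (suc (lo ℕ.+ hi)) /2⌋ ≤⟨ ℕ.⌊n/2⌋-mono (ℕ.s≤s (ℕ.+-monoˡ-≤ hi lo<hi)) ⟩
  ⌈ hi ℕ.+ hi /2⌉             ≡⟨ ℕ.n≡⌈n+n/2⌉ hi ⟨
  hi                          ∎
  where open ℕ.≤-Reasoning

module Scheduling
  {c ℓ₁ ℓ₂} (G : OrderedAbelianGroup c ℓ₁ ℓ₂)
  {n : ℕ} (p : Vector (OrderedAbelianGroup.Carrier G) n)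
  where

  open OrderedAbelianGroup G

  Job : Set
  Job = Fin n

  load : Schedule n → Machine → Carrier
  load σ i = sum λ j → if lookup (jobs σ i) j then p j else 0#

  makespan : Schedule n → Carrier
  makespan σ = max (load σ m₁) (load σ m₂)

  ImprovingNeighbor : ℕ → Schedule n → Pred (Schedule n) ℓ₂
  ImprovingNeighbor k σ σ′ = Neighbor k σ σ′ × makespan σ′ < makespan σ

  improvingNeighbor? : ∀ k σ → Decidable (ImprovingNeighbor k σ)
  improvingNeighbor? k σ σ′ = neighbor? k σ σ′ ×-dec (makespan σ′ <? makespan σ)

  Success : ℕ → Schedule n → Pred (Maybe (Schedule n)) ℓ₂
  Success k σ = Any (ImprovingNeighbor k σ)

  success? : ∀ k σ → Decidable (Success k σ)
  success? k σ = Maybe.dec (improvingNeighbor? k σ)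

  ----------------------------------------------------------------------
  -- The deterministic part of the randomized k-swap algorithm

  -- The value of a set of jobs, with a reference to the set.
  Entry : Set c
  Entry = Carrier × List Job

  module _ where
    open Timed

    onMachine : Schedule n → Machine → Job → Timed Bool
    onMachine σ m₁ j = step (lookup σ j)
    onMachine σ m₂ j = step (not (lookup σ j))

    -- Total processing time of those of the given jobs that are on i.
    sumOn : Schedule n → Machine → List Job → Timed Carrier
    sumOn σ i []       = step 0#
    sumOn σ i (j ∷ js) = do
      b ← onMachine σ i j
      s ← sumOn σ i js
      step (if b then p j + s else s)

    entry : Schedule n → Machine → List Job → Timed Entry
    entry σ crit S = do
      x ← sumOn σ crit S
      y ← sumOn σ (other crit) S
      step (x - y , S)

    entries : Schedule n → Machine → ℕ → List Job → Timed (List Entry)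
    entries σ crit h X = do
      Ss ← subsets h X
      mapT (entry σ crit) Ss

    merge : List Entry → List Entry → Timed (List Entry)
    merge []       ys       = step ys
    merge (x ∷ xs) []       = step (x ∷ xs)
    merge (x ∷ xs) (y ∷ ys) = do
      b ← step (does (proj₁ y <? proj₁ x))
      if b
        then (do zs ← merge (x ∷ xs) ys
                 step (y ∷ zs))
        else (do zs ← merge xs (y ∷ ys)
                 step (x ∷ zs))

    mergePairs : List (List Entry) → Timed (List (List Entry))
    mergePairs []              = step []
    mergePairs (xs ∷ [])       = step (xs ∷ [])
    mergePairs (xs ∷ ys ∷ xss) = do
      zs  ← merge xs ys
      zss ← mergePairs xss
      step (zs ∷ zss)

    -- The first argument only ensures termination; the number of lists
    -- is always enough.
    mergeAll : ℕ → List (List Entry) → Timed (List Entry)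
    mergeAll _       []              = step []
    mergeAll _       (xs ∷ [])       = step xs
    mergeAll zero    (xs ∷ _ ∷ _)    = step xs
    mergeAll (suc f) (xs ∷ ys ∷ xss) = do
      zss ← mergePairs (xs ∷ ys ∷ xss)
      mergeAll f zss

    sort : List Entry → Timed (List Entry)
    sort xs = do
      xss ← mapT (λ x → step (x ∷ [])) xs
      mergeAll (length xs) xss

    -- Search positions lo ≤ i < hi for an entry whose value lies strictly
    -- between l and u.  The first explicit argument only ensures
    -- termination; hi is always enough.
    binarySearch : ∀ {m} → ℕ → Vec Entry m → (l u : Carrier) →
                   (lo hi : ℕ) → hi ℕ.≤ m → Timed (Maybe Entry)
    binarySearch zero    B l u lo hi hi≤m = step nothing
    binarySearch (suc f) B l u lo hi hi≤m with lo ℕ.<? hi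
    ... | no  _     = step nothing
    ... | yes lo<hi = do
      e     ← step (lookup B (fromℕ< (ℕ.≤-trans (mid<hi lo<hi) hi≤m)))
      above ← step (does (l <? proj₁ e))
      below ← step (does (proj₁ e <? u))
      if above
        then (if below
          then step (just e)
          else binarySearch f B l u lo ⌊ lo ℕ.+ hi /2⌋
                 (ℕ.≤-trans (ℕ.<⇒≤ (mid<hi lo<hi)) hi≤m))
        else binarySearch f B l u (suc ⌊ lo ℕ.+ hi /2⌋) hi hi≤m

    interchange : List Job → Schedule n → Timed (Schedule n)
    interchange []       σ = step σ
    interchange (j ∷ js) σ = do
      σ′ ← step (updateAt σ j not)
      interchange js σ′

    scan : ∀ {m} → Schedule n → Carrier → List Entry → Vec Entry m →
           Timed (Maybe (Schedule n))
    scan         σ Δ []              B = step nothing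
    scan {m = m} σ Δ ((x , S₁) ∷ xs) B = do
      found ← binarySearch m B (- x) (Δ - x) 0 m ℕ.≤-refl
      next found
      where
      next : Maybe Entry → Timed (Maybe (Schedule n))
      next nothing         = do
        σ′? ← scan σ Δ xs B
        step σ′?
      next (just (_ , S₂)) = do
        σ′ ← interchange S₁ σ
        σ″ ← interchange S₂ σ′
        step (just σ″)

    kSwapOn : ℕ → Schedule n → (A B : List Job) → Timed (Maybe (Schedule n))
    kSwapOn k σ A B = do
      L₁         ← sumOn σ m₁ (allFin n)
      L₂         ← sumOn σ m₂ (allFin n)
      (crit , Δ) ← step (if does (L₁ <? L₂) then (m₂ , L₂ - L₁) else (m₁ , L₁ - L₂))
      AΣ         ← entries σ crit ⌈ k /2⌉ A
      BΣ         ← entries σ crit ⌊ k /2⌋ B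
      BΣ-sorted  ← sort BΣ
      BΣ-array   ← toArray BΣ-sorted
      scan σ Δ AΣ BΣ-array

  ----------------------------------------------------------------------
  -- `just σ′` corresponds to the answer True with updated schedule σ′,
  -- `nothing` to False.

  module _ where
    open Randomized

    kSwap : ℕ → Schedule n → Alg (Maybe (Schedule n))
    kSwap k σ = do
      (A , B) ← split (allFin n)
      lift (kSwapOn k σ A B)

    -- r independent runs on σ for each of the parameter values 1, …, k.
    procedure : (r k : ℕ) → Schedule n → Alg (Maybe (Schedule n))
    procedure r zero    σ = do
      tick
      return nothing
    procedure r (suc k) σ = do
      x ← procedure r k σ
      y ← repeat r (kSwap (suc k) σ)
      tick
      return (x <∣> y)

------------------------------------------------------------------------
-- The bound 1 - 1/e

-- ∑_{i ≤ m} 1 / i!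
expSum : ℕ → ℚ
expSum zero    = 1ℚ
expSum (suc m) = expSum m ℚ.+ ℚ.normalize 1 (suc m !) {{suc m ℕ.!≢0}}

expSum-pos : ∀ m → Positive (expSum m)
expSum-pos zero    = _
expSum-pos (suc m) = ℚ.pos+pos⇒pos (expSum m) {{expSum-pos m}} _
  {{ℚ.normalize-pos 1 (suc m !) {{suc m ℕ.!≢0}}}}

1/expSum : ℕ → ℚ
1/expSum m = (1/ expSum m) {{ℚ.pos⇒nonZero (expSum m) {{expSum-pos m}}}}

-- Since e is the supremum of its partial sums, 1 - 1/e is the supremum
-- of the rationals 1 - 1 / expSum m.
_≥1-1/e : ℚ → Set
q ≥1-1/e = ∀ m → 1ℚ ℚ.- 1/expSum m ℚ.≤ q

{-# OPTIONS --safe #-}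
-- A run with parameter j succeeds as soon as the j jobs in which σ and
-- an improving neighbor differ are split evenly between A and B: two
-- pieces of the transfer with total strictly between 0 and Δ are then in
-- the lists, and every pair found by the search is a valid improvement.
-- An even split has probability C(j, ⌈j/2⌉) / 2^j ≥ 1 / (2 √k), so with
-- r = 6 ⌈√k⌉ runs Bernoulli's inequality bounds the probability of
-- failure by 1 / (1 + 3), which is below 1/e since e ≤ 3.
-- For the running time, a list has at most n^⌈k/2⌉ entries, whose
-- logarithm is O (k log n).
module Submission where

-- A run with parameter j interchanges exactly j jobs, so a neighbor at distance j from the schedule
-- is within reach of that parameter only; this is why every value up to k has to be tried. The runs
-- are combined by keeping the first `just`, so a single wrong report would hide a later success.
-- Failure probabilities multiply only because every run is sound on every sequence of tosses. The
-- predicate `Surely` on leaves expresses this, and it also carries the facts about `split` into the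
-- step bounds, which are worst cases. Roots and divisions are avoided throughout: bounds with a
-- square root are squared, and an inequality q ≥ a/b is written with natural multiples, using the
-- repeated sum `n ⋆ q`. Counting arguments by induction on lists then become additions of
-- rationals, without casts.

open import Defs

-- Binomial coefficients and integer square roots

module Arithmetic where

  open import Data.Nat.Base hiding (parity)
  open import Data.Nat.Properties
  open import Data.Nat.Tactic.RingSolver using (solve-∀)
  open import Relation.Binary.PropositionalEquality.Core
  open import Relation.Binary.PropositionalEquality.Properties using (module ≡-Reasoning)
  open import Relation.Nullary.Decidable.Core using (yes; no)

  -- paths a b is the binomial coefficient C(a+b, a).
  paths : ℕ → ℕ → ℕ
  paths zero    b       = 1
  paths (suc a) zero    = 1
  paths (suc a) (suc b) = paths a (suc b) + paths (suc a) b

  -- Pascal's rule matches the split of the leading factor a + b + 2 of the factorial into (a + 1) +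
  -- (b + 1). Cancelling factorials then gives the ratio of neighboring coefficients in
  -- `paths-sucˡ`.
  paths-! : ∀ a b → paths a b * (a ! * b !) ≡ (a + b) !
  paths-! zero    b       = trans (+-identityʳ _) (+-identityʳ _)
  paths-! (suc a) zero    = trans (+-identityʳ _) (trans (*-identityʳ _) (cong _! (sym (+-identityʳ (suc a)))))
  paths-! (suc a) (suc b) = begin
    (u + v) * ((suc a * x) * (suc b * y))                                  ≡⟨ lemma u v x y a b ⟩
    suc a * (u * (x * (suc b * y))) + suc b * (v * ((suc a * x) * y))
      ≡⟨ cong₂ (λ s t → suc a * s + suc b * t) (paths-! a (suc b)) (paths-! (suc a) b) ⟩
    suc a * (a + suc b) ! + suc b * (suc a + b) !
      ≡⟨ cong (λ s → suc a * (a + suc b) ! + suc b * s !) (sym (+-suc a b)) ⟩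
    suc a * (a + suc b) ! + suc b * (a + suc b) !
      ≡⟨ *-distribʳ-+ ((a + suc b) !) (suc a) (suc b) ⟨
    (suc a + suc b) !                                                      ∎
    where
    open ≡-Reasoning
    u v x y : ℕ
    u = paths a (suc b)
    v = paths (suc a) b
    x = a !
    y = b !
    lemma : ∀ u v x y a b → (u + v) * ((suc a * x) * (suc b * y)) ≡
            suc a * (u * (x * (suc b * y))) + suc b * (v * ((suc a * x) * y))
    lemma = solve-∀

  paths-sucˡ : ∀ a b → suc a * paths (suc a) b ≡ suc (a + b) * paths a b
  paths-sucˡ a b = *-cancelʳ-≡ _ _ (a ! * b !) {{m*n≢0 (a !) (b !) {{a !≢0}} {{b !≢0}}}} (begin
    suc a * paths (suc a) b * (a ! * b !)   ≡⟨ lemma (suc a) (paths (suc a) b) (a !) (b !) ⟩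
    paths (suc a) b * (suc a ! * b !)       ≡⟨ paths-! (suc a) b ⟩
    suc (a + b) * (a + b) !                 ≡⟨ cong (suc (a + b) *_) (paths-! a b) ⟨
    suc (a + b) * (paths a b * (a ! * b !)) ≡⟨ *-assoc (suc (a + b)) (paths a b) _ ⟨
    suc (a + b) * paths a b * (a ! * b !)   ∎)
    where
    open ≡-Reasoning
    lemma : ∀ s p x y → s * p * (x * y) ≡ p * (s * x * y)
    lemma = solve-∀

  paths-comm : ∀ a b → paths a b ≡ paths b a
  paths-comm zero    zero    = refl
  paths-comm zero    (suc b) = refl
  paths-comm (suc a) zero    = refl
  paths-comm (suc a) (suc b) =
    trans (cong₂ _+_ (paths-comm a (suc b)) (paths-comm (suc a) b)) (+-comm (paths (suc b) a) _)

  paths-diagonal : ∀ m → paths (suc m) (suc m) ≡ 2 * paths (suc m) m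
  paths-diagonal m = cong₂ _+_ (paths-comm m (suc m)) (sym (+-identityʳ _))

  -- The squared form of C(2m, m) ≥ 4^m / (2√m), shifted by one. The induction uses that consecutive
  -- central coefficients have ratio 2 (2m + 3) / (m + 2).
  central-bound : ∀ m → 16 ^ suc m ≤ 4 * suc m * paths (suc m) (suc m) ^ 2
  central-bound zero    = ≤-refl
  central-bound (suc m) = *-cancelˡ-≤ (2 + m) (begin
    (2 + m) * (16 * 16 ^ suc m)
      ≤⟨ *-monoʳ-≤ (2 + m) (*-monoʳ-≤ 16 (central-bound m)) ⟩
    -- The added term completes the square: 4 (m + 1) (m + 2) + 1 = (2m + 3)².
    (2 + m) * (16 * (4 * suc m * P ^ 2))            ≤⟨ m≤m+n _ (16 * P ^ 2) ⟩
    (2 + m) * (16 * (4 * suc m * P ^ 2)) + 16 * P ^ 2 ≡⟨ lemma₁ m P ⟩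
    16 * ((suc (suc m + suc m)) * P) ^ 2
      ≡⟨ cong (λ s → 16 * s ^ 2) (paths-sucˡ (suc m) (suc m)) ⟨
    16 * ((2 + m) * Q) ^ 2                          ≡⟨ lemma₂ (2 + m) Q ⟩
    (2 + m) * (4 * (2 + m) * (2 * Q) ^ 2)
      ≡⟨ cong (λ s → (2 + m) * (4 * (2 + m) * s ^ 2)) (paths-diagonal (suc m)) ⟨
    (2 + m) * (4 * (2 + m) * paths (2 + m) (2 + m) ^ 2) ∎)
    where
    open ≤-Reasoning
    P Q : ℕ
    P = paths (suc m) (suc m)
    Q = paths (2 + m) (suc m)
    lemma₁ : ∀ m P → (2 + m) * (16 * (4 * suc m * (P * (P * 1)))) + 16 * (P * (P * 1)) ≡
                     16 * (((suc (suc m + suc m)) * P) * (((suc (suc m + suc m)) * P) * 1))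
    lemma₁ = solve-∀
    lemma₂ : ∀ m Q → 16 * ((m * Q) * ((m * Q) * 1)) ≡ m * (4 * m * ((2 * Q) * ((2 * Q) * 1)))
    lemma₂ = solve-∀

  data Parity : ℕ → Set where
    even : ∀ m → Parity (m + m)
    odd  : ∀ m → Parity (suc (m + m))

  parity : ∀ n → Parity n
  parity zero = even 0
  parity (suc n) with parity n
  ... | even m = odd m
  ... | odd m  = subst Parity (cong suc (+-suc m m)) (even (suc m))

  4^[m+m] : ∀ m → (2 ^ (m + m)) ^ 2 ≡ 16 ^ m
  4^[m+m] m = begin
    (2 ^ (m + m)) ^ 2 ≡⟨ ^-*-assoc 2 (m + m) 2 ⟩
    2 ^ ((m + m) * 2) ≡⟨ cong (2 ^_) (lemma m) ⟩
    2 ^ (4 * m)       ≡⟨ ^-*-assoc 2 4 m ⟨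
    16 ^ m            ∎
    where
    open ≡-Reasoning
    lemma : ∀ m → (m + m) * 2 ≡ 4 * m
    lemma = solve-∀

  -- Both parities reduce to `central-bound` at m; enlarging its factor m + 1 to k gives the two
  -- cases the same form.
  balanced-split-bound : ∀ k → 1 ≤ k → (2 ^ k) ^ 2 ≤ 4 * k * paths ⌈ k /2⌉ ⌊ k /2⌋ ^ 2
  balanced-split-bound k 1≤k with parity k
  balanced-split-bound _ () | even zero
  ... | even (suc m) = begin
    (2 ^ (suc m + suc m)) ^ 2                     ≡⟨ 4^[m+m] (suc m) ⟩
    16 ^ suc m                                    ≤⟨ central-bound m ⟩
    4 * suc m * paths (suc m) (suc m) ^ 2
      ≤⟨ *-monoˡ-≤ (paths (suc m) (suc m) ^ 2) (*-monoʳ-≤ 4 (m≤m+n (suc m) (suc m))) ⟩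
    4 * (suc m + suc m) * paths (suc m) (suc m) ^ 2
      ≡⟨ cong₂ (λ a b → 4 * (suc m + suc m) * paths a b ^ 2) (n≡⌈n+n/2⌉ (suc m)) (n≡⌊n+n/2⌋ (suc m)) ⟩
    _                                             ∎
    where open ≤-Reasoning
  -- C(2m + 2, m + 1) is twice C(2m + 1, m + 1), so a factor of 4 leads from the odd number to the
  -- central coefficient above it.
  ... | odd m = *-cancelˡ-≤ 4 (begin
    4 * (2 ^ suc (m + m)) ^ 2                     ≡⟨ lemma₁ (2 ^ (m + m)) ⟩
    16 * (2 ^ (m + m)) ^ 2                        ≡⟨ cong (16 *_) (4^[m+m] m) ⟩
    16 ^ suc m                                    ≤⟨ central-bound m ⟩
    4 * suc m * paths (suc m) (suc m) ^ 2
      ≡⟨ cong (λ s → 4 * suc m * s ^ 2) (paths-diagonal m) ⟩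
    4 * suc m * (2 * P) ^ 2
      ≤⟨ *-monoˡ-≤ ((2 * P) ^ 2) (*-monoʳ-≤ 4 (s≤s (m≤m+n m m))) ⟩
    4 * suc (m + m) * (2 * P) ^ 2                 ≡⟨ lemma₂ (suc (m + m)) P ⟩
    4 * (4 * suc (m + m) * P ^ 2)
      ≡⟨ cong₂ (λ a b → 4 * (4 * suc (m + m) * paths a b ^ 2)) (cong suc (n≡⌊n+n/2⌋ m)) (n≡⌈n+n/2⌉ m) ⟩
    _                                             ∎)
    where
    open ≤-Reasoning
    P : ℕ
    P = paths (suc m) m
    lemma₁ : ∀ x → 4 * ((2 * x) * ((2 * x) * 1)) ≡ 16 * (x * (x * 1))
    lemma₁ = solve-∀
    lemma₂ : ∀ k P → 4 * k * ((2 * P) * ((2 * P) * 1)) ≡ 4 * (4 * k * (P * (P * 1)))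
    lemma₂ = solve-∀

  -- The root is raised only when its square no longer reaches the argument, so the upper and the
  -- lower bound follow by the same case split.
  ⌈√_⌉ : ℕ → ℕ
  ⌈√ zero  ⌉ = 0
  ⌈√ suc k ⌉ with suc k ≤? ⌈√ k ⌉ ^ 2
  ... | yes _ = ⌈√ k ⌉
  ... | no  _ = suc ⌈√ k ⌉

  k≤⌈√k⌉² : ∀ k → k ≤ ⌈√ k ⌉ ^ 2
  k≤⌈√k⌉² zero = z≤n
  k≤⌈√k⌉² (suc k) with suc k ≤? ⌈√ k ⌉ ^ 2
  ... | yes p = p
  ... | no  _ = begin
    suc k                ≤⟨ s≤s (k≤⌈√k⌉² k) ⟩
    suc (⌈√ k ⌉ ^ 2)     ≤⟨ m≤m+n _ (2 * ⌈√ k ⌉) ⟩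
    suc (⌈√ k ⌉ ^ 2) + 2 * ⌈√ k ⌉ ≡⟨ lemma ⌈√ k ⌉ ⟩
    suc ⌈√ k ⌉ ^ 2       ∎
    where
    open ≤-Reasoning
    lemma : ∀ s → suc (s * (s * 1)) + 2 * s ≡ suc s * (suc s * 1)
    lemma = solve-∀

  -- A root that is about to be raised satisfies s² ≤ k, and (s + 1)² ≤ 3 s² + 1.
  ⌈√k⌉²≤4k : ∀ k → ⌈√ k ⌉ ^ 2 ≤ 4 * k
  ⌈√k⌉²≤4k zero = z≤n
  ⌈√k⌉²≤4k (suc k) with suc k ≤? ⌈√ k ⌉ ^ 2
  ... | yes p = ≤-trans (⌈√k⌉²≤4k k) (*-monoʳ-≤ 4 (n≤1+n k))
  ... | no  q = begin
    suc s ^ 2            ≡⟨ lemma s ⟩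
    s ^ 2 + 2 * s + 1    ≤⟨ +-monoˡ-≤ 1 (+-monoʳ-≤ (s ^ 2) (*-monoʳ-≤ 2 (s≤s² s))) ⟩
    s ^ 2 + 2 * s ^ 2 + 1 ≡⟨ lemma₂ (s ^ 2) ⟩
    3 * s ^ 2 + 1        ≤⟨ +-monoˡ-≤ 1 (*-monoʳ-≤ 3 (≮⇒≥ q)) ⟩
    3 * k + 1            ≤⟨ +-mono-≤ (*-monoˡ-≤ k (n≤1+n 3)) (s≤s z≤n) ⟩
    4 * k + 4            ≡⟨ lemma₃ k ⟩
    4 * suc k            ∎
    where
    open ≤-Reasoning
    s : ℕ
    s = ⌈√ k ⌉
    s≤s² : ∀ s → s ≤ s ^ 2
    s≤s² zero    = z≤n
    s≤s² (suc s) = ≤-trans (≤-reflexive (sym (*-identityʳ (suc s)))) (*-monoʳ-≤ (suc s) (s≤s z≤n))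
    lemma : ∀ s → suc s * (suc s * 1) ≡ s * (s * 1) + 2 * s + 1
    lemma = solve-∀
    lemma₂ : ∀ t → t + 2 * t + 1 ≡ 3 * t + 1
    lemma₂ = solve-∀
    lemma₃ : ∀ k → 4 * k + 4 ≡ 4 * suc k
    lemma₃ = solve-∀

  ^2-cancel-≤ : ∀ {m n} → m ^ 2 ≤ n ^ 2 → m ≤ n
  ^2-cancel-≤ {m} {n} m²≤n² with m ≤? n
  ... | yes m≤n = m≤n
  ... | no  m≰n with () ← <⇒≱ (^-monoˡ-< 2 (≰⇒> m≰n)) m²≤n²

  -- The root is that of k, not of j: the number of runs is fixed in advance for all parameters,
  -- while j depends on an unknown neighbor.
  2^k≤2s·paths : ∀ j k → 1 ≤ j → j ≤ k → 2 ^ j ≤ 2 * ⌈√ k ⌉ * paths ⌈ j /2⌉ ⌊ j /2⌋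
  2^k≤2s·paths j k 1≤j j≤k = ^2-cancel-≤ (begin
    (2 ^ j) ^ 2               ≤⟨ balanced-split-bound j 1≤j ⟩
    4 * j * P ^ 2             ≤⟨ *-monoˡ-≤ (P ^ 2) (*-monoʳ-≤ 4 (≤-trans j≤k (k≤⌈√k⌉² k))) ⟩
    4 * ⌈√ k ⌉ ^ 2 * P ^ 2    ≡⟨ lemma ⌈√ k ⌉ P ⟩
    (2 * ⌈√ k ⌉ * P) ^ 2      ∎)
    where
    open ≤-Reasoning
    P : ℕ
    P = paths ⌈ j /2⌉ ⌊ j /2⌋
    lemma : ∀ s P → 4 * (s * (s * 1)) * (P * (P * 1)) ≡ (2 * s * P) * ((2 * s * P) * 1)
    lemma = solve-∀

-- Rational inequalities and expectations over coin tosses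

module Probability where

  open import Data.Bool.Base using (Bool; true; false; if_then_else_)
  import Data.Integer.Base as ℤ
  open import Data.List.Base using (List; []; _∷_; length; filterᵇ)
  open import Data.List.Relation.Ternary.Interleaving.Propositional
    using (Interleaving; []; _∷ˡ_; _∷ʳ_)
  open import Data.Maybe.Base using (Maybe; just; nothing; _<∣>_)
  import Data.Maybe.Relation.Unary.All as Maybe using (All; just; nothing)
  import Data.Maybe.Relation.Unary.Any as Maybe using (just; dec)
  open import Data.Nat.Base as ℕ using (ℕ; zero; suc; _!)
  import Data.Nat.Properties as ℕ
  open import Data.Product.Base using (_×_; _,_)
  open import Data.Rational.Base as ℚ using (ℚ; 0ℚ; 1ℚ; ½; _+_; _*_; _-_; -_; _≤_; normalize; nonNegative; toℚᵘ)
  open import Data.Rational.Properties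
  open import Data.Rational.Solver using (module +-*-Solver)
  open import Data.Rational.Unnormalised.Base as ℚᵘ using (mkℚᵘ)
  import Data.Rational.Unnormalised.Properties as ℚᵘ
  open import Data.Unit.Base using (tt)
  open import Level using (Level)
  open import Relation.Binary.PropositionalEquality.Core
  open import Relation.Binary.PropositionalEquality.Properties using (module ≡-Reasoning)
  open import Relation.Nullary.Decidable.Core using (does)
  open import Relation.Nullary.Decidable using (dec-true)
  open import Relation.Unary using (Pred; Decidable)
  open import Algebra.Properties.CommutativeMonoid.Mult +-0-commutativeMonoid public
    using () renaming (_×_ to _⋆_; ×-homo-+ to ⋆-homo-+; ×-assocˡ to ⋆-assocˡ; ×-distrib-+ to ⋆-distrib-+)
  open Arithmetic

  private variable
    a b p : Level
    A : Set a
    B : Set b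

  ⋆-mono-≤ : ∀ n {x y} → x ≤ y → n ⋆ x ≤ n ⋆ y
  ⋆-mono-≤ zero    x≤y = ≤-refl
  ⋆-mono-≤ (suc n) x≤y = +-mono-≤ x≤y (⋆-mono-≤ n x≤y)

  ⋆-nonNeg : ∀ n {x} → 0ℚ ≤ x → 0ℚ ≤ n ⋆ x
  ⋆-nonNeg zero    0≤x = ≤-refl
  ⋆-nonNeg (suc n) 0≤x = +-mono-≤ 0≤x (⋆-nonNeg n 0≤x)

  ⋆-monoˡ-≤ : ∀ {m n x} → 0ℚ ≤ x → m ℕ.≤ n → m ⋆ x ≤ n ⋆ x
  ⋆-monoˡ-≤ {n = n} 0≤x ℕ.z≤n = ⋆-nonNeg n 0≤x
  ⋆-monoˡ-≤ {x = x} 0≤x (ℕ.s≤s m≤n) = +-monoʳ-≤ x (⋆-monoˡ-≤ 0≤x m≤n)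

  ⋆-mono-< : ∀ n .{{_ : ℕ.NonZero n}} {x y} → x ℚ.< y → n ⋆ x ℚ.< n ⋆ y
  ⋆-mono-< (suc n) x<y = +-mono-<-≤ x<y (⋆-mono-≤ n (<⇒≤ x<y))

  ⋆-cancel-≤ : ∀ n .{{_ : ℕ.NonZero n}} {x y} → n ⋆ x ≤ n ⋆ y → x ≤ y
  ⋆-cancel-≤ n nx≤ny = ≮⇒≥ λ y<x → <-irrefl refl (<-≤-trans (⋆-mono-< n y<x) nx≤ny)

  *-nonNeg : ∀ {x y} → 0ℚ ≤ x → 0ℚ ≤ y → 0ℚ ≤ x * y
  *-nonNeg {x} {y} 0≤x 0≤y =
    nonNegative⁻¹ _ {{nonNeg*nonNeg⇒nonNeg x {{nonNegative 0≤x}} y {{nonNegative 0≤y}}}}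

  -- Doubling the multiplicity cancels the ½ of a toss, so that averages become plain sums.
  ⋆-mean : ∀ n x y → (n ℕ.* 2) ⋆ (½ * (x + y)) ≡ n ⋆ x + n ⋆ y
  ⋆-mean n x y = begin
    (n ℕ.* 2) ⋆ (½ * (x + y)) ≡⟨ ⋆-assocˡ (½ * (x + y)) n 2 ⟨
    n ⋆ (2 ⋆ (½ * (x + y)))
      ≡⟨ cong (n ⋆_) (solve 1 (λ z → con ½ :* z :+ (con ½ :* z :+ con 0ℚ) := z) refl (x + y)) ⟩
    n ⋆ (x + y)               ≡⟨ ⋆-distrib-+ x y n ⟩
    n ⋆ x + n ⋆ y             ∎
    where
    open ≡-Reasoning
    open +-*-Solver

  -- On unnormalised fractions the comparison is an inequality of natural numbers. It serves to show
  -- that each term 1/m! is at most half of the preceding one.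
  reciprocal-double : ∀ m n .{{_ : ℕ.NonZero m}} .{{_ : ℕ.NonZero n}} → 2 ℕ.* n ℕ.≤ m →
                      normalize 1 m + normalize 1 m ≤ normalize 1 n
  reciprocal-double (suc m) (suc n) 2n≤m = toℚᵘ-cancel-≤ (begin
    toℚᵘ (x + x)             ≃⟨ toℚᵘ-homo-+ x x ⟩
    toℚᵘ x ℚᵘ.+ toℚᵘ x
      ≃⟨ ℚᵘ.+-cong (toℚᵘ-fromℚᵘ (mkℚᵘ (ℤ.+ 1) m)) (toℚᵘ-fromℚᵘ (mkℚᵘ (ℤ.+ 1) m)) ⟩
    mkℚᵘ (ℤ.+ 1) m ℚᵘ.+ mkℚᵘ (ℤ.+ 1) m ≤⟨ ℚᵘ.*≤* (ℤ.+≤+ bound) ⟩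
    mkℚᵘ (ℤ.+ 1) n           ≃⟨ toℚᵘ-fromℚᵘ (mkℚᵘ (ℤ.+ 1) n) ⟨
    toℚᵘ (normalize 1 (suc n)) ∎)
    where
    open ℚᵘ.≤-Reasoning
    x : ℚ
    x = normalize 1 (suc m)
    bound : (1 ℕ.* suc m ℕ.+ 1 ℕ.* suc m) ℕ.* suc n ℕ.≤ 1 ℕ.* (suc m ℕ.* suc m)
    bound = ℕ.≤-trans (ℕ.≤-reflexive (lemma (suc m) (suc n))) (ℕ.*-monoʳ-≤ 1 (ℕ.*-monoʳ-≤ (suc m) 2n≤m))
      where
      open import Data.Nat.Tactic.RingSolver using (solve-∀)
      lemma : ∀ d n → (1 ℕ.* d ℕ.+ 1 ℕ.* d) ℕ.* n ≡ 1 ℕ.* (d ℕ.* (2 ℕ.* n))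
      lemma = solve-∀

  1/[1+_]! : ℕ → ℚ
  1/[1+ m ]! = normalize 1 (suc m !) {{suc m ℕ.!≢0}}

  -- The last summand is added once more so that the bound is inductive.
  expSum+1/m!≤3 : ∀ m → expSum (suc m) + 1/[1+ m ]! ≤ 3 ⋆ 1ℚ
  expSum+1/m!≤3 zero    = ≤-refl
  expSum+1/m!≤3 (suc m) = begin
    expSum (suc m) + y + y      ≡⟨ +-assoc (expSum (suc m)) y y ⟩
    expSum (suc m) + (y + y)
      ≤⟨ +-monoʳ-≤ (expSum (suc m)) (reciprocal-double (suc (suc m) !) (suc m !)
          {{suc (suc m) ℕ.!≢0}} {{suc m ℕ.!≢0}}
              (ℕ.*-monoˡ-≤ (suc m !) {2} {suc (suc m)} (ℕ.s≤s (ℕ.s≤s ℕ.z≤n)))) ⟩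
    expSum (suc m) + 1/[1+ m ]! ≤⟨ expSum+1/m!≤3 m ⟩
    3 ⋆ 1ℚ                      ∎
    where
    open ≤-Reasoning
    y : ℚ
    y = 1/[1+ suc m ]!

  expSum≤3 : ∀ m → expSum m ≤ 3 ⋆ 1ℚ
  expSum≤3 zero    = ⋆-monoˡ-≤ {1} {3} (nonNegative⁻¹ 1ℚ) (ℕ.s≤s ℕ.z≤n)
  expSum≤3 (suc m) = begin
    expSum (suc m)              ≡⟨ +-identityʳ (expSum (suc m)) ⟨
    expSum (suc m) + 0ℚ
      ≤⟨ +-monoʳ-≤ (expSum (suc m)) (nonNegative⁻¹ _ {{normalize-nonNeg 1 (suc m !) {{suc m ℕ.!≢0}}}}) ⟩
    expSum (suc m) + 1/[1+ m ]! ≤⟨ expSum+1/m!≤3 m ⟩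
    3 ⋆ 1ℚ                      ∎
    where open ≤-Reasoning

  -- Since x ≤ 1/4 and every partial sum of e is at most 3, their product is at most 1. The factor 4
  -- is 1 + 3, the form in which the bound on failure arrives.
  4x≤1⇒1-x≥1-1/e : ∀ {x} → x * (4 ⋆ 1ℚ) ≤ 1ℚ → (1ℚ - x) ≥1-1/e
  4x≤1⇒1-x≥1-1/e {x} 4x≤1 m = +-monoʳ-≤ 1ℚ (neg-antimono-≤ x≤1/e)
    where
    open ≤-Reasoning
    e : ℚ
    e = expSum m
    instance
      e-pos : ℚ.Positive e
      e-pos = expSum-pos m
      e≢0 : ℚ.NonZero e
      e≢0 = pos⇒nonZero e
    x≤¼ : x ≤ 1ℚ * (ℚ.1/ (4 ⋆ 1ℚ))
    x≤¼ = *-cancelʳ-≤-pos (4 ⋆ 1ℚ) 4x≤1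
    x≤1/e : x ≤ 1/expSum m
    x≤1/e = *-cancelʳ-≤-pos e (begin
      x * e                                ≤⟨ *-monoʳ-≤-nonNeg e {{pos⇒nonNeg e}} x≤¼ ⟩
      1ℚ * (ℚ.1/ (4 ⋆ 1ℚ)) * e
        ≤⟨ *-monoˡ-≤-nonNeg (1ℚ * (ℚ.1/ (4 ⋆ 1ℚ))) (≤-trans (expSum≤3 m) (⋆-monoˡ-≤ {3} {4} (nonNegative⁻¹ 1ℚ) (ℕ.n≤1+n 3))) ⟩
      1ℚ                                   ≡⟨ *-inverseˡ e ⟨
      1/expSum m * e                       ∎)

  open Randomized

  -- `Pr` sees only a predicate on the final outcome and does not pass through `>>=`; the
  -- expectation of an arbitrary function does.
  E : Alg A → (A → ℚ) → ℚ
  E (return x)   f = f x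
  E (charge c t) f = E t f
  E (toss t)     f = ½ * (E (t true) f + E (t false) f)

  -- As a predicate on the leaves of the tree it serves expectations and worst-case step counts
  -- alike.
  Surely : Pred A p → Alg A → Set p
  Surely P (return x)   = P x
  Surely P (charge c t) = Surely P t
  Surely P (toss t)     = ∀ b → Surely P (t b)

  Surely->>= : ∀ {q} {P : Pred A p} {Q : Pred B q} (t : Alg A) {f : A → Alg B} →
               Surely P t → (∀ {x} → P x → Surely Q (f x)) → Surely Q (t >>= f)
  Surely->>= (return x)   Px Qf = Qf Px
  Surely->>= (charge c t) Pt Qf = Surely->>= t Pt Qf
  Surely->>= (toss t)     Pt Qf = λ b → Surely->>= (t b) (Pt b) Qf

  always : {P : Pred A p} → (∀ x → P x) → ∀ t → Surely P t
  always f (return x)   = f x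
  always f (charge c t) = always f t
  always f (toss t)     = λ b → always f (t b)

  Surely-map : ∀ {q} {P : Pred A p} {Q : Pred A q} (t : Alg A) →
               (∀ {x} → P x → Q x) → Surely P t → Surely Q t
  Surely-map (return x)   f Pt = f Pt
  Surely-map (charge c t) f Pt = Surely-map t f Pt
  Surely-map (toss t)     f Pt = λ b → Surely-map (t b) f (Pt b)

  -- The bound M is asked for only at values that t can return, so the continuation may rely on
  -- whatever `Surely` knows about them.
  steps->>= : ∀ {M} (t : Alg A) {f : A → Alg B} → Surely (λ x → steps (f x) ℕ.≤ M) t →
              steps (t >>= f) ℕ.≤ steps t ℕ.+ M
  steps->>= (return x)   h = h
  steps->>= {M = M} (charge c t) h =
    ℕ.≤-trans (ℕ.+-monoʳ-≤ c (steps->>= t h)) (ℕ.≤-reflexive (sym (ℕ.+-assoc c (steps t) M)))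
  steps->>= {M = M} (toss t) h = ℕ.s≤s (ℕ.⊔-lub
    (ℕ.≤-trans (steps->>= (t true) (h true)) (ℕ.+-monoˡ-≤ M (ℕ.m≤m⊔n _ _)))
    (ℕ.≤-trans (steps->>= (t false) (h false)) (ℕ.+-monoˡ-≤ M (ℕ.m≤n⊔m _ _))))

  E->>= : (t : Alg A) {f : A → Alg B} {g : B → ℚ} → E (t >>= f) g ≡ E t (λ x → E (f x) g)
  E->>= (return x)   = refl
  E->>= (charge c t) = E->>= t
  E->>= (toss t)     = cong₂ (λ x y → ½ * (x + y)) (E->>= (t true)) (E->>= (t false))

  E-cong : {P : Pred A p} (t : Alg A) {f g : A → ℚ} → Surely P t →
           (∀ {x} → P x → f x ≡ g x) → E t f ≡ E t g
  E-cong (return x)   Pt f≡g = f≡g Pt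
  E-cong (charge c t) Pt f≡g = E-cong t Pt f≡g
  E-cong (toss t)     Pt f≡g =
    cong₂ (λ x y → ½ * (x + y)) (E-cong (t true) (Pt true) f≡g) (E-cong (t false) (Pt false) f≡g)

  E-nonNeg : (t : Alg A) {f : A → ℚ} → (∀ x → 0ℚ ≤ f x) → 0ℚ ≤ E t f
  E-nonNeg (return x)   0≤f = 0≤f x
  E-nonNeg (charge c t) 0≤f = E-nonNeg t 0≤f
  E-nonNeg (toss t)     0≤f =
    *-nonNeg (nonNegative⁻¹ ½) (+-mono-≤ (E-nonNeg (t true) 0≤f) (E-nonNeg (t false) 0≤f))

  E-*ʳ : (t : Alg A) {f : A → ℚ} (c : ℚ) → E t (λ x → f x * c) ≡ E t f * c
  E-*ʳ (return x)   c = refl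
  E-*ʳ (charge _ t) c = E-*ʳ t c
  E-*ʳ (toss t) {f} c = trans (cong₂ (λ x y → ½ * (x + y)) (E-*ʳ (t true) {f} c) (E-*ʳ (t false) {f} c))
    (solve 3 (λ x y c → con ½ :* (x :* c :+ y :* c) := con ½ :* (x :+ y) :* c) refl (E (t true) f) (E (t false) f) c)
    where open +-*-Solver

  module _ {P : Pred A p} (P? : Decidable P) where

    -- The indicator of failure is used because failures, not successes, multiply over independent
    -- runs.
    miss : A → ℚ
    miss x = if does (P? x) then 0ℚ else 1ℚ

    miss-nonNeg : ∀ x → 0ℚ ≤ miss x
    miss-nonNeg x with does (P? x)
    ... | true  = ≤-refl
    ... | false = nonNegative⁻¹ 1ℚ

    Pr-nonNeg : ∀ t → 0ℚ ≤ Pr P? t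
    Pr-nonNeg (return x) with does (P? x)
    ... | true  = nonNegative⁻¹ 1ℚ
    ... | false = ≤-refl
    Pr-nonNeg (charge c t) = Pr-nonNeg t
    Pr-nonNeg (toss t) =
      *-nonNeg (nonNegative⁻¹ ½) (+-mono-≤ (Pr-nonNeg (t true)) (Pr-nonNeg (t false)))

    Pr≡1-E-miss : ∀ t → Pr P? t ≡ 1ℚ - E t miss
    Pr≡1-E-miss (return x) with does (P? x)
    ... | true  = refl
    ... | false = refl
    Pr≡1-E-miss (charge c t) = Pr≡1-E-miss t
    Pr≡1-E-miss (toss t) =
      trans (cong₂ (λ x y → ½ * (x + y)) (Pr≡1-E-miss (t true)) (Pr≡1-E-miss (t false)))
        (solve 2 (λ x y → con ½ :* ((con 1ℚ :- x) :+ (con 1ℚ :- y)) := con 1ℚ :- con ½ :* (x :+ y))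
          refl (E (t true) miss) (E (t false) miss))
      where open +-*-Solver

    Pr≡E : ∀ t → Pr P? t ≡ E t (λ x → if does (P? x) then 1ℚ else 0ℚ)
    Pr≡E (return x)   = refl
    Pr≡E (charge c t) = Pr≡E t
    Pr≡E (toss t)     = cong₂ (λ x y → ½ * (x + y)) (Pr≡E (t true)) (Pr≡E (t false))

    E-miss≤1 : ∀ t → E t miss ≤ 1ℚ
    E-miss≤1 t = begin
      m                  ≡⟨ solve 1 (λ m → m := con 0ℚ :+ m) refl m ⟩
      0ℚ + m             ≤⟨ +-monoˡ-≤ m (Pr-nonNeg t) ⟩
      Pr P? t + m        ≡⟨ cong (_+ m) (Pr≡1-E-miss t) ⟩
      1ℚ - m + m         ≡⟨ solve 1 (λ m → con 1ℚ :- m :+ m := con 1ℚ) refl m ⟩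
      1ℚ                 ∎
      where
      open ≤-Reasoning
      open +-*-Solver
      m : ℚ
      m = E t miss

  module _ {P : Pred A p} (P? : Decidable P) where

    missAny : Maybe A → ℚ
    missAny = miss (Maybe.dec P?)

    Sound : Alg (Maybe A) → Set _
    Sound = Surely (Maybe.All P)

    -- A `just` on the left decides the outcome alone, so the product formula requires it to be a
    -- success; an unsound report would hide a success of y.
    missAny-<∣> : ∀ {x} → Maybe.All P x → ∀ y → missAny (x <∣> y) ≡ missAny x * missAny y
    missAny-<∣> Maybe.nothing       y = sym (*-identityˡ (missAny y))
    missAny-<∣> (Maybe.just {x} px) y
      rewrite dec-true (Maybe.dec P? (just x)) (Maybe.just px) = sym (*-zeroˡ (missAny y))

    Sound-<∣> : ∀ (t u : Alg (Maybe A)) → Sound t → Sound u →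
                Sound (t >>= λ x → u >>= λ y → tick >>= λ _ → return (x <∣> y))
    Sound-<∣> t u st su = Surely->>= t st λ
      { Maybe.nothing     → Surely->>= u su λ py → py
      ; (Maybe.just px) → Surely->>= u su λ _ → Maybe.just px }

    -- Independence: the same tree u hangs at every leaf of t, so after `missAny-<∣>` its
    -- expectation is a constant factor.
    E-miss-<∣> : ∀ (t u : Alg (Maybe A)) → Sound t →
                 E (t >>= λ x → u >>= λ y → tick >>= λ _ → return (x <∣> y)) missAny
                   ≡ E t missAny * E u missAny
    E-miss-<∣> t u st = begin
      E (t >>= λ x → u >>= λ y → tick >>= λ _ → return (x <∣> y)) missAny
        ≡⟨ E->>= t ⟩
      E t (λ x → E (u >>= λ y → tick >>= λ _ → return (x <∣> y)) missAny)
        ≡⟨ E-cong t st (λ {x} sx → trans (E->>= u) (trans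
             (E-cong u (always (λ _ → tt) u) (λ {y} _ → trans (missAny-<∣> sx y) (*-comm (missAny x) _)))
             (trans (E-*ʳ u (missAny x)) (*-comm _ (missAny x))))) ⟩
      E t (λ x → missAny x * E u missAny)
        ≡⟨ E-*ʳ t (E u missAny) ⟩
      E t missAny * E u missAny ∎
      where
      open ≡-Reasoning

    Sound-repeat : ∀ r {t : Alg (Maybe A)} → Sound t → Sound (repeat r t)
    Sound-repeat zero    st = Maybe.nothing
    Sound-repeat (suc r) {t} st = Sound-<∣> t (repeat r t) st (Sound-repeat r st)

    -- (1 - q)^r (1 + r q) ≤ 1 takes the place of (1 - q)^r ≤ exp (- r q).
    E-miss-repeat : ∀ r {t : Alg (Maybe A)} → Sound t →
      E (repeat r t) missAny * (1ℚ + r ⋆ Pr (Maybe.dec P?) t) ≤ 1ℚ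
    E-miss-repeat zero st = ≤-refl
    E-miss-repeat (suc r) {t} st = begin
      E (repeat (suc r) t) missAny * (1ℚ + (q + rq))
        ≡⟨ cong (_* (1ℚ + (q + rq))) (E-miss-<∣> t (repeat r t) st) ⟩
      m * f * (1ℚ + (q + rq))
        ≡⟨ cong (λ q → m * f * (1ℚ + (q + rq))) (Pr≡1-E-miss (Maybe.dec P?) t) ⟩
      m * f * (1ℚ + (1ℚ - m + rq))                   ≡⟨ +-identityʳ _ ⟨
      m * f * (1ℚ + (1ℚ - m + rq)) + 0ℚ              ≤⟨ +-monoʳ-≤ (m * f * (1ℚ + (1ℚ - m + rq)))
             (*-nonNeg (*-nonNeg f≥0 q≥0) (+-mono-≤ q≥0 (⋆-nonNeg r q≥0))) ⟩
      m * f * (1ℚ + (1ℚ - m + rq)) + f * q * (q + rq)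
        ≡⟨ cong (λ q → m * f * (1ℚ + (1ℚ - m + rq)) + f * q * (q + rq)) (Pr≡1-E-miss (Maybe.dec P?) t) ⟩
      m * f * (1ℚ + (1ℚ - m + rq)) + f * (1ℚ - m) * (1ℚ - m + rq)
        ≡⟨ solve 3 (λ m f rq → m :* f :* (con 1ℚ :+ (con 1ℚ :- m :+ rq)) :+ f :* (con 1ℚ :- m) :* (con 1ℚ :- m :+ rq)
                       := f :* (con 1ℚ :+ rq)) refl m f rq ⟩
      f * (1ℚ + rq)                                  ≤⟨ E-miss-repeat r st ⟩
      1ℚ                                             ∎
      where
      open ≤-Reasoning
      open +-*-Solver
      m f q rq : ℚ
      m  = E t missAny
      f  = E (repeat r t) missAny
      q  = Pr (Maybe.dec P?) t
      rq = r ⋆ q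
      q≥0 : 0ℚ ≤ q
      q≥0 = Pr-nonNeg (Maybe.dec P?) t
      f≥0 : 0ℚ ≤ f
      f≥0 = E-nonNeg (repeat r t) (miss-nonNeg (Maybe.dec P?))

  -- Random splits of a list

  split-interleaving : (xs : List A) → Surely (λ (as , bs) → Interleaving as bs xs) (split xs)
  split-interleaving []       = []
  split-interleaving (x ∷ xs) true  = Surely->>= (split xs) (split-interleaving xs) (refl ∷ˡ_)
  split-interleaving (x ∷ xs) false = Surely->>= (split xs) (split-interleaving xs) (refl ∷ʳ_)

  steps-split : {A : Set a} (xs : List A) → steps (split xs) ℕ.≤ 2 ℕ.* length xs ℕ.+ 1
  steps-split []       = ℕ.≤-refl
  steps-split {A = A} (x ∷ xs) = ℕ.≤-trans
      (ℕ.s≤s (ℕ.⊔-lub (half {λ (as , bs) → x ∷ as , bs}) (half {λ (as , bs) → as , x ∷ bs})))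
          (ℕ.≤-reflexive (lemma (length xs)))
    where
    open import Data.Nat.Tactic.RingSolver using (solve-∀)
    lemma : ∀ n → suc (2 ℕ.* n ℕ.+ 1 ℕ.+ 1) ≡ 2 ℕ.* suc n ℕ.+ 1
    lemma = solve-∀
    half : ∀ {f : List A × List A → List A × List A} →
        steps (split xs >>= λ z → charge 1 (return (f z))) ℕ.≤ 2 ℕ.* length xs ℕ.+ 1 ℕ.+ 1
    half {f} = ℕ.≤-trans (steps->>= (split xs) (always (λ _ → ℕ.≤-refl) (split xs))) (ℕ.+-monoˡ-≤ 1 (steps-split xs))

  module _ {A : Set a} (marked : A → Bool) where

    #marked : List A → ℕ
    #marked xs = length (filterᵇ marked xs)

    -- A marked element goes to either side with probability 1/2, so recursion on the list is
    -- Pascal's rule for `paths`. The function f generalises an indicator of success: being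
    -- nonnegative, and at least 1 on the splits with counts a and b, passes to its restrictions to
    -- the two branches, with the counts adjusted.
    E-split : ∀ xs a b (f : List A × List A → ℚ) → (∀ z → 0ℚ ≤ f z) →
      (∀ {as bs} → Interleaving as bs xs → #marked as ≡ a → #marked bs ≡ b → 1ℚ ≤ f (as , bs)) →
      a ℕ.+ b ≡ #marked xs →
      paths a b ⋆ 1ℚ ≤ (2 ℕ.^ (a ℕ.+ b)) ⋆ E (split xs) f
    E-split [] zero zero f 0≤f 1≤f eq = +-monoˡ-≤ 0ℚ (1≤f [] refl refl)
    -- The value of `marked x` becomes an argument of `go` together with its equation, so that it
    -- can be split on along with a and b.
    E-split (x ∷ xs) a b f 0≤f 1≤f eq = ≤-trans (go a b (marked x) refl 1≤f eq)
      (≤-reflexive (cong ((2 ℕ.^ (a ℕ.+ b)) ⋆_) (sym E-∷)))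
      where
      fˡ fʳ : List A × List A → ℚ
      fˡ (as , bs) = f (x ∷ as , bs)
      fʳ (as , bs) = f (as , x ∷ bs)
      u v : ℚ
      u = E (split xs) fˡ
      v = E (split xs) fʳ
      u≥0 : 0ℚ ≤ u
      u≥0 = E-nonNeg (split xs) (λ _ → 0≤f _)
      v≥0 : 0ℚ ≤ v
      v≥0 = E-nonNeg (split xs) (λ _ → 0≤f _)
      E-∷ : E (split (x ∷ xs)) f ≡ ½ * (u + v)
      E-∷ = cong₂ (λ x y → ½ * (x + y)) (E->>= (split xs)) (E->>= (split xs))
      unmarked-∷ : marked x ≡ false → ∀ ys → #marked (x ∷ ys) ≡ #marked ys
      unmarked-∷ mx ys rewrite mx = refl
      marked-∷ : marked x ≡ true → ∀ ys → #marked (x ∷ ys) ≡ suc (#marked ys)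
      marked-∷ mx ys rewrite mx = refl
      Covered : ℕ → ℕ → Set _
      Covered a b = ∀ {as bs} → Interleaving as bs (x ∷ xs) → #marked as ≡ a → #marked bs ≡ b → 1ℚ ≤ f (as , bs)
      open ≤-Reasoning
      double : ∀ n {z u v} → z ≤ (2 ℕ.^ n) ⋆ u + (2 ℕ.^ n) ⋆ v → z ≤ (2 ℕ.^ suc n) ⋆ (½ * (u + v))
      double n {z} {u} {v} z≤ = begin
        z                                     ≤⟨ z≤ ⟩
        (2 ℕ.^ n) ⋆ u + (2 ℕ.^ n) ⋆ v         ≡⟨ ⋆-mean (2 ℕ.^ n) u v ⟨
        (2 ℕ.^ n ℕ.* 2) ⋆ (½ * (u + v))       ≡⟨ cong (_⋆ (½ * (u + v))) (ℕ.*-comm (2 ℕ.^ n) 2) ⟩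
        (2 ℕ.^ suc n) ⋆ (½ * (u + v))         ∎
      go : ∀ a b m → marked x ≡ m → Covered a b → a ℕ.+ b ≡ #marked (x ∷ xs) →
           paths a b ⋆ 1ℚ ≤ (2 ℕ.^ (a ℕ.+ b)) ⋆ (½ * (u + v))
      -- An unmarked x leaves both counts as they are, so the claim is the mean of two equal bounds;
      -- it is doubled to remove the ½.
      go a b false mx 1≤f eq = ⋆-cancel-≤ 2 (begin
        2 ⋆ z                     ≡⟨ cong (z +_) (+-identityʳ z) ⟩
        z + z                     ≤⟨ +-mono-≤
          (E-split xs a b fˡ (λ _ → 0≤f _) (λ i p q → 1≤f (refl ∷ˡ i) (trans (unmarked-∷ mx _) p) q) (trans eq (unmarked-∷ mx xs)))
          (E-split xs a b fʳ (λ _ → 0≤f _) (λ i p q → 1≤f (refl ∷ʳ i) p (trans (unmarked-∷ mx _) q)) (trans eq (unmarked-∷ mx xs))) ⟩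
        n ⋆ u + n ⋆ v             ≡⟨ ⋆-mean n u v ⟨
        (n ℕ.* 2) ⋆ w             ≡⟨ cong (_⋆ w) (ℕ.*-comm n 2) ⟩
        (2 ℕ.* n) ⋆ w             ≡⟨ ⋆-assocˡ w 2 n ⟨
        2 ⋆ (n ⋆ w)               ∎)
        where
        n : ℕ
        n = 2 ℕ.^ (a ℕ.+ b)
        z w : ℚ
        z = paths a b ⋆ 1ℚ
        w = ½ * (u + v)
      go zero zero true mx 1≤f eq with () ← trans eq (marked-∷ mx xs)
      -- No marked element may go to A here, so the branch with x in A contributes only u ≥ 0.
      go zero (suc b) true mx 1≤f eq = double b (begin
        1 ⋆ 1ℚ                    ≡⟨ +-identityˡ (1 ⋆ 1ℚ) ⟨
        0ℚ + 1 ⋆ 1ℚ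
          ≤⟨ +-mono-≤ (⋆-nonNeg (2 ℕ.^ b) u≥0) (E-split xs 0 b fʳ (λ _ → 0≤f _)
                                       (λ i p q → 1≤f (refl ∷ʳ i) p (trans (marked-∷ mx _) (cong suc q)))
                                       (ℕ.suc-injective (trans eq (marked-∷ mx xs)))) ⟩
        (2 ℕ.^ b) ⋆ u + (2 ℕ.^ b) ⋆ v ∎)
      go (suc a) zero true mx 1≤f eq = double (a ℕ.+ 0) (begin
        1 ⋆ 1ℚ                    ≡⟨ cong (_⋆ 1ℚ) (paths-zeroʳ a) ⟨
        paths a 0 ⋆ 1ℚ            ≡⟨ +-identityʳ (paths a 0 ⋆ 1ℚ) ⟨
        paths a 0 ⋆ 1ℚ + 0ℚ       ≤⟨ +-mono-≤ (E-split xs a 0 fˡ (λ _ → 0≤f _)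
                                       (λ i p q → 1≤f (refl ∷ˡ i) (trans (marked-∷ mx _) (cong suc p)) q)
                                       (ℕ.suc-injective (trans eq (marked-∷ mx xs)))) (⋆-nonNeg (2 ℕ.^ (a ℕ.+ 0)) v≥0) ⟩
        (2 ℕ.^ (a ℕ.+ 0)) ⋆ u + (2 ℕ.^ (a ℕ.+ 0)) ⋆ v ∎)
        where
        paths-zeroʳ : ∀ a → paths a 0 ≡ 1
        paths-zeroʳ a = trans (paths-comm a 0) refl
      -- The two summands of Pascal's rule are the branches with x in A and with x in B.
      go (suc a) (suc b) true mx 1≤f eq = double (a ℕ.+ suc b) (begin
        (paths a (suc b) ℕ.+ paths (suc a) b) ⋆ 1ℚ
          ≡⟨ ⋆-homo-+ 1ℚ (paths a (suc b)) (paths (suc a) b) ⟩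
        paths a (suc b) ⋆ 1ℚ + paths (suc a) b ⋆ 1ℚ     ≤⟨ +-mono-≤
          (E-split xs a (suc b) fˡ (λ _ → 0≤f _)
            (λ i p q → 1≤f (refl ∷ˡ i) (trans (marked-∷ mx _) (cong suc p)) q) eq′)
          (E-split xs (suc a) b fʳ (λ _ → 0≤f _)
            (λ i p q → 1≤f (refl ∷ʳ i) p (trans (marked-∷ mx _) (cong suc q))) (trans (sym (ℕ.+-suc a b)) eq′)) ⟩
        n ⋆ u + (2 ℕ.^ (suc a ℕ.+ b)) ⋆ v
          ≡⟨ cong (λ m → n ⋆ u + (2 ℕ.^ m) ⋆ v) (ℕ.+-suc a b) ⟨
        n ⋆ u + n ⋆ v                                   ∎)
        where
        n : ℕ
        n = 2 ℕ.^ (a ℕ.+ suc b)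
        eq′ : a ℕ.+ suc b ≡ #marked xs
        eq′ = ℕ.suc-injective (trans eq (marked-∷ mx xs))

-- Neighbors, loads and transfers between the machines

module Schedules where

  open import Algebra.Bundles using (AbelianGroup)
  open import Data.Bool.Base using (Bool; true; false; not; if_then_else_; _xor_)
  open import Data.Bool.Properties using (not-involutive)
  open import Data.Empty using (⊥-elim)
  open import Data.Fin.Base using (Fin; zero; suc)
  import Data.Fin.Properties as Fin
  open import Data.Fin.Subset using (Subset; _⊆_; _─_; _∪_; ∁; ∣_∣)
  open import Data.Fin.Subset.Properties using (∣p∣≤∣x∷p∣)
  open import Data.List.Base using (List; []; _∷_; _++_; length; filterᵇ; allFin; tabulate)
  open import Data.List.Relation.Unary.All as All using (All; []; _∷_)
  open import Data.List.Relation.Unary.AllPairs using ([]; _∷_)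
  open import Data.List.Relation.Unary.Unique.Propositional using (Unique)
  open import Data.List.Relation.Ternary.Interleaving.Propositional
    using (Interleaving; []; _∷ˡ_; _∷ʳ_)
  open import Data.Nat.Base as ℕ using (ℕ; zero; suc; z≤n; s≤s)
  import Data.Nat.Properties as ℕ
  open import Data.Product.Base using (_×_; _,_)
  open import Data.Sum.Base using (_⊎_; inj₁; inj₂)
  open import Data.Vec.Base as Vec using (Vec; []; _∷_; lookup; updateAt)
  import Data.Vec.Properties as Vec
  open import Data.Vec.Functional using (Vector)
  open import Function.Base using (_∘_; id)
  open import Relation.Binary.Definitions using (tri<; tri≈; tri>)
  open import Relation.Binary.PropositionalEquality.Core as ≡ using (_≡_; _≢_; refl; cong; cong₂)
  open import Relation.Binary.Structures using (IsStrictTotalOrder)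
  open import Relation.Nullary.Decidable.Core using (yes; no)
  open import Relation.Nullary.Negation.Core using (¬_)
  open Probability using (#marked)

  flips : ∀ {n} → List (Fin n) → Schedule n → Schedule n
  flips []       σ = σ
  flips (j ∷ js) σ = flips js (updateAt σ j not)

  flips-++ : ∀ {n} (js ks : List (Fin n)) σ → flips (js ++ ks) σ ≡ flips ks (flips js σ)
  flips-++ []       ks σ = refl
  flips-++ (j ∷ js) ks σ = flips-++ js ks (updateAt σ j not)

  lookup-jobs-flip : ∀ {n} (σ : Schedule n) i j →
                     lookup (jobs (updateAt σ j not) i) j ≡ lookup (jobs σ (other i)) j
  lookup-jobs-flip σ m₁ j = ≡.trans (Vec.lookup∘updateAt j σ) (≡.sym (Vec.lookup-map j not σ))
  lookup-jobs-flip σ m₂ j = ≡.trans (Vec.lookup-map j not (updateAt σ j not))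
    (≡.trans (cong not (Vec.lookup∘updateAt j σ)) (not-involutive (lookup σ j)))

  lookup-jobs-minimal : ∀ {n} (σ : Schedule n) i j {j′} → j′ ≢ j →
                        lookup (jobs (updateAt σ j not) i) j′ ≡ lookup (jobs σ i) j′
  lookup-jobs-minimal σ m₁ j {j′} j′≢j = Vec.lookup∘updateAt′ j′ j j′≢j σ
  lookup-jobs-minimal σ m₂ j {j′} j′≢j = ≡.trans (Vec.lookup-map j′ not (updateAt σ j not))
    (≡.trans (cong not (Vec.lookup∘updateAt′ j′ j j′≢j σ)) (≡.sym (Vec.lookup-map j′ not σ)))

  -- The Hamming distance, kept as two one-sided differences because these are the sets S₁ and S₂ of
  -- a `Neighbor`.
  distance : ∀ {n} → Schedule n → Schedule n → ℕ
  distance σ τ = ∣ σ ─ τ ∣ ℕ.+ ∣ τ ─ σ ∣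

  distance-refl : ∀ {n} (σ : Schedule n) → distance σ σ ≡ 0
  distance-refl []          = refl
  distance-refl (true ∷ σ)  = distance-refl σ
  distance-refl (false ∷ σ) = distance-refl σ

  distance-flip : ∀ {n} (σ τ : Schedule n) j → distance σ (updateAt τ j not) ℕ.≤ suc (distance σ τ)
  distance-flip (true ∷ σ)  (true ∷ τ)  zero    = ℕ.≤-refl
  distance-flip (true ∷ σ)  (false ∷ τ) zero    = ℕ.≤-trans (ℕ.n≤1+n _) (ℕ.n≤1+n _)
  distance-flip (false ∷ σ) (true ∷ τ)  zero    = ℕ.≤-trans (ℕ.+-monoʳ-≤ ∣ σ ─ τ ∣ (ℕ.n≤1+n _)) (ℕ.n≤1+n _)
  distance-flip (false ∷ σ) (false ∷ τ) zero    = ℕ.≤-reflexive (ℕ.+-suc ∣ σ ─ τ ∣ _)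
  distance-flip (true ∷ σ)  (true ∷ τ)  (suc j) = distance-flip σ τ j
  distance-flip (true ∷ σ)  (false ∷ τ) (suc j) = s≤s (distance-flip σ τ j)
  distance-flip (false ∷ σ) (true ∷ τ)  (suc j) =
    ℕ.≤-trans (ℕ.≤-reflexive (ℕ.+-suc ∣ σ ─ updateAt τ j not ∣ _))
      (ℕ.≤-trans (s≤s (distance-flip σ τ j)) (s≤s (ℕ.≤-reflexive (≡.sym (ℕ.+-suc ∣ σ ─ τ ∣ _)))))
  distance-flip (false ∷ σ) (false ∷ τ) (suc j) = distance-flip σ τ j

  distance-flips : ∀ {n} (σ τ : Schedule n) js → distance σ (flips js τ) ℕ.≤ length js ℕ.+ distance σ τ
  distance-flips σ τ []       = ℕ.≤-refl
  distance-flips σ τ (j ∷ js) = ℕ.≤-trans (distance-flips σ (updateAt τ j not) js)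
    (ℕ.≤-trans (ℕ.+-monoʳ-≤ (length js) (distance-flip σ τ j)) (ℕ.≤-reflexive (ℕ.+-suc (length js) _)))

  Neighbor-distance : ∀ {n k} (σ τ : Schedule n) → distance σ τ ℕ.≤ k → Neighbor k σ τ
  Neighbor-distance σ τ d≤k =
    σ ─ τ , τ ─ σ , ─-⊆ σ τ , ─-⊆-∁ σ τ , d≤k , ─-∪ σ τ
    where
    open import Data.Vec.Base using (here; there)
    ─-⊆ : ∀ {n} (σ τ : Subset n) → σ ─ τ ⊆ σ
    ─-⊆ (true ∷ σ)  (false ∷ τ) here        = here
    ─-⊆ (_ ∷ σ)     (_ ∷ τ)     (there x∈)  = there (─-⊆ σ τ x∈)
    ─-⊆ (false ∷ σ) (true ∷ τ)  {zero} ()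
    ─-⊆ (false ∷ σ) (false ∷ τ) {zero} ()
    ─-⊆-∁ : ∀ {n} (σ τ : Subset n) → τ ─ σ ⊆ ∁ σ
    ─-⊆-∁ (false ∷ σ) (true ∷ τ) here       = here
    ─-⊆-∁ (_ ∷ σ)     (_ ∷ τ)    (there x∈) = there (─-⊆-∁ σ τ x∈)
    ─-∪ : ∀ {n} (σ τ : Subset n) → τ ≡ (σ ─ (σ ─ τ)) ∪ (τ ─ σ)
    ─-∪ []          []          = refl
    ─-∪ (true ∷ σ)  (true ∷ τ)  = cong (true ∷_) (─-∪ σ τ)
    ─-∪ (true ∷ σ)  (false ∷ τ) = cong (false ∷_) (─-∪ σ τ)
    ─-∪ (false ∷ σ) (true ∷ τ)  = cong (true ∷_) (─-∪ σ τ)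
    ─-∪ (false ∷ σ) (false ∷ τ) = cong (false ∷_) (─-∪ σ τ)

  -- Each flip changes the Hamming distance by at most one; arguing through the distance spares
  -- sorting the flipped jobs by machine.
  Neighbor-flips : ∀ {n k} (σ : Schedule n) js → length js ℕ.≤ k → Neighbor k σ (flips js σ)
  Neighbor-flips {k = k} σ js js≤k = Neighbor-distance σ (flips js σ) (begin
    distance σ (flips js σ)     ≤⟨ distance-flips σ σ js ⟩
    length js ℕ.+ distance σ σ  ≡⟨ cong (length js ℕ.+_) (distance-refl σ) ⟩
    length js ℕ.+ 0             ≡⟨ ℕ.+-identityʳ (length js) ⟩
    length js                   ≤⟨ js≤k ⟩
    k                           ∎)
    where open ℕ.≤-Reasoning

  differ : ∀ {n} → Schedule n → Schedule n → Fin n → Bool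
  differ σ τ j = lookup σ j xor lookup τ j

  -- A job on which the schedules differ lies in S₁ or in S₂. This count will be the parameter j
  -- whose runs are analysed.
  #differ≤k : ∀ {n k} (σ τ : Schedule n) → Neighbor k σ τ → #marked (differ σ τ) (allFin n) ℕ.≤ k
  #differ≤k {n} σ _ (S₁ , S₂ , _ , _ , S≤k , refl) =
    ℕ.≤-trans (count S₁ S₂ id (λ j → differ⇒moved σ S₁ S₂ j)) S≤k
    where
    differ⇒moved : ∀ {n} (σ S₁ S₂ : Subset n) j → differ σ ((σ ─ S₁) ∪ S₂) j ≡ true →
                   lookup S₁ j ≡ true ⊎ lookup S₂ j ≡ true
    differ⇒moved (_ ∷ _)     (true ∷ _)  (_ ∷ _)    zero _ = inj₁ refl
    differ⇒moved (_ ∷ _)     (false ∷ _) (true ∷ _) zero _ = inj₂ refl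
    differ⇒moved (true ∷ _)  (false ∷ _) (false ∷ _) zero ()
    differ⇒moved (false ∷ _) (false ∷ _) (false ∷ _) zero ()
    differ⇒moved (_ ∷ σ) (_ ∷ S₁) (_ ∷ S₂) (suc j) d = differ⇒moved σ S₁ S₂ j d
    d : Fin n → Bool
    d = differ σ ((σ ─ S₁) ∪ S₂)
    -- The renaming g lets the induction shorten the two sets while d keeps its domain.
    count : ∀ {m} (T₁ T₂ : Subset m) (g : Fin m → Fin n) →
            (∀ j → d (g j) ≡ true → lookup T₁ j ≡ true ⊎ lookup T₂ j ≡ true) →
            #marked d (tabulate g) ℕ.≤ ∣ T₁ ∣ ℕ.+ ∣ T₂ ∣
    count []       []       g h = z≤n
    count (x ∷ T₁) (y ∷ T₂) g h with d (g zero) in eq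
    ... | false = ℕ.≤-trans (count T₁ T₂ (g ∘ suc) (h ∘ suc))
                    (ℕ.+-mono-≤ (∣p∣≤∣x∷p∣ x T₁) (∣p∣≤∣x∷p∣ y T₂))
    ... | true with h zero eq
    ...   | inj₁ refl = s≤s (ℕ.≤-trans (count T₁ T₂ (g ∘ suc) (h ∘ suc)) (ℕ.+-monoʳ-≤ ∣ T₁ ∣ (∣p∣≤∣x∷p∣ y T₂)))
    ...   | inj₂ refl = ℕ.≤-trans (s≤s (count T₁ T₂ (g ∘ suc) (h ∘ suc)))
            (ℕ.≤-trans (s≤s (ℕ.+-monoˡ-≤ ∣ T₂ ∣ (∣p∣≤∣x∷p∣ x T₁))) (ℕ.≤-reflexive (≡.sym (ℕ.+-suc ∣ x ∷ T₁ ∣ ∣ T₂ ∣))))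

  module _ {c ℓ₁ ℓ₂} (G : OrderedAbelianGroup c ℓ₁ ℓ₂) where

    open OrderedAbelianGroup G
    open IsStrictTotalOrder isStrictTotalOrder using (compare; <-respʳ-≈; <-respˡ-≈; asym)
      renaming (trans to <-trans; irrefl to <-irrefl)
    open AbelianGroup abelianGroup
      using (setoid; group; commutativeMonoid; commutativeSemigroup; assoc; comm; identityˡ; identityʳ; inverseˡ; inverseʳ;
          ∙-cong; ∙-congˡ; ∙-congʳ; ⁻¹-cong)
      renaming (refl to ≈-refl; sym to ≈-sym; trans to ≈-trans; reflexive to ≈-reflexive)
    open import Algebra.Properties.AbelianGroup abelianGroup using (⁻¹-anti-homo‿-; ⁻¹-∙-comm)
    open import Algebra.Properties.Group group using (ε⁻¹≈ε; //-rightDividesˡ; //-rightDividesʳ)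
    open import Algebra.Properties.CommutativeSemigroup commutativeSemigroup
      using (interchange)
    open import Algebra.Properties.CommutativeMonoid.Sum commutativeMonoid using (∑-distrib-+; sum-cong-≋)

    <-shift : ∀ z {x y x′ y′} → x + z ≈ x′ → y + z ≈ y′ → x < y → x′ < y′
    <-shift z x+z≈x′ y+z≈y′ x<y = <-respʳ-≈ y+z≈y′ (<-respˡ-≈ x+z≈x′ (+-monoˡ-< z x<y))

    -- The group comes with a strict order only; a weak inequality is expressed as the negation of
    -- the reversed strict one.
    ≮-<-trans : ∀ {x y z} → ¬ (y < x) → y < z → x < z
    ≮-<-trans {x} {y} y≮x y<z with compare x y
    ... | tri< x<y _ _ = <-trans x<y y<z
    ... | tri≈ _ x≈y _ = <-respˡ-≈ (≈-sym x≈y) y<z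
    ... | tri> _ _ y<x = ⊥-elim (y≮x y<x)

    <-≮-trans : ∀ {x y z} → x < y → ¬ (z < y) → x < z
    <-≮-trans {x} {y} {z} x<y z≮y with compare y z
    ... | tri< y<z _ _ = <-trans x<y y<z
    ... | tri≈ _ y≈z _ = <-respʳ-≈ y≈z x<y
    ... | tri> _ _ z<y = ⊥-elim (z≮y z<y)

    ≮-trans : ∀ {x y z} → ¬ (y < x) → ¬ (z < y) → ¬ (z < x)
    ≮-trans y≮x z≮y z<x = y≮x (≮-<-trans z≮y z<x)

    module _ {a b a′ b′ d} (a′+d≈a : a′ + d ≈ a) (b′≈b+d : b′ ≈ b + d) where

      -- Here a and b stand for the loads of the critical and the other machine, and d is the net
      -- load moved from the first to the second. Then a′ < a amounts to 0 < d, and b′ < a amounts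
      -- to d < a - b.
      transfer-improves : 0# < d → d < a - b → a′ < a × b′ < a
      transfer-improves 0<d d<a-b =
        <-shift a′ (identityˡ a′) (≈-trans (comm d a′) a′+d≈a) 0<d ,
        <-shift b (≈-trans (comm d b) (≈-sym b′≈b+d)) (//-rightDividesˡ b a) d<a-b

      improves-transfer : a′ < a → b′ < a → 0# < d × d < a - b
      improves-transfer a′<a b′<a =
        <-shift (- a′) (inverseʳ a′) (a-a′≈d a′+d≈a) a′<a ,
        <-shift (- b) (a-a′≈d (≈-sym b′≈b+d)) ≈-refl b′<a
        where
        a-a′≈d : ∀ {a a′ d} → a′ + d ≈ a → a - a′ ≈ d
        a-a′≈d {a} {a′} {d} eq = ≈-trans (∙-congʳ (≈-trans (≈-sym eq) (comm a′ d))) (//-rightDividesʳ a′ d)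

    -- Adding x to all sides turns the search interval for y into the condition on the total. The
    -- total is a separate d because sums agree only up to `≈`.
    window : ∀ {x y d Δ} → x + y ≈ d → - x < y → y < Δ - x → 0# < d × d < Δ
    window {x} {y} {d} {Δ} x+y≈d l u =
      <-shift x (inverseˡ x) (≈-trans (comm y x) x+y≈d) l ,
      <-shift x (≈-trans (comm y x) x+y≈d) (//-rightDividesˡ x Δ) u

    window⁻¹ : ∀ {x y d Δ} → x + y ≈ d → 0# < d → d < Δ → - x < y × y < Δ - x
    window⁻¹ {x} {y} {d} {Δ} x+y≈d l u =
      <-shift (- x) (identityˡ (- x)) d-x≈y l ,
      <-shift (- x) d-x≈y ≈-refl u
      where
      d-x≈y : d - x ≈ y
      d-x≈y = ≈-trans (∙-congʳ (≈-trans (≈-sym x+y≈d) (comm x y))) (//-rightDividesʳ x y)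

    max≈ˡ : ∀ {x y} → ¬ (x < y) → max x y ≈ x
    max≈ˡ {x} {y} x≮y with x <? y
    ... | yes x<y = ⊥-elim (x≮y x<y)
    ... | no  _   = ≈-refl

    max≈ʳ : ∀ {x y} → ¬ (y < x) → max x y ≈ y
    max≈ʳ {x} {y} y≮x with compare x y
    ... | tri< _ _ _   = ≈-refl
    ... | tri≈ _ x≈y _ = x≈y
    ... | tri> _ _ y<x = ⊥-elim (y≮x y<x)

    max<⇒ : ∀ {x y z} → max x y < z → x < z × y < z
    max<⇒ {x} {y} m<z with x <? y
    ... | yes x<y = <-trans x<y m<z , m<z
    ... | no  x≮y = m<z , ≮-<-trans x≮y m<z

    max<⇐ : ∀ {x y z} → x < z → y < z → max x y < z
    max<⇐ {x} {y} x<z y<z with x <? y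
    ... | yes _ = y<z
    ... | no  _ = x<z

    sum-update : ∀ {n} (f g : Vector Carrier n) j {d} → (∀ {i} → i ≢ j → f i ≡ g i) → f j + d ≈ g j →
                 sum f + d ≈ sum g
    sum-update {suc n} f g zero {d} f≡g fj+d≈gj = begin
      f zero + sum (f ∘ suc) + d   ≈⟨ assoc (f zero) _ d ⟩
      f zero + (sum (f ∘ suc) + d) ≈⟨ ∙-congˡ (comm (sum (f ∘ suc)) d) ⟩
      f zero + (d + sum (f ∘ suc)) ≈⟨ assoc (f zero) d _ ⟨
      f zero + d + sum (f ∘ suc)
        ≈⟨ ∙-cong fj+d≈gj (sum-cong-≋ {n} λ i → ≈-reflexive (f≡g {suc i} λ ())) ⟩
      g zero + sum (g ∘ suc)       ∎
      where open import Relation.Binary.Reasoning.Setoid setoid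
    sum-update f g (suc j) {d} f≡g fj+d≈gj = begin
      f zero + sum (f ∘ suc) + d   ≈⟨ assoc (f zero) _ d ⟩
      f zero + (sum (f ∘ suc) + d)
        ≈⟨ ∙-cong (≈-reflexive (f≡g λ ())) (sum-update (f ∘ suc) (g ∘ suc) j (λ i≢j → f≡g (i≢j ∘ Fin.suc-injective)) fj+d≈gj) ⟩
      g zero + sum (g ∘ suc)       ∎
      where open import Relation.Binary.Reasoning.Setoid setoid

    module _ {a} {A : Set a} where

      -- Sublists and splits of the jobs are lists, whereas `load` sums over `Fin n`;
      -- `lsum-tabulate` connects the two.
      lsum : (A → Carrier) → List A → Carrier
      lsum f []       = 0#
      lsum f (x ∷ xs) = f x + lsum f xs

      lsum-cong : ∀ {f g : A → Carrier} {xs} → All (λ x → f x ≈ g x) xs → lsum f xs ≈ lsum g xs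
      lsum-cong []       = ≈-refl
      lsum-cong (e ∷ es) = ∙-cong e (lsum-cong es)

      lsum-++ : ∀ f (xs ys : List A) → lsum f (xs ++ ys) ≈ lsum f xs + lsum f ys
      lsum-++ f []       ys = ≈-sym (identityˡ (lsum f ys))
      lsum-++ f (x ∷ xs) ys = ≈-trans (∙-congˡ (lsum-++ f xs ys)) (≈-sym (assoc (f x) (lsum f xs) (lsum f ys)))

      lsum-- : ∀ f g (xs : List A) → lsum f xs - lsum g xs ≈ lsum (λ x → f x - g x) xs
      lsum-- f g []       = inverseʳ 0#
      lsum-- f g (x ∷ xs) = ≈-trans (∙-congˡ (≈-sym (⁻¹-∙-comm (g x) (lsum g xs))))
        (≈-trans (interchange (f x) (lsum f xs) (- g x) (- lsum g xs)) (∙-congˡ (lsum-- f g xs)))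

      lsum-interleaving : ∀ f {as bs xs : List A} → Interleaving as bs xs → lsum f as + lsum f bs ≈ lsum f xs
      lsum-interleaving f [] = identityˡ 0#
      lsum-interleaving f {x ∷ as} {bs} (refl ∷ˡ i) =
        ≈-trans (assoc (f x) (lsum f as) (lsum f bs)) (∙-congˡ (lsum-interleaving f i))
      lsum-interleaving f {as} {x ∷ bs} {_ ∷ xs} (refl ∷ʳ i) = begin
        lsum f as + (f x + lsum f bs) ≈⟨ assoc (lsum f as) (f x) (lsum f bs) ⟨
        lsum f as + f x + lsum f bs   ≈⟨ ∙-congʳ (comm (lsum f as) (f x)) ⟩
        f x + lsum f as + lsum f bs   ≈⟨ assoc (f x) (lsum f as) (lsum f bs) ⟩
        f x + (lsum f as + lsum f bs) ≈⟨ ∙-congˡ (lsum-interleaving f i) ⟩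
        f x + lsum f xs               ∎
        where open import Relation.Binary.Reasoning.Setoid setoid

      -- Masking instead of deleting gives sums over unfiltered lists, to which `lsum-interleaving`
      -- and `lsum-tabulate` apply.
      lsum-filterᵇ : ∀ f (m : A → Bool) xs → lsum f (filterᵇ m xs) ≈ lsum (λ x → if m x then f x else 0#) xs
      lsum-filterᵇ f m []       = ≈-refl
      lsum-filterᵇ f m (x ∷ xs) with m x
      ... | true  = ∙-congˡ (lsum-filterᵇ f m xs)
      ... | false = ≈-trans (lsum-filterᵇ f m xs) (≈-sym (identityˡ _))

      lsum-tabulate : ∀ {n} f (g : Fin n → A) → lsum f (tabulate g) ≡ sum (f ∘ g)
      lsum-tabulate {zero}  f g = refl
      lsum-tabulate {suc n} f g = cong (f (g zero) +_) (lsum-tabulate f (g ∘ suc))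

      lsum-neg : ∀ f (xs : List A) → lsum (λ x → - f x) xs ≈ - lsum f xs
      lsum-neg f []       = ≈-sym ε⁻¹≈ε
      lsum-neg f (x ∷ xs) = ≈-trans (∙-congˡ (lsum-neg f xs)) (⁻¹-∙-comm (f x) (lsum f xs))

    module Loads {n} (p : Vector Carrier n) where
      open Scheduling G p

      weight : Schedule n → Machine → Job → Carrier
      weight σ i j = if lookup (jobs σ i) j then p j else 0#

      -- Equal to p j for jobs on machine i and to - p j for the others. This is what the load of i
      -- loses when j changes machines and, for the critical i, the contribution of j to the value
      -- of an entry.
      gain : Schedule n → Machine → Job → Carrier
      gain σ i j = weight σ i j - weight σ (other i) j

      weight-cong : ∀ σ τ i i′ j → lookup (jobs σ i) j ≡ lookup (jobs τ i′) j → weight σ i j ≡ weight τ i′ j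
      weight-cong σ τ i i′ j = cong (λ b → if b then p j else 0#)

      load-flip : ∀ σ i j → load (updateAt σ j not) i + gain σ i j ≈ load σ i
      load-flip σ i j = sum-update (weight (updateAt σ j not) i) (weight σ i) j
        (λ {j′} j′≢j → weight-cong (updateAt σ j not) σ i i j′ (lookup-jobs-minimal σ i j j′≢j))
        (≈-trans (∙-congʳ (≈-reflexive (weight-cong (updateAt σ j not) σ i (other i) j (lookup-jobs-flip σ i j))))
          (≈-trans (comm _ _) (//-rightDividesˡ (weight σ (other i) j) (weight σ i j))))

      gain-minimal : ∀ σ i j {j′} → j′ ≢ j → gain (updateAt σ j not) i j′ ≡ gain σ i j′
      gain-minimal σ i j {j′} j′≢j = cong₂ _-_
        (weight-cong (updateAt σ j not) σ i i j′ (lookup-jobs-minimal σ i j j′≢j))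
        (weight-cong (updateAt σ j not) σ (other i) (other i) j′ (lookup-jobs-minimal σ (other i) j j′≢j))

      -- All gains are taken in the initial schedule. A flip of j leaves the gains of other jobs
      -- alone but reverses that of j itself, hence the condition `Unique`.
      load-flips : ∀ σ i {js} → Unique js → load (flips js σ) i + lsum (gain σ i) js ≈ load σ i
      load-flips σ i [] = identityʳ (load σ i)
      load-flips σ i {j ∷ js} (j∉js ∷ u) = begin
        L + (gain σ i j + lsum (gain σ i) js)  ≈⟨ ∙-congˡ (comm (gain σ i j) _) ⟩
        L + (lsum (gain σ i) js + gain σ i j)  ≈⟨ assoc L _ (gain σ i j) ⟨
        L + lsum (gain σ i) js + gain σ i j
          ≈⟨ ∙-congʳ (∙-congˡ (lsum-cong (All.map (λ j≢j′ → ≈-reflexive (≡.sym (gain-minimal σ i j (j≢j′ ∘ ≡.sym)))) j∉js))) ⟩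
        L + lsum (gain τ i) js + gain σ i j    ≈⟨ ∙-congʳ (load-flips τ i u) ⟩
        load τ i + gain σ i j                  ≈⟨ load-flip σ i j ⟩
        load σ i                               ∎
        where
        open import Relation.Binary.Reasoning.Setoid setoid
        τ : Schedule n
        τ = updateAt σ j not
        L : Carrier
        L = load (flips (j ∷ js) σ) i

      -- True summand by summand: a job on which σ and τ agree keeps its weight, and any other job
      -- has in τ the weight that σ gives it on the opposite machine.
      load-differ : ∀ σ τ i → load τ i + lsum (λ j → if differ σ τ j then gain σ i j else 0#) (allFin n) ≈ load σ i
      load-differ σ τ i = begin
        load τ i + lsum moved (allFin n) ≈⟨ ∙-congˡ (≈-reflexive (lsum-tabulate moved id)) ⟩
        load τ i + sum moved             ≈⟨ ∑-distrib-+ (weight τ i) moved ⟨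
        sum (λ j → weight τ i j + moved j) ≈⟨ sum-cong-≋ {n} pointwise ⟩
        load σ i                         ∎
        where
        open import Relation.Binary.Reasoning.Setoid setoid
        moved : Job → Carrier
        moved j = if differ σ τ j then gain σ i j else 0#
        pointwise : ∀ j → weight τ i j + moved j ≈ weight σ i j
        pointwise j with differ σ τ j in eq
        ... | false = ≈-trans (identityʳ _) (≈-reflexive (weight-cong τ σ i i j (same i)))
          where
          xor-false : ∀ x y → x xor y ≡ false → y ≡ x
          xor-false true  true  _ = refl
          xor-false false false _ = refl
          same : ∀ i → lookup (jobs τ i) j ≡ lookup (jobs σ i) j
          same m₁ = xor-false (lookup σ j) (lookup τ j) eq
          same m₂ = ≡.trans (Vec.lookup-map j not τ) (≡.trans (cong not (same m₁)) (≡.sym (Vec.lookup-map j not σ)))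
        ... | true = ≈-trans (∙-congʳ (≈-reflexive (weight-cong τ σ i (other i) j (opposite i))))
                (≈-trans (comm _ _) (//-rightDividesˡ (weight σ (other i) j) (weight σ i j)))
          where
          xor-true : ∀ x y → x xor y ≡ true → y ≡ not x
          xor-true true  false _ = refl
          xor-true false true  _ = refl
          opposite : ∀ i → lookup (jobs τ i) j ≡ lookup (jobs σ (other i)) j
          opposite m₁ = ≡.trans (xor-true (lookup σ j) (lookup τ j) eq) (≡.sym (Vec.lookup-map j not σ))
          opposite m₂ = ≡.trans (Vec.lookup-map j not τ)
              (≡.trans (cong not (xor-true (lookup σ j) (lookup τ j) eq)) (not-involutive (lookup σ j)))

      gain-other : ∀ σ i j → gain σ (other i) j ≈ - gain σ i j
      gain-other σ i j = ≈-trans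
          (∙-congˡ (⁻¹-cong (≈-reflexive (weight-cong σ σ (other (other i)) i j (cong (λ i → lookup (jobs σ i) j) (other-involutive i))))))
        (≈-sym (⁻¹-anti-homo‿- (weight σ i j) (weight σ (other i) j)))
        where
        other-involutive : ∀ i → other (other i) ≡ i
        other-involutive m₁ = refl
        other-involutive m₂ = refl

      lsum-gain-other : ∀ σ i js → lsum (gain σ (other i)) js ≈ - lsum (gain σ i) js
      lsum-gain-other σ i js = ≈-trans (lsum-cong {xs = js} (All.universal (gain-other σ i) js)) (lsum-neg (gain σ i) js)

-- Correctness and cost of enumeration, sorting and binary search

module Routines where

  open import Data.Empty using (⊥-elim)
  open import Data.Fin.Base as Fin using (Fin; zero; suc; fromℕ<; toℕ)
  import Data.Fin.Properties as Fin
  open import Data.List.Base using (List; []; _∷_; _++_; length; map; concat)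
  import Data.List.Properties as List
  open import Data.List.Membership.Propositional using (_∈_)
  open import Data.List.Membership.Propositional.Properties using (∈-map⁺; ∈-++⁺ˡ; ∈-++⁺ʳ)
  open import Data.List.Relation.Binary.Permutation.Propositional using (_↭_; ↭-refl; ↭-sym; ↭-trans; prep; ↭-reflexive)
  open import Data.List.Relation.Binary.Permutation.Propositional.Properties using (All-resp-↭; ↭-length; shift; ++⁺)
  open import Data.List.Relation.Binary.Sublist.Propositional using (_⊆_; []; _∷_; _∷ʳ_; minimum)
  open import Data.List.Relation.Unary.All as All using (All; []; _∷_)
  import Data.List.Relation.Unary.All.Properties as All
  open import Data.List.Relation.Unary.AllPairs using (AllPairs; []; _∷_)
  open import Data.List.Relation.Unary.Any using (here; there)
  open import Data.Maybe.Base using (just)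
  open import Data.Nat.Base as ℕ using (ℕ; zero; suc; z≤n; s≤s; _^_; ⌊_/2⌋; ⌈_/2⌉)
  import Data.Nat.Properties as ℕ
  open import Data.Nat.Tactic.RingSolver using (solve-∀)
  open import Data.Product.Base using (∃; _×_; _,_; proj₁; proj₂)
  open import Data.Vec.Base using (Vec; lookup; fromList)
  open import Data.Vec.Functional using (Vector)
  open import Function.Base using (_∘_)
  open import Relation.Binary.PropositionalEquality.Core using (_≡_; refl; sym; trans; cong; cong₂; subst)
  open import Relation.Binary.PropositionalEquality.Properties using (module ≡-Reasoning)
  open import Relation.Binary.Structures using (IsStrictTotalOrder)
  open import Relation.Nullary.Decidable.Core using (yes; no)
  open import Relation.Nullary.Negation.Core using (¬_)
  open Schedules

  open Timed using (Timed; _after_; value; cost; mapT; append; subsets; toArray; step)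

  module _ {a} {A : Set a} where

    mapT-value : ∀ {b} {B : Set b} (f : A → Timed B) xs → value (mapT f xs) ≡ map (value ∘ f) xs
    mapT-value f []       = refl
    mapT-value f (x ∷ xs) = cong (value (f x) ∷_) (mapT-value f xs)

    mapT-cost : ∀ {b} {B : Set b} {f : A → Timed B} {c xs} → All (λ x → cost (f x) ℕ.≤ c) xs →
                cost (mapT f xs) ℕ.≤ length xs ℕ.* suc c ℕ.+ 1
    mapT-cost [] = ℕ.≤-refl
    mapT-cost {c = c} {xs = _ ∷ xs} (h ∷ hs) = ℕ.≤-trans (ℕ.+-mono-≤ h (ℕ.+-monoˡ-≤ 1 (mapT-cost hs)))
      (ℕ.≤-reflexive (lemma c (length xs)))
      where
      lemma : ∀ c l → c ℕ.+ (l ℕ.* suc c ℕ.+ 1 ℕ.+ 1) ≡ suc l ℕ.* suc c ℕ.+ 1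
      lemma = solve-∀

    append-value : ∀ (xs ys : List A) → value (append xs ys) ≡ xs ++ ys
    append-value []       ys = refl
    append-value (x ∷ xs) ys = cong (x ∷_) (append-value xs ys)

    append-cost : ∀ (xs ys : List A) → cost (append xs ys) ≡ length xs ℕ.+ 1
    append-cost []       ys = refl
    append-cost (x ∷ xs) ys = trans (cong (ℕ._+ 1) (append-cost xs ys)) (ℕ.+-comm _ 1)

  module _ {a} {A : Set a} where

    subsets-∷ : ∀ h x (xs : List A) → value (subsets (suc h) (x ∷ xs)) ≡
                map (x ∷_) (value (subsets h xs)) ++ value (subsets (suc h) xs)
    subsets-∷ h x xs = trans (append-value _ (value (subsets (suc h) xs)))
      (cong (_++ value (subsets (suc h) xs)) (mapT-value _ (value (subsets h xs))))

    subsets-sound : ∀ h (xs : List A) → All (λ ys → ys ⊆ xs × length ys ≡ h) (value (subsets h xs))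
    subsets-sound zero    xs       = (minimum xs , refl) ∷ []
    subsets-sound (suc h) []       = []
    subsets-sound (suc h) (x ∷ xs) rewrite subsets-∷ h x xs = All.++⁺
      (All.map⁺ (All.map (λ (s , l) → refl ∷ s , cong suc l) (subsets-sound h xs)))
      (All.map (λ (s , l) → x ∷ʳ s , l) (subsets-sound (suc h) xs))

    subsets-complete : ∀ {ys xs : List A} → ys ⊆ xs → ys ∈ value (subsets (length ys) xs)
    subsets-complete {[]}     s = here refl
    subsets-complete {y ∷ ys} (_∷ʳ_ {ys = xs} x s) rewrite subsets-∷ (length ys) x xs =
      ∈-++⁺ʳ (map (x ∷_) (value (subsets (length ys) xs))) (subsets-complete s)
    subsets-complete {y ∷ ys} (_∷_ {ys = xs} refl s) rewrite subsets-∷ (length ys) y xs =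
      ∈-++⁺ˡ (∈-map⁺ (y ∷_) (subsets-complete s))

    #subsets : ℕ → List A → ℕ
    #subsets h xs = length (value (subsets h xs))

    #subsets-∷ : ∀ h x (xs : List A) → #subsets (suc h) (x ∷ xs) ≡ #subsets h xs ℕ.+ #subsets (suc h) xs
    #subsets-∷ h x xs = trans (cong length (subsets-∷ h x xs))
      (trans (List.length-++ (map (x ∷_) (value (subsets h xs))))
        (cong (ℕ._+ #subsets (suc h) xs) (List.length-map (x ∷_) (value (subsets h xs)))))

    subsets-cost-∷ : ∀ h x (xs : List A) → cost (subsets (suc h) (x ∷ xs)) ℕ.≤
                     cost (subsets h xs) ℕ.+ cost (subsets (suc h) xs) ℕ.+ (3 ℕ.* #subsets h xs ℕ.+ 2)
    subsets-cost-∷ h x xs = begin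
      f ℕ.+ (cost us ℕ.+ (g ℕ.+ cost (append (value us) (value (subsets (suc h) xs)))))
        ≡⟨ cong (λ c → f ℕ.+ (cost us ℕ.+ (g ℕ.+ c))) (append-cost (value us) _) ⟩
      f ℕ.+ (cost us ℕ.+ (g ℕ.+ (length (value us) ℕ.+ 1)))
        ≡⟨ cong (λ l → f ℕ.+ (cost us ℕ.+ (g ℕ.+ (l ℕ.+ 1)))) (trans (cong length (mapT-value _ ys)) (List.length-map _ ys)) ⟩
      f ℕ.+ (cost us ℕ.+ (g ℕ.+ (length ys ℕ.+ 1)))
        ≤⟨ ℕ.+-monoʳ-≤ f (ℕ.+-monoˡ-≤ (g ℕ.+ (length ys ℕ.+ 1)) (mapT-cost (All.universal (λ _ → ℕ.≤-refl) ys))) ⟩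
      f ℕ.+ (length ys ℕ.* 2 ℕ.+ 1 ℕ.+ (g ℕ.+ (length ys ℕ.+ 1)))
        ≡⟨ lemma f g (length ys) ⟩
      f ℕ.+ g ℕ.+ (3 ℕ.* #subsets h xs ℕ.+ 2) ∎
      where
      open ℕ.≤-Reasoning
      f g : ℕ
      f = cost (subsets h xs)
      g = cost (subsets (suc h) xs)
      ys : List (List A)
      ys = value (subsets h xs)
      us : Timed (List (List A))
      us = mapT (λ y → step (x ∷ y)) ys
      lemma : ∀ f g l → f ℕ.+ (l ℕ.* 2 ℕ.+ 1 ℕ.+ (g ℕ.+ (l ℕ.+ 1))) ≡ f ℕ.+ g ℕ.+ (3 ℕ.* l ℕ.+ 2)
      lemma = solve-∀

    module _ {n : ℕ} where

      #subsets≤n^h : ∀ h (xs : List A) → length xs ℕ.≤ n → #subsets h xs ℕ.≤ n ^ h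
      -- One factor has to be the actual length for Pascal's rule to close: n^h + |xs| n^h = (1 +
      -- |xs|) n^h. A bound by n^(h + 1) alone is not inductive.
      #subsets≤|xs|n^h : ∀ h (xs : List A) → length xs ℕ.≤ n → #subsets (suc h) xs ℕ.≤ length xs ℕ.* n ^ h
      #subsets≤n^h zero    xs _ = ℕ.≤-refl
      #subsets≤n^h (suc h) xs l = ℕ.≤-trans (#subsets≤|xs|n^h h xs l) (ℕ.*-monoˡ-≤ (n ^ h) l)
      #subsets≤|xs|n^h h []       _ = z≤n
      #subsets≤|xs|n^h h (x ∷ xs) l = ℕ.≤-trans (ℕ.≤-reflexive (#subsets-∷ h x xs))
        (ℕ.+-mono-≤ (#subsets≤n^h h xs (ℕ.<⇒≤ l)) (#subsets≤|xs|n^h h xs (ℕ.<⇒≤ l)))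

      -- As in the count of subsets, the length stays a separate factor; the factor h + 1 pays for
      -- the recursive call with smaller h. In the constant 6, five units cover `mapT`, `append` and
      -- the closing steps, and one covers the call of `subsets zero`.
      subsets-cost-suc : ∀ h (xs : List A) .{{_ : ℕ.NonZero n}} → length xs ℕ.≤ n →
                         cost (subsets (suc h) xs) ℕ.≤ 6 ℕ.* suc h ℕ.* n ^ h ℕ.* suc (length xs)
      subsets-cost-suc h [] l =
          ℕ.*-mono-≤ {1} {6 ℕ.* suc h ℕ.* n ^ h} {1} {1} (ℕ.*-mono-≤ {1} {6 ℕ.* suc h} {1} (s≤s z≤n) (ℕ.m^n>0 n h)) ℕ.≤-refl
      subsets-cost-suc zero (x ∷ xs) l = begin
        cost (subsets 1 (x ∷ xs))                        ≤⟨ subsets-cost-∷ zero x xs ⟩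
        1 ℕ.+ cost (subsets 1 xs) ℕ.+ 5
          ≤⟨ ℕ.+-monoˡ-≤ 5 (s≤s (subsets-cost-suc zero xs (ℕ.<⇒≤ l))) ⟩
        suc (6 ℕ.* suc (length xs)) ℕ.+ 5                ≡⟨ lemma (length xs) ⟩
        6 ℕ.* suc (suc (length xs))                      ∎
        where
        open ℕ.≤-Reasoning
        lemma : ∀ l → suc (6 ℕ.* suc l) ℕ.+ 5 ≡ 6 ℕ.* suc (suc l)
        lemma = solve-∀
      subsets-cost-suc (suc h) (x ∷ xs) l = begin
        cost (subsets (2 ℕ.+ h) (x ∷ xs))                ≤⟨ subsets-cost-∷ (suc h) x xs ⟩
        cost (subsets (suc h) xs) ℕ.+ cost (subsets (2 ℕ.+ h) xs) ℕ.+ (3 ℕ.* #subsets (suc h) xs ℕ.+ 2)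
          ≤⟨ ℕ.+-mono-≤ (ℕ.+-mono-≤ (subsets-cost-suc h xs (ℕ.<⇒≤ l)) (subsets-cost-suc (suc h) xs (ℕ.<⇒≤ l)))
               (ℕ.+-mono-≤ (ℕ.*-monoʳ-≤ 3 (#subsets≤n^h (suc h) xs (ℕ.<⇒≤ l))) (ℕ.*-monoʳ-≤ 2 (ℕ.m^n>0 n (suc h)))) ⟩
        6 ℕ.* suc h ℕ.* P ℕ.* suc m ℕ.+ T ℕ.+ (3 ℕ.* Q ℕ.+ 2 ℕ.* Q)
          ≤⟨ ℕ.+-monoˡ-≤ _ (ℕ.+-monoˡ-≤ T (ℕ.*-monoʳ-≤ (6 ℕ.* suc h ℕ.* P) l)) ⟩
        6 ℕ.* suc h ℕ.* P ℕ.* n ℕ.+ T ℕ.+ (3 ℕ.* Q ℕ.+ 2 ℕ.* Q)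
          -- A spare Q brings 5 Q up to the 6 Q by which the bound grows from h to h + 1.
          ≤⟨ ℕ.m≤m+n _ Q ⟩
        6 ℕ.* suc h ℕ.* P ℕ.* n ℕ.+ T ℕ.+ (3 ℕ.* Q ℕ.+ 2 ℕ.* Q) ℕ.+ Q
          ≡⟨ lemma h P n m ⟩
        6 ℕ.* suc (suc h) ℕ.* Q ℕ.* suc (suc m) ∎
        where
        open ℕ.≤-Reasoning
        m P Q T : ℕ
        m = length xs
        P = n ^ h
        Q = n ^ suc h
        T = 6 ℕ.* suc (suc h) ℕ.* Q ℕ.* suc m
        lemma : ∀ h P n m →
          6 ℕ.* suc h ℕ.* P ℕ.* n ℕ.+ 6 ℕ.* suc (suc h) ℕ.* (n ℕ.* P) ℕ.* suc m
              ℕ.+ (3 ℕ.* (n ℕ.* P) ℕ.+ 2 ℕ.* (n ℕ.* P)) ℕ.+ (n ℕ.* P)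
            ≡ 6 ℕ.* suc (suc h) ℕ.* (n ℕ.* P) ℕ.* suc (suc m)
        lemma = solve-∀

      subsets-cost : ∀ h (xs : List A) .{{_ : ℕ.NonZero n}} → length xs ℕ.≤ n →
                     cost (subsets h xs) ℕ.≤ 12 ℕ.* h ℕ.* n ^ h ℕ.+ 1
      subsets-cost zero    xs l = ℕ.≤-refl
      subsets-cost (suc h) xs l = begin
        cost (subsets (suc h) xs)                     ≤⟨ subsets-cost-suc h xs l ⟩
        6 ℕ.* suc h ℕ.* n ^ h ℕ.* suc (length xs)
          ≤⟨ ℕ.*-monoʳ-≤ (6 ℕ.* suc h ℕ.* n ^ h) (ℕ.+-mono-≤ (ℕ.>-nonZero⁻¹ n) l) ⟩
        6 ℕ.* suc h ℕ.* n ^ h ℕ.* (n ℕ.+ n)           ≡⟨ lemma (suc h) (n ^ h) n ⟩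
        12 ℕ.* suc h ℕ.* n ^ suc h                    ≤⟨ ℕ.m≤m+n _ 1 ⟩
        12 ℕ.* suc h ℕ.* n ^ suc h ℕ.+ 1              ∎
        where
        open ℕ.≤-Reasoning
        lemma : ∀ h P n → 6 ℕ.* h ℕ.* P ℕ.* (n ℕ.+ n) ≡ 12 ℕ.* h ℕ.* (n ℕ.* P)
        lemma = solve-∀

  lo≤mid : ∀ {lo hi} → lo ℕ.≤ hi → lo ℕ.≤ ⌊ lo ℕ.+ hi /2⌋
  lo≤mid {lo} {hi} lo≤hi = ℕ.≤-trans (ℕ.≤-reflexive (ℕ.n≡⌊n+n/2⌋ lo)) (ℕ.⌊n/2⌋-mono (ℕ.+-monoʳ-≤ lo lo≤hi))

  -- Together with `hi<1+mid+half` this halves the width allowed to the search range, whichever side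
  -- is kept, so the exponent in `search-cost` drops by one per probe.
  mid<lo+half : ∀ {lo hi d} → hi ℕ.< lo ℕ.+ 2 ℕ.* d → ⌊ lo ℕ.+ hi /2⌋ ℕ.< lo ℕ.+ d
  mid<lo+half {lo} {hi} {d} hi< = begin
    ⌊ suc (suc (lo ℕ.+ hi)) /2⌋
      ≤⟨ ℕ.⌊n/2⌋-mono (s≤s (ℕ.≤-trans (ℕ.≤-reflexive (sym (ℕ.+-suc lo hi))) (ℕ.+-monoʳ-≤ lo hi<))) ⟩
    ⌊ suc (lo ℕ.+ (lo ℕ.+ 2 ℕ.* d)) /2⌋   ≡⟨ cong (⌊_/2⌋ ∘ suc) (lemma lo d) ⟩
    ⌈ (lo ℕ.+ d) ℕ.+ (lo ℕ.+ d) /2⌉       ≡⟨ ℕ.n≡⌈n+n/2⌉ (lo ℕ.+ d) ⟨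
    lo ℕ.+ d                              ∎
    where
    open ℕ.≤-Reasoning
    lemma : ∀ l d → l ℕ.+ (l ℕ.+ 2 ℕ.* d) ≡ (l ℕ.+ d) ℕ.+ (l ℕ.+ d)
    lemma = solve-∀

  hi<1+mid+half : ∀ {lo hi d} → hi ℕ.< lo ℕ.+ 2 ℕ.* d → hi ℕ.< suc ⌊ lo ℕ.+ hi /2⌋ ℕ.+ d
  hi<1+mid+half {lo} {hi} {d} hi< = s≤s (begin
    hi                                    ≡⟨ ℕ.n≡⌈n+n/2⌉ hi ⟩
    ⌊ suc (hi ℕ.+ hi) /2⌋
      ≤⟨ ℕ.⌊n/2⌋-mono (ℕ.≤-trans (ℕ.+-monoˡ-≤ hi hi<) (ℕ.≤-reflexive (lemma lo hi d))) ⟩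
    ⌊ lo ℕ.+ hi ℕ.+ 2 ℕ.* d /2⌋           ≡⟨ ⌊/2⌋-+2* (lo ℕ.+ hi) d ⟩
    ⌊ lo ℕ.+ hi /2⌋ ℕ.+ d                 ∎)
    where
    open ℕ.≤-Reasoning
    lemma : ∀ l h d → l ℕ.+ 2 ℕ.* d ℕ.+ h ≡ l ℕ.+ h ℕ.+ 2 ℕ.* d
    lemma = solve-∀
    ⌊/2⌋-+2* : ∀ m d → ⌊ m ℕ.+ 2 ℕ.* d /2⌋ ≡ ⌊ m /2⌋ ℕ.+ d
    ⌊/2⌋-+2* m zero    = trans (cong ⌊_/2⌋ (ℕ.+-identityʳ m)) (sym (ℕ.+-identityʳ _))
    ⌊/2⌋-+2* m (suc d) = trans (cong ⌊_/2⌋ (lemma₂ m d)) (trans (cong suc (⌊/2⌋-+2* m d)) (sym (ℕ.+-suc ⌊ m /2⌋ d)))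
      where
      lemma₂ : ∀ m d → m ℕ.+ 2 ℕ.* suc d ≡ suc (suc (m ℕ.+ 2 ℕ.* d))
      lemma₂ = solve-∀

  module Search {c ℓ₁ ℓ₂} (G : OrderedAbelianGroup c ℓ₁ ℓ₂)
                {n : ℕ} (p : Vector (OrderedAbelianGroup.Carrier G) n) where

    open OrderedAbelianGroup G
    open Scheduling G p
    open IsStrictTotalOrder isStrictTotalOrder using (asym) renaming (irrefl to <-irrefl; trans to <-trans)

    infix 4 _≼_

    _≼_ : Entry → Entry → Set ℓ₂
    e ≼ e′ = ¬ (proj₁ e′ < proj₁ e)

    Sorted : List Entry → Set _
    Sorted = AllPairs _≼_

    ≼-trans : ∀ {e e′ e″} → e ≼ e′ → e′ ≼ e″ → e ≼ e″
    ≼-trans = ≮-trans G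

    merge-↭ : ∀ xs ys → value (merge xs ys) ↭ xs ++ ys
    merge-↭ []       ys       = ↭-refl
    merge-↭ (x ∷ xs) []       = ↭-reflexive (sym (List.++-identityʳ (x ∷ xs)))
    merge-↭ (x ∷ xs) (y ∷ ys) with proj₁ y <? proj₁ x | merge-↭ (x ∷ xs) ys | merge-↭ xs (y ∷ ys)
    ... | yes _ | rec | _   = ↭-trans (prep y rec) (↭-sym (shift y (x ∷ xs) ys))
    ... | no  _ | _   | rec = prep x rec

    -- The smaller head bounds the concatenation of what remains, and `All` carries this bound along
    -- `merge-↭` to the merged list.
    merge-sorted : ∀ {xs ys} → Sorted xs → Sorted ys → Sorted (value (merge xs ys))
    merge-sorted {[]}     {ys}     _          sy = sy
    merge-sorted {x ∷ xs} {[]}     sx         _  = sx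
    merge-sorted {x ∷ xs} {y ∷ ys} (hx ∷ sx) (hy ∷ sy)
      with proj₁ y <? proj₁ x | merge-sorted (hx ∷ sx) sy | merge-sorted sx (hy ∷ sy)
    ... | yes y<x | rec | _ = All-resp-↭ (↭-sym (merge-↭ (x ∷ xs) ys))
                      (asym y<x ∷ All.++⁺ (All.map (λ {e} → ≼-trans {y} {x} {e} (asym y<x)) hx) hy)
                    ∷ rec
    ... | no  y≮x | _ | rec = All-resp-↭ (↭-sym (merge-↭ xs (y ∷ ys)))
                      (All.++⁺ hx (y≮x ∷ All.map (λ {e} → ≼-trans {x} {y} {e} y≮x) hy))
                    ∷ rec

    merge-cost : ∀ xs ys → cost (merge xs ys) ℕ.≤ 2 ℕ.* (length xs ℕ.+ length ys) ℕ.+ 1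
    merge-cost []       ys       = ℕ.m≤n+m 1 (2 ℕ.* length ys)
    merge-cost (x ∷ xs) []       = ℕ.m≤n+m 1 (2 ℕ.* (length (x ∷ xs) ℕ.+ 0))
    merge-cost (x ∷ xs) (y ∷ ys)
      with proj₁ y <? proj₁ x | merge-cost (x ∷ xs) ys | merge-cost xs (y ∷ ys)
    ... | yes _ | rec | _ = ℕ.≤-trans (s≤s (ℕ.+-monoˡ-≤ 1 rec)) (ℕ.≤-reflexive (lemma (length xs) (length ys)))
      where
      lemma : ∀ a b → suc (2 ℕ.* (suc a ℕ.+ b) ℕ.+ 1 ℕ.+ 1) ≡ 2 ℕ.* (suc a ℕ.+ suc b) ℕ.+ 1
      lemma = solve-∀
    ... | no  _ | _ | rec = ℕ.≤-trans (s≤s (ℕ.+-monoˡ-≤ 1 rec)) (ℕ.≤-reflexive (lemma (length xs) (length ys)))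
      where
      lemma : ∀ a b → suc (2 ℕ.* (a ℕ.+ suc b) ℕ.+ 1 ℕ.+ 1) ≡ 2 ℕ.* (suc a ℕ.+ suc b) ℕ.+ 1
      lemma = solve-∀

    mergePairs-↭ : ∀ xss → concat (value (mergePairs xss)) ↭ concat xss
    mergePairs-↭ []              = ↭-refl
    mergePairs-↭ (xs ∷ [])       = ↭-refl
    mergePairs-↭ (xs ∷ ys ∷ xss) = ↭-trans (++⁺ (merge-↭ xs ys) (mergePairs-↭ xss))
      (↭-reflexive (List.++-assoc xs ys (concat xss)))

    mergePairs-sorted : ∀ {xss} → All Sorted xss → All Sorted (value (mergePairs xss))
    mergePairs-sorted []            = []
    mergePairs-sorted (s ∷ [])      = s ∷ []
    mergePairs-sorted (s ∷ s′ ∷ ss) = merge-sorted s s′ ∷ mergePairs-sorted ss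

    mergePairs-length : ∀ xss → length (value (mergePairs xss)) ≡ ⌈ length xss /2⌉
    mergePairs-length []              = refl
    mergePairs-length (xs ∷ [])       = refl
    mergePairs-length (xs ∷ ys ∷ xss) = cong suc (mergePairs-length xss)

    mergePairs-cost : ∀ xss → cost (mergePairs xss) ℕ.≤ 2 ℕ.* length (concat xss) ℕ.+ 2 ℕ.* length xss ℕ.+ 1
    mergePairs-cost []              = ℕ.≤-refl
    mergePairs-cost (xs ∷ [])       = ℕ.m≤n+m 1 (2 ℕ.* length (xs ++ []) ℕ.+ 2)
    mergePairs-cost (xs ∷ ys ∷ xss) = begin
      cost (merge xs ys) ℕ.+ (cost (mergePairs xss) ℕ.+ 1)
        ≤⟨ ℕ.+-mono-≤ (merge-cost xs ys) (ℕ.+-monoˡ-≤ 1 (mergePairs-cost xss)) ⟩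
      2 ℕ.* (length xs ℕ.+ length ys) ℕ.+ 1 ℕ.+ (2 ℕ.* length (concat xss) ℕ.+ 2 ℕ.* length xss ℕ.+ 1 ℕ.+ 1)
        ≤⟨ ℕ.m≤m+n _ 2 ⟩
      2 ℕ.* (length xs ℕ.+ length ys) ℕ.+ 1 ℕ.+ (2 ℕ.* length (concat xss) ℕ.+ 2 ℕ.* length xss ℕ.+ 1 ℕ.+ 1) ℕ.+ 2
        ≡⟨ lemma (length xs) (length ys) (length (concat xss)) (length xss) ⟩
      2 ℕ.* (length xs ℕ.+ (length ys ℕ.+ length (concat xss))) ℕ.+ 2 ℕ.* suc (suc (length xss)) ℕ.+ 1
        ≡⟨ cong (λ l → 2 ℕ.* l ℕ.+ 2 ℕ.* suc (suc (length xss)) ℕ.+ 1)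
            (trans (List.length-++ xs) (cong (length xs ℕ.+_) (List.length-++ ys))) ⟨
      2 ℕ.* length (xs ++ ys ++ concat xss) ℕ.+ 2 ℕ.* suc (suc (length xss)) ℕ.+ 1 ∎
      where
      open ℕ.≤-Reasoning
      lemma : ∀ x y s m → 2 ℕ.* (x ℕ.+ y) ℕ.+ 1 ℕ.+ (2 ℕ.* s ℕ.+ 2 ℕ.* m ℕ.+ 1 ℕ.+ 1) ℕ.+ 2 ≡
              2 ℕ.* (x ℕ.+ (y ℕ.+ s)) ℕ.+ 2 ℕ.* suc (suc m) ℕ.+ 1
      lemma = solve-∀

    mergeAll-↭ : ∀ f xss → length xss ℕ.≤ suc f → value (mergeAll f xss) ↭ concat xss
    mergeAll-↭ f       []              _ = ↭-refl
    mergeAll-↭ f       (xs ∷ [])       _ = ↭-reflexive (sym (List.++-identityʳ xs))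
    mergeAll-↭ zero    (xs ∷ ys ∷ xss) (s≤s ())
    mergeAll-↭ (suc f) (xs ∷ ys ∷ xss) (s≤s (s≤s l)) = ↭-trans
      (mergeAll-↭ f (value (mergePairs (xs ∷ ys ∷ xss)))
        (ℕ.≤-trans (ℕ.≤-reflexive (mergePairs-length (xs ∷ ys ∷ xss))) (s≤s (ℕ.≤-trans (ℕ.⌈n/2⌉≤n (length xss)) l))))
      (mergePairs-↭ (xs ∷ ys ∷ xss))

    -- A call that runs out of fuel returns one of its lists, which is sorted; whether anything gets
    -- lost is the concern of `mergeAll-↭`.
    mergeAll-sorted : ∀ f {xss} → All Sorted xss → Sorted (value (mergeAll f xss))
    mergeAll-sorted f       []            = []
    mergeAll-sorted f       (s ∷ [])      = s
    mergeAll-sorted zero    (s ∷ _ ∷ _)   = s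
    mergeAll-sorted (suc f) (s ∷ s′ ∷ ss) = mergeAll-sorted f (mergePairs-sorted (s ∷ s′ ∷ ss))

    -- A round halves the number of lists, rounding up, and keeps their total length, so 2^r lists
    -- take at most r rounds of linear cost.
    mergeAll-cost : ∀ f r xss → length xss ℕ.≤ 2 ^ r →
                    cost (mergeAll f xss) ℕ.≤ r ℕ.* (2 ℕ.* length (concat xss) ℕ.+ 2 ℕ.* length xss ℕ.+ 1) ℕ.+ 1
    mergeAll-cost f       r       []              _ = ℕ.m≤n+m 1 _
    mergeAll-cost f       r       (xs ∷ [])       _ = ℕ.m≤n+m 1 _
    mergeAll-cost zero    r       (xs ∷ ys ∷ xss) _ = ℕ.m≤n+m 1 _
    mergeAll-cost (suc f) zero    (xs ∷ ys ∷ xss) (s≤s ())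
    mergeAll-cost (suc f) (suc r) xss@(_ ∷ _ ∷ _) l = begin
      cost (mergePairs xss) ℕ.+ cost (mergeAll f yss)
        ≤⟨ ℕ.+-mono-≤ (mergePairs-cost xss) (mergeAll-cost f r yss |yss|≤2^r) ⟩
      B ℕ.+ (r ℕ.* (2 ℕ.* length (concat yss) ℕ.+ 2 ℕ.* length yss ℕ.+ 1) ℕ.+ 1)
        ≤⟨ ℕ.+-monoʳ-≤ B (ℕ.+-monoˡ-≤ 1 (ℕ.*-monoʳ-≤ r (ℕ.+-monoˡ-≤ 1
             (ℕ.+-mono-≤ (ℕ.≤-reflexive (cong (2 ℕ.*_) (↭-length (mergePairs-↭ xss)))) (ℕ.*-monoʳ-≤ 2 |yss|≤|xss|))))) ⟩
      B ℕ.+ (r ℕ.* B ℕ.+ 1)                            ≡⟨ ℕ.+-assoc B (r ℕ.* B) 1 ⟨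
      suc r ℕ.* B ℕ.+ 1                                ∎
      where
      open ℕ.≤-Reasoning
      B : ℕ
      B = 2 ℕ.* length (concat xss) ℕ.+ 2 ℕ.* length xss ℕ.+ 1
      yss : List (List Entry)
      yss = value (mergePairs xss)
      |yss|≤|xss| : length yss ℕ.≤ length xss
      |yss|≤|xss| = ℕ.≤-trans (ℕ.≤-reflexive (mergePairs-length xss)) (ℕ.⌈n/2⌉≤n (length xss))
      |yss|≤2^r : length yss ℕ.≤ 2 ^ r
      |yss|≤2^r = begin
        length yss                ≡⟨ mergePairs-length xss ⟩
        ⌈ length xss /2⌉          ≤⟨ ℕ.⌈n/2⌉-mono l ⟩
        ⌈ 2 ^ r ℕ.+ (2 ^ r ℕ.+ 0) /2⌉ ≡⟨ cong (λ x → ⌈ 2 ^ r ℕ.+ x /2⌉) (ℕ.+-identityʳ (2 ^ r)) ⟩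
        ⌈ 2 ^ r ℕ.+ 2 ^ r /2⌉     ≡⟨ ℕ.n≡⌈n+n/2⌉ (2 ^ r) ⟨
        2 ^ r                     ∎

    singletons : List Entry → List (List Entry)
    singletons = map (λ x → x ∷ [])

    sort-value : ∀ xs → value (sort xs) ≡ value (mergeAll (length xs) (singletons xs))
    sort-value xs = cong (value ∘ mergeAll (length xs)) (mapT-value _ xs)

    sort-↭ : ∀ xs → value (sort xs) ↭ xs
    sort-↭ xs = ↭-trans (↭-reflexive (sort-value xs)) (↭-trans
      (mergeAll-↭ (length xs) (singletons xs) (ℕ.≤-trans (ℕ.≤-reflexive (List.length-map _ xs)) (ℕ.n≤1+n _)))
      (↭-reflexive (List.concat-map-[_] xs)))

    sort-sorted : ∀ xs → Sorted (value (sort xs))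
    sort-sorted xs = subst Sorted (sym (sort-value xs))
      (mergeAll-sorted (length xs) (All.map⁺ (All.universal (λ _ → [] ∷ []) xs)))

    sort-cost : ∀ r xs → length xs ℕ.≤ 2 ^ r →
                cost (sort xs) ℕ.≤ 2 ℕ.* length xs ℕ.+ 2 ℕ.+ r ℕ.* (4 ℕ.* length xs ℕ.+ 1)
    sort-cost r xs l = begin
      cost (mapT (λ x → step (x ∷ [])) xs) ℕ.+ cost (mergeAll m (value (mapT (λ x → step (x ∷ [])) xs)))
        ≡⟨ cong (λ xss → cost (mapT (λ x → step (x ∷ [])) xs) ℕ.+ cost (mergeAll m xss)) (mapT-value _ xs) ⟩
      cost (mapT (λ x → step (x ∷ [])) xs) ℕ.+ cost (mergeAll m (singletons xs))
        ≤⟨ ℕ.+-mono-≤ (mapT-cost (All.universal (λ _ → ℕ.≤-refl) xs))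
             (mergeAll-cost m r (singletons xs) (ℕ.≤-trans (ℕ.≤-reflexive (List.length-map _ xs)) l)) ⟩
      m ℕ.* 2 ℕ.+ 1 ℕ.+ (r ℕ.* (2 ℕ.* length (concat (singletons xs)) ℕ.+ 2 ℕ.* length (singletons xs) ℕ.+ 1) ℕ.+ 1)
        ≡⟨ cong₂ (λ a b → m ℕ.* 2 ℕ.+ 1 ℕ.+ (r ℕ.* (2 ℕ.* a ℕ.+ 2 ℕ.* b ℕ.+ 1) ℕ.+ 1))
            (cong length (List.concat-map-[_] xs)) (List.length-map _ xs) ⟩
      m ℕ.* 2 ℕ.+ 1 ℕ.+ (r ℕ.* (2 ℕ.* m ℕ.+ 2 ℕ.* m ℕ.+ 1) ℕ.+ 1)
        ≡⟨ lemma m r ⟩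
      2 ℕ.* m ℕ.+ 2 ℕ.+ r ℕ.* (4 ℕ.* m ℕ.+ 1) ∎
      where
      open ℕ.≤-Reasoning
      m : ℕ
      m = length xs
      lemma : ∀ m r → m ℕ.* 2 ℕ.+ 1 ℕ.+ (r ℕ.* (2 ℕ.* m ℕ.+ 2 ℕ.* m ℕ.+ 1) ℕ.+ 1) ≡ 2 ℕ.* m ℕ.+ 2 ℕ.+ r ℕ.* (4 ℕ.* m ℕ.+ 1)
      lemma = solve-∀

    Ascending : ∀ {m} → Vec Entry m → Set _
    Ascending B = ∀ {i j} → toℕ i ℕ.≤ toℕ j → lookup B i ≼ lookup B j

    lookup-fromList-All : ∀ {q} {Q : Entry → Set q} {xs} → All Q xs → ∀ i → Q (lookup (fromList xs) i)
    lookup-fromList-All (h ∷ hs) zero    = h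
    lookup-fromList-All (h ∷ hs) (suc i) = lookup-fromList-All hs i

    fromList-∈ : ∀ {x : Entry} {xs} → x ∈ xs → ∃ λ i → lookup (fromList xs) i ≡ x
    fromList-∈ (here refl) = zero , refl
    fromList-∈ (there x∈) with i , eq ← fromList-∈ x∈ = suc i , eq

    fromList-ascending : ∀ {xs} → Sorted xs → Ascending (fromList xs)
    fromList-ascending (h ∷ hs) {zero}  {zero}  _       = <-irrefl (IsStrictTotalOrder.Eq.refl isStrictTotalOrder)
    fromList-ascending (h ∷ hs) {zero}  {suc j} _       = lookup-fromList-All h j
    fromList-ascending (h ∷ hs) {suc i} {suc j} (s≤s l) = fromList-ascending hs l

    three : ∀ r → suc (suc (suc (3 ℕ.* r ℕ.+ 1))) ≡ 3 ℕ.* suc r ℕ.+ 1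
    three = solve-∀

    InWindow : Carrier → Carrier → Entry → Set ℓ₂
    InWindow l u e = l < proj₁ e × proj₁ e < u

    search-sound : ∀ {m} f (B : Vec Entry m) l u lo hi hi≤m {e} →
                   value (binarySearch f B l u lo hi hi≤m) ≡ just e →
                   ∃ λ i → lookup B i ≡ e × InWindow l u e
    search-sound zero    B l u lo hi hi≤m ()
    search-sound (suc f) B l u lo hi hi≤m eq with lo ℕ.<? hi
    search-sound (suc f) B l u lo hi hi≤m () | no _
    search-sound (suc f) B l u lo hi hi≤m eq | yes lo<hi
      with mid ← fromℕ< (ℕ.≤-trans (mid<hi lo<hi) hi≤m)
      with l <? proj₁ (lookup B mid) | proj₁ (lookup B mid) <? u
    search-sound (suc f) B l u lo hi hi≤m refl | yes lo<hi | yes l<e | yes e<u = mid , refl , l<e , e<u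
    ... | yes _   | no _ = search-sound f B l u lo _ _ eq
    ... | no _    | _    = search-sound f B l u _ hi hi≤m eq

    -- The invariant is that the position i of an entry in the window stays in the range: a probe
    -- not below u lies after i, and a probe not above l lies before it. The fuel is at least the
    -- length of the range.
    search-complete : ∀ {m} f (B : Vec Entry m) l u lo hi hi≤m → Ascending B → hi ℕ.≤ lo ℕ.+ f →
                      ∀ {i} → lo ℕ.≤ toℕ i → toℕ i ℕ.< hi → InWindow l u (lookup B i) →
                      ∃ λ e → value (binarySearch f B l u lo hi hi≤m) ≡ just e
    search-complete zero    B l u lo hi hi≤m asc fuel lo≤i i<hi w =
      ⊥-elim (ℕ.<⇒≱ i<hi (ℕ.≤-trans fuel (ℕ.≤-trans (ℕ.≤-reflexive (ℕ.+-identityʳ lo)) lo≤i)))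
    search-complete (suc f) B l u lo hi hi≤m asc fuel {i} lo≤i i<hi (l<i , i<u) with lo ℕ.<? hi
    ... | no  lo≮hi = ⊥-elim (lo≮hi (ℕ.≤-<-trans lo≤i i<hi))
    ... | yes lo<hi with l <? proj₁ (lookup B (fromℕ< (ℕ.≤-trans (mid<hi lo<hi) hi≤m)))
                       | proj₁ (lookup B (fromℕ< (ℕ.≤-trans (mid<hi lo<hi) hi≤m))) <? u
    ...   | yes l<e | yes e<u = _ , refl
    ...   | yes l<e | no  e≮u = search-complete f B l u lo _ _ asc
              (ℕ.≤-pred (ℕ.≤-trans (mid<hi lo<hi) (ℕ.≤-trans fuel (ℕ.≤-reflexive (ℕ.+-suc lo f))))) lo≤i
              (ℕ.≰⇒> λ mid≤i → asc {fromℕ< (ℕ.≤-trans (mid<hi lo<hi) hi≤m)} {i} (ℕ.≤-trans (ℕ.≤-reflexive (Fin.toℕ-fromℕ< _)) mid≤i)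
                (<-≮-trans G i<u e≮u)) (l<i , i<u)
    ...   | no  l≮e | _ = search-complete f B l u _ hi hi≤m asc
              (ℕ.≤-trans fuel (ℕ.≤-trans (ℕ.≤-reflexive (ℕ.+-suc lo f)) (s≤s (ℕ.+-monoˡ-≤ f (lo≤mid (ℕ.<⇒≤ lo<hi))))))
              (ℕ.≰⇒> λ i≤mid → asc {i} {fromℕ< (ℕ.≤-trans (mid<hi lo<hi) hi≤m)} (ℕ.≤-trans i≤mid (ℕ.≤-reflexive (sym (Fin.toℕ-fromℕ< _))))
                (≮-<-trans G l≮e l<i)) i<hi (l<i , i<u)

    search-cost : ∀ {m} f (B : Vec Entry m) l u lo hi hi≤m r → hi ℕ.< lo ℕ.+ 2 ^ r →
                  cost (binarySearch f B l u lo hi hi≤m) ℕ.≤ 3 ℕ.* r ℕ.+ 1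
    search-cost zero    B l u lo hi hi≤m r _ = ℕ.m≤n+m 1 _
    search-cost (suc f) B l u lo hi hi≤m r hi<lo+2^r with lo ℕ.<? hi
    ... | no  _ = ℕ.m≤n+m 1 _
    -- At exponent 0 the strict bound hi < lo + 1 leaves an empty range; this is the reason for a
    -- strict invariant.
    search-cost (suc f) B l u lo hi hi≤m zero    hi<lo+1 | yes lo<hi =
      ⊥-elim (ℕ.<⇒≱ lo<hi (ℕ.≤-pred (ℕ.≤-trans hi<lo+1 (ℕ.≤-reflexive (ℕ.+-comm lo 1)))))
    search-cost (suc f) B l u lo hi hi≤m (suc r) hi<lo+2^r | yes lo<hi
      with l <? proj₁ (lookup B (fromℕ< (ℕ.≤-trans (mid<hi lo<hi) hi≤m)))
         | proj₁ (lookup B (fromℕ< (ℕ.≤-trans (mid<hi lo<hi) hi≤m))) <? u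
    ... | yes _ | yes _ = ℕ.≤-trans (s≤s (s≤s (s≤s (ℕ.m≤n+m 1 (3 ℕ.* r))))) (ℕ.≤-reflexive (three r))
    ... | yes _ | no  _ = ℕ.≤-trans (s≤s (s≤s (s≤s (search-cost f B l u lo _ _ r (mid<lo+half {lo} {hi} hi<lo+2^r)))))
        (ℕ.≤-reflexive (three r))
    ... | no  _ | _     = ℕ.≤-trans (s≤s (s≤s (s≤s (search-cost f B l u _ hi hi≤m r (hi<1+mid+half {lo} {hi} hi<lo+2^r)))))
        (ℕ.≤-reflexive (three r))

-- A single run of the k-swap algorithm

module Runs where

  open import Algebra.Bundles using (AbelianGroup)
  open import Data.Bool.Base using (true; false; not; if_then_else_)
  open import Data.Fin.Base as Fin using (Fin)
  open import Data.Fin.Properties using (toℕ<n)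
  open import Data.List.Base using (List; []; _∷_; _++_; length; map; allFin; filterᵇ)
  import Data.List.Properties as List
  open import Data.List.Membership.Propositional using (_∈_)
  open import Data.List.Membership.Propositional.Properties using (∈-map⁺)
  open import Data.List.Relation.Binary.Permutation.Propositional using (↭-sym; ↭⇒↭ₛ)
  open import Data.List.Relation.Binary.Permutation.Propositional.Properties using (All-resp-↭; ∈-resp-↭)
  import Data.List.Relation.Binary.Permutation.Setoid.Properties as PermSetoid
  open import Data.List.Relation.Binary.Sublist.Propositional using (_⊆_; []; _∷_; _∷ʳ_)
  open import Data.List.Relation.Binary.Sublist.Propositional.Properties using (++⁺; filter-⊆; All-resp-⊆)
  open import Data.List.Relation.Ternary.Interleaving.Propositional using (Interleaving; toPermutation)
  open import Data.List.Relation.Unary.All as All using (All; []; _∷_)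
  import Data.List.Relation.Unary.All.Properties as All
  open import Data.List.Relation.Unary.AllPairs using ([]; _∷_)
  open import Data.List.Relation.Unary.Any using (here; there)
  open import Data.List.Relation.Unary.Unique.Propositional using (Unique)
  open import Data.List.Relation.Unary.Unique.Propositional.Properties using (allFin⁺)
  open import Data.Maybe.Base using (Maybe; just; nothing)
  import Data.Maybe.Relation.Unary.All as Maybe using (All; just; nothing)
  import Data.Maybe.Relation.Unary.Any as Maybe using (just)
  open import Data.Nat.Base as ℕ using (ℕ; suc; z≤n; s≤s; _^_; ⌊_/2⌋; ⌈_/2⌉)
  import Data.Nat.Properties as ℕ
  open import Data.Nat.Tactic.RingSolver using (solve-∀)
  open import Data.Product.Base using (∃; ∃₂; _×_; _,_; proj₁; proj₂)
  open import Data.Vec.Base using (Vec; lookup; fromList; updateAt)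
  open import Data.Vec.Properties using (lookup-map)
  open import Data.Vec.Functional using (Vector)
  open import Function.Base using (_∘_; id)
  open import Relation.Binary.PropositionalEquality.Core using (_≡_; refl; sym; trans; cong; cong₂; subst)
  open import Relation.Binary.PropositionalEquality.Properties using (module ≡-Reasoning; setoid)
  open import Relation.Binary.Structures using (IsStrictTotalOrder)
  open import Relation.Nullary.Decidable.Core using (does; yes; no; T?)
  open import Relation.Nullary.Negation.Core using (¬_)
  open Probability using (#marked)
  open Schedules
  open Routines

  open Timed using (Timed; _after_; value; cost; mapT; append; subsets; toArray; step)

  Unique-⊆ : ∀ {a} {A : Set a} {xs ys : List A} → xs ⊆ ys → Unique ys → Unique xs
  Unique-⊆ []         []       = []
  Unique-⊆ (_ ∷ʳ s)   (_ ∷ u)  = Unique-⊆ s u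
  Unique-⊆ (refl ∷ s) (h ∷ u)  = All-resp-⊆ s h ∷ Unique-⊆ s u

  -- A and B together permute the list of all jobs, so sublists of the two parts share no job.
  Unique-interleaving : ∀ {n} {as bs xs ys : List (Fin n)} → Interleaving as bs (allFin n) →
                        xs ⊆ as → ys ⊆ bs → Unique (xs ++ ys)
  Unique-interleaving {n} i s t = Unique-⊆ (++⁺ s t)
    (PermSetoid.Unique-resp-↭ (setoid (Fin n)) (↭⇒↭ₛ (toPermutation i)) (allFin⁺ n))

  module KSwap {c ℓ₁ ℓ₂} (G : OrderedAbelianGroup c ℓ₁ ℓ₂)
               {n : ℕ} (p : Vector (OrderedAbelianGroup.Carrier G) n) where

    open OrderedAbelianGroup G
    open Scheduling G p
    open Loads G p
    open Search G p
    open IsStrictTotalOrder isStrictTotalOrder using (asym; <-respʳ-≈; <-respˡ-≈)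
      renaming (irrefl to <-irrefl; trans to <-trans)
    open AbelianGroup abelianGroup
      using (assoc; comm; identityˡ; identityʳ; inverseˡ; ∙-cong; ∙-congˡ; ∙-congʳ; ⁻¹-cong)
      renaming (refl to ≈-refl; sym to ≈-sym; trans to ≈-trans; reflexive to ≈-reflexive)
    open import Algebra.Properties.Group (AbelianGroup.group abelianGroup) using (//-rightDividesˡ)

    scan-sound : ∀ {m} σ Δ es (B : Vec Entry m) {σ′} → value (scan σ Δ es B) ≡ just σ′ →
                 ∃₂ λ e i → e ∈ es × InWindow (- proj₁ e) (Δ - proj₁ e) (lookup B i) ×
                            σ′ ≡ flips (proj₂ e ++ proj₂ (lookup B i)) σ
    scan-sound σ Δ [] B ()
    scan-sound {m} σ Δ ((x , S₁) ∷ es) B eq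
      with value (binarySearch m B (- x) (Δ - x) 0 m ℕ.≤-refl) in found
    ... | nothing = let e , i , e∈ , w , eq′ = scan-sound σ Δ es B eq in e , i , there e∈ , w , eq′
    scan-sound {m} σ Δ ((x , S₁) ∷ es) B refl | just (y , S₂)
      with i , eq , w ← search-sound m B (- x) (Δ - x) 0 m ℕ.≤-refl found =
      (x , S₁) , i , here refl , subst (InWindow (- x) (Δ - x)) (sym eq) w , (begin
        value (interchange S₂ (value (interchange S₁ σ))) ≡⟨ interchange-value S₂ _ ⟩
        flips S₂ (value (interchange S₁ σ))
          ≡⟨ cong (flips S₂) (interchange-value S₁ σ) ⟩
        flips S₂ (flips S₁ σ)                             ≡⟨ flips-++ S₁ S₂ σ ⟨
        flips (S₁ ++ S₂) σ                                ≡⟨ cong (λ e → flips (S₁ ++ proj₂ e) σ) eq ⟨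
        flips (S₁ ++ proj₂ (lookup B i)) σ                ∎)
      where
      open ≡-Reasoning
      interchange-value : ∀ js σ → value (interchange js σ) ≡ flips js σ
      interchange-value []       σ = refl
      interchange-value (j ∷ js) σ = interchange-value js (updateAt σ j not)

    -- A match for e guarantees only that the scan ends with some answer; an entry before e may be
    -- the one reported.
    scan-complete : ∀ {m} σ Δ es (B : Vec Entry m) → Ascending B → ∀ {e i} → e ∈ es →
                    InWindow (- proj₁ e) (Δ - proj₁ e) (lookup B i) →
                    ∃ λ σ′ → value (scan σ Δ es B) ≡ just σ′
    scan-complete {m} σ Δ ((x , S₁) ∷ es) B asc {i = i} e∈ w
      with value (binarySearch m B (- x) (Δ - x) 0 m ℕ.≤-refl) in found
    ... | just (y , S₂) = _ , refl
    scan-complete {m} σ Δ ((x , S₁) ∷ es) B asc {i = i} (here refl) w | nothing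
      with _ , eq ← search-complete m B (- x) (Δ - x) 0 m ℕ.≤-refl asc ℕ.≤-refl {i} z≤n (toℕ<n i) w
      with () ← trans (sym found) eq
    scan-complete {m} σ Δ ((x , S₁) ∷ es) B asc {i = i} (there e∈) w | nothing =
      scan-complete σ Δ es B asc {i = i} e∈ w

    interchange-cost : ∀ js σ → cost (interchange js σ) ≡ length js ℕ.+ 1
    interchange-cost []       σ = refl
    interchange-cost (j ∷ js) σ = cong suc (interchange-cost js (updateAt σ j not))

    -- The scan stops at the first hit, so interchanging is paid once and stays outside the product
    -- with the number of entries.
    scan-cost : ∀ {m} σ Δ (B : Vec Entry m) h r → m ℕ.< 2 ^ r →
                (∀ i → length (proj₂ (lookup B i)) ℕ.≤ h) → ∀ {es} → All (λ e → length (proj₂ e) ℕ.≤ h) es →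
                cost (scan σ Δ es B) ℕ.≤ length es ℕ.* (3 ℕ.* r ℕ.+ 2) ℕ.+ (2 ℕ.* h ℕ.+ 3)
    scan-cost σ Δ B h r m<2^r hB [] = ℕ.≤-trans (s≤s z≤n) (ℕ.m≤n+m 3 (2 ℕ.* h))
    scan-cost {m} σ Δ B h r m<2^r hB {(x , S₁) ∷ es} (hS₁ ∷ hs)
      with value (binarySearch m B (- x) (Δ - x) 0 m ℕ.≤-refl) in found
         | search-cost m B (- x) (Δ - x) 0 m ℕ.≤-refl r m<2^r
    ... | nothing | s = ℕ.≤-trans (ℕ.+-mono-≤ s (ℕ.+-monoˡ-≤ 1 (scan-cost σ Δ B h r m<2^r hB hs)))
                          (ℕ.≤-reflexive (lemma r (length es) h))
      where
      lemma : ∀ r l h → 3 ℕ.* r ℕ.+ 1 ℕ.+ (l ℕ.* (3 ℕ.* r ℕ.+ 2) ℕ.+ (2 ℕ.* h ℕ.+ 3) ℕ.+ 1) ≡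
                        suc l ℕ.* (3 ℕ.* r ℕ.+ 2) ℕ.+ (2 ℕ.* h ℕ.+ 3)
      lemma = solve-∀
    ... | just (y , S₂) | s
      with i , eq , _ ← search-sound m B (- x) (Δ - x) 0 m ℕ.≤-refl found = begin
      cost (binarySearch m B (- x) (Δ - x) 0 m ℕ.≤-refl) ℕ.+ (cost (interchange S₁ σ) ℕ.+ (cost (interchange S₂ σ₁) ℕ.+ 1))
        ≤⟨ ℕ.+-mono-≤ s (ℕ.+-mono-≤ (bound S₁ σ hS₁)
             (ℕ.+-monoˡ-≤ 1 (bound S₂ σ₁ (subst (λ e → length (proj₂ e) ℕ.≤ h) eq (hB i))))) ⟩
      3 ℕ.* r ℕ.+ 1 ℕ.+ (h ℕ.+ 1 ℕ.+ (h ℕ.+ 1 ℕ.+ 1))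
        ≤⟨ ℕ.m≤m+n _ (length es ℕ.* (3 ℕ.* r ℕ.+ 2) ℕ.+ 1) ⟩
      3 ℕ.* r ℕ.+ 1 ℕ.+ (h ℕ.+ 1 ℕ.+ (h ℕ.+ 1 ℕ.+ 1)) ℕ.+ (length es ℕ.* (3 ℕ.* r ℕ.+ 2) ℕ.+ 1)
        ≡⟨ lemma r (length es) h ⟩
      suc (length es) ℕ.* (3 ℕ.* r ℕ.+ 2) ℕ.+ (2 ℕ.* h ℕ.+ 3) ∎
      where
      open ℕ.≤-Reasoning
      σ₁ : Schedule n
      σ₁ = value (interchange S₁ σ)
      lemma : ∀ r l h → 3 ℕ.* r ℕ.+ 1 ℕ.+ (h ℕ.+ 1 ℕ.+ (h ℕ.+ 1 ℕ.+ 1)) ℕ.+ (l ℕ.* (3 ℕ.* r ℕ.+ 2) ℕ.+ 1) ≡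
                        suc l ℕ.* (3 ℕ.* r ℕ.+ 2) ℕ.+ (2 ℕ.* h ℕ.+ 3)
      lemma = solve-∀
      bound : ∀ js σ → length js ℕ.≤ h → cost (interchange js σ) ℕ.≤ h ℕ.+ 1
      bound js σ js≤h = ℕ.≤-trans (ℕ.≤-reflexive (interchange-cost js σ)) (ℕ.+-monoˡ-≤ 1 js≤h)

    onMachine-value : ∀ σ i j → value (onMachine σ i j) ≡ lookup (jobs σ i) j
    onMachine-value σ m₁ j = refl
    onMachine-value σ m₂ j = sym (lookup-map j not σ)

    onMachine-cost : ∀ σ i j → cost (onMachine σ i j) ≡ 1
    onMachine-cost σ m₁ j = refl
    onMachine-cost σ m₂ j = refl

    sumOn-value : ∀ σ i js → value (sumOn σ i js) ≈ lsum G (weight σ i) js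
    sumOn-value σ i []       = ≈-refl
    sumOn-value σ i (j ∷ js) rewrite onMachine-value σ i j with lookup (jobs σ i) j
    ... | true  = ∙-congˡ (sumOn-value σ i js)
    ... | false = ≈-trans (sumOn-value σ i js) (≈-sym (identityˡ _))

    sumOn-cost : ∀ σ i js → cost (sumOn σ i js) ≡ 2 ℕ.* length js ℕ.+ 1
    sumOn-cost σ i []       = refl
    sumOn-cost σ i (j ∷ js) = trans (cong₂ (λ a b → a ℕ.+ (b ℕ.+ 1)) (onMachine-cost σ i j) (sumOn-cost σ i js))
                                    (lemma (length js))
      where
      lemma : ∀ l → 1 ℕ.+ (2 ℕ.* l ℕ.+ 1 ℕ.+ 1) ≡ 2 ℕ.* suc l ℕ.+ 1
      lemma = solve-∀

    sumOn-allFin : ∀ σ i → value (sumOn σ i (allFin n)) ≈ load σ i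
    sumOn-allFin σ i = ≈-trans (sumOn-value σ i (allFin n)) (≈-reflexive (lsum-tabulate G (weight σ i) id))

    entries-value : ∀ σ crit h X → value (entries σ crit h X) ≡ map (value ∘ entry σ crit) (value (subsets h X))
    entries-value σ crit h X = mapT-value (entry σ crit) (value (subsets h X))

    IsEntry : Schedule n → Machine → ℕ → List Job → Entry → Set _
    IsEntry σ crit h X (x , S) = S ⊆ X × length S ≡ h × x ≈ lsum G (gain σ crit) S

    entries-sound : ∀ σ crit h X → All (IsEntry σ crit h X) (value (entries σ crit h X))
    entries-sound σ crit h X = subst (All (IsEntry σ crit h X)) (sym (entries-value σ crit h X))
      (All.map⁺ (All.map (λ {S} (S⊆X , |S|≡h) → S⊆X , |S|≡h ,
        ≈-trans (∙-cong (sumOn-value σ crit S) (⁻¹-cong (sumOn-value σ (other crit) S)))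
                (lsum-- G (weight σ crit) (weight σ (other crit)) S)) (subsets-sound h X)))

    entries-complete : ∀ σ crit {S X} → S ⊆ X → ∃ λ e → e ∈ value (entries σ crit (length S) X) × proj₂ e ≡ S
    entries-complete σ crit {S} {X} S⊆X = value (entry σ crit S) ,
      subst (value (entry σ crit S) ∈_) (sym (entries-value σ crit (length S) X))
        (∈-map⁺ (value ∘ entry σ crit) (subsets-complete S⊆X)) , refl

    #entries : ∀ σ crit h X → length (value (entries σ crit h X)) ≡ #subsets h X
    #entries σ crit h X = trans (cong length (entries-value σ crit h X)) (List.length-map _ (value (subsets h X)))

    entries-cost : ∀ σ crit h X → cost (entries σ crit h X) ℕ.≤
                   cost (subsets h X) ℕ.+ (#subsets h X ℕ.* (4 ℕ.* h ℕ.+ 4) ℕ.+ 1)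
    entries-cost σ crit h X = ℕ.+-monoʳ-≤ (cost (subsets h X)) (ℕ.≤-trans
      (mapT-cost (All.map (λ {S} (_ , |S|≡h) → bound S |S|≡h) (subsets-sound h X)))
      (ℕ.≤-reflexive (cong (λ c → #subsets h X ℕ.* c ℕ.+ 1) (sym (ℕ.+-suc (4 ℕ.* h) 3)))))
      where
      lemma : ∀ l → 2 ℕ.* l ℕ.+ 1 ℕ.+ (2 ℕ.* l ℕ.+ 1 ℕ.+ 1) ≡ 4 ℕ.* l ℕ.+ 3
      lemma = solve-∀
      bound : ∀ S → length S ≡ h → cost (entry σ crit S) ℕ.≤ 4 ℕ.* h ℕ.+ 3
      bound S refl = ℕ.≤-reflexive (trans
        (cong₂ (λ a b → a ℕ.+ (b ℕ.+ 1)) (sumOn-cost σ crit S) (sumOn-cost σ (other crit) S)) (lemma (length S)))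

    module _ (σ : Schedule n) where

      L₁ L₂ : Carrier
      L₁ = value (sumOn σ m₁ (allFin n))
      L₂ = value (sumOn σ m₂ (allFin n))

      -- Unfolds to the pair computed inside `kSwapOn`, named here so that facts can be stated about
      -- it.
      critical : Machine × Carrier
      critical = if does (L₁ <? L₂) then (m₂ , L₂ - L₁) else (m₁ , L₁ - L₂)

      IsCritical : Machine → Carrier → Set _
      IsCritical i Δ = ¬ (load σ i < load σ (other i)) × Δ ≈ load σ i - load σ (other i)

      critical-correct : IsCritical (proj₁ critical) (proj₂ critical)
      critical-correct with L₁ <? L₂
      ... | yes L₁<L₂ = (λ l → asym L₁<L₂ (<-respʳ-≈ (≈-sym (sumOn-allFin σ m₁)) (<-respˡ-≈ (≈-sym (sumOn-allFin σ m₂)) l))) ,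
                        ∙-cong (sumOn-allFin σ m₂) (⁻¹-cong (sumOn-allFin σ m₁))
      ... | no  L₁≮L₂ = (λ l → L₁≮L₂ (<-respʳ-≈ (≈-sym (sumOn-allFin σ m₂)) (<-respˡ-≈ (≈-sym (sumOn-allFin σ m₁)) l))) ,
                        ∙-cong (sumOn-allFin σ m₁) (⁻¹-cong (sumOn-allFin σ m₂))

      makespan-critical : ∀ i {Δ} → IsCritical i Δ → makespan σ ≈ load σ i
      makespan-critical m₁ (c , _) = max≈ˡ G c
      makespan-critical m₂ (c , _) = max≈ʳ G c

      makespan<⇒ : ∀ τ i {x} → makespan τ < x → load τ i < x × load τ (other i) < x
      makespan<⇒ τ m₁ m<x = max<⇒ G m<x
      makespan<⇒ τ m₂ m<x = let l₁ , l₂ = max<⇒ G m<x in l₂ , l₁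

      makespan<⇐ : ∀ τ i {x} → load τ i < x → load τ (other i) < x → makespan τ < x
      makespan<⇐ τ m₁ l l′ = max<⇐ G l l′
      makespan<⇐ τ m₂ l l′ = max<⇐ G l′ l

      -- The common interface of two descriptions of a move: flipping distinct jobs, used for
      -- soundness, and collecting the jobs on which two schedules differ, used for completeness.
      Transfers : Schedule n → List Job → Set _
      Transfers τ js = ∀ i → load τ i + lsum G (gain σ i) js ≈ load σ i

      module _ {τ} js (t : Transfers τ js) i {Δ} (crit : IsCritical i Δ) where

        d : Carrier
        d = lsum G (gain σ i) js

        load-other : load τ (other i) ≈ load σ (other i) + d
        load-other = begin
          b′                   ≈⟨ //-rightDividesˡ d b′ ⟨
          b′ - d + d           ≈⟨ ∙-congʳ (∙-congˡ (lsum-gain-other σ i js)) ⟨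
          b′ + lsum G (gain σ (other i)) js + d ≈⟨ ∙-congʳ (t (other i)) ⟩
          load σ (other i) + d ∎
          where
          open import Relation.Binary.Reasoning.Setoid (AbelianGroup.setoid abelianGroup)
          b′ : Carrier
          b′ = load τ (other i)

        transfers-improve : 0# < d × d < Δ → makespan τ < makespan σ
        transfers-improve (0<d , d<Δ) =
          let l , l′ = transfer-improves G (t i) load-other 0<d (<-respʳ-≈ (proj₂ crit) d<Δ)
          in <-respʳ-≈ (≈-sym (makespan-critical i crit)) (makespan<⇐ τ i l l′)

        improves-transfers : makespan τ < makespan σ → 0# < d × d < Δ
        improves-transfers m<m =
          let l , l′     = makespan<⇒ τ i (<-respʳ-≈ (makespan-critical i crit) m<m)
              0<d , d<ab = improves-transfer G (t i) load-other l l′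
          in 0<d , <-respʳ-≈ (≈-sym (proj₂ crit)) d<ab

      flips-transfers : ∀ {js} → Unique js → Transfers (flips js σ) js
      flips-transfers u i = load-flips σ i u

      differ-transfers : ∀ τ → Transfers τ (filterᵇ (differ σ τ) (allFin n))
      differ-transfers τ i = ≈-trans (∙-congˡ (lsum-filterᵇ G (gain σ i) (differ σ τ) (allFin n))) (load-differ σ τ i)

      module Run (k : ℕ) {A B : List Job} (A∪B : Interleaving A B (allFin n)) where

        i₀ : Machine
        i₀ = proj₁ critical

        Δ₀ : Carrier
        Δ₀ = proj₂ critical

        AΣ BΣ BΣ′ : List Entry
        AΣ  = value (entries σ i₀ ⌈ k /2⌉ A)
        BΣ  = value (entries σ i₀ ⌊ k /2⌋ B)
        BΣ′ = value (sort BΣ)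

        BΣ′-sound : All (IsEntry σ i₀ ⌊ k /2⌋ B) BΣ′
        BΣ′-sound = All-resp-↭ (↭-sym (sort-↭ BΣ)) (entries-sound σ i₀ ⌊ k /2⌋ B)

        -- The result is judged by a possibly larger k′, because `procedure` measures the runs of
        -- all parameters against the neighborhood of the largest one.
        sound : ∀ {k′} → k ℕ.≤ k′ → Maybe.All (ImprovingNeighbor k′ σ) (value (kSwapOn k σ A B))
        sound {k′} k≤k′ with value (kSwapOn k σ A B) in eq
        ... | nothing = Maybe.nothing
        ... | just σ′
          with (x , S₁) , i , e∈ , (l , u) , refl ← scan-sound σ Δ₀ AΣ (fromList BΣ′) eq
          with S₁⊆A , |S₁| , x≈ ← All.lookup (entries-sound σ i₀ ⌈ k /2⌉ A) e∈
             | S₂⊆B , |S₂| , y≈ ← lookup-fromList-All BΣ′-sound i =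
          Maybe.just
            ( Neighbor-flips σ (S₁ ++ S₂) (ℕ.≤-trans (ℕ.≤-reflexive size) k≤k′)
            , transfers-improve (S₁ ++ S₂) (flips-transfers (Unique-interleaving A∪B S₁⊆A S₂⊆B)) i₀ critical-correct
                (window G (≈-trans (∙-cong x≈ y≈) (≈-sym (lsum-++ G (gain σ i₀) S₁ S₂))) l u))
          where
          S₂ : List Job
          S₂ = proj₂ (lookup (fromList BΣ′) i)
          size : length (S₁ ++ S₂) ≡ k
          size = trans (List.length-++ S₁) (trans (cong₂ ℕ._+_ |S₁| |S₂|)
                   (trans (ℕ.+-comm ⌈ k /2⌉ ⌊ k /2⌋) (ℕ.⌊n/2⌋+⌈n/2⌉≡n k)))

        -- The differing jobs in A and those in B have exactly the sizes that are enumerated. Their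
        -- values add up to the net load that τ takes off the critical machine, which lies strictly
        -- between 0 and Δ.
        complete : ∀ τ → makespan τ < makespan σ →
                   #marked (differ σ τ) A ≡ ⌈ k /2⌉ → #marked (differ σ τ) B ≡ ⌊ k /2⌋ →
                   ∃ λ σ′ → value (kSwapOn k σ A B) ≡ just σ′
        complete τ m<m |S₁| |S₂|
          with (x , _) , e∈ , refl ← entries-complete σ i₀ (filter-⊆ (T? ∘ differ σ τ) A)
             | (y , _) , e′∈ , refl ← entries-complete σ i₀ (filter-⊆ (T? ∘ differ σ τ) B)
          -- Membership is known for the lengths of the filtered lists; the rewriting turns these
          -- into the two halves of k used by the algorithm.
          rewrite |S₁| | |S₂|
          with _ , _ , x≈ ← All.lookup (entries-sound σ i₀ ⌈ k /2⌉ A) e∈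
             | _ , _ , y≈ ← All.lookup (entries-sound σ i₀ ⌊ k /2⌋ B) e′∈
             | i , eq ← fromList-∈ (∈-resp-↭ (↭-sym (sort-↭ BΣ)) e′∈) =
          scan-complete σ Δ₀ AΣ (fromList BΣ′) (fromList-ascending (sort-sorted BΣ)) {i = i} e∈
            (subst (InWindow (- x) (Δ₀ - x)) (sym eq)
              (let 0<d , d<Δ = improves-transfers (filterᵇ (differ σ τ) (allFin n)) (differ-transfers τ) i₀ critical-correct m<m in
               window⁻¹ G (≈-trans (∙-cong x≈ y≈) sum-differ) 0<d d<Δ))
          where
          g : Job → Carrier
          g j = if differ σ τ j then gain σ i₀ j else 0#
          sum-differ : lsum G (gain σ i₀) (filterᵇ (differ σ τ) A) + lsum G (gain σ i₀) (filterᵇ (differ σ τ) B)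
                         ≈ lsum G (gain σ i₀) (filterᵇ (differ σ τ) (allFin n))
          sum-differ = begin
            lsum G (gain σ i₀) (filterᵇ (differ σ τ) A) + lsum G (gain σ i₀) (filterᵇ (differ σ τ) B)
              ≈⟨ ∙-cong (lsum-filterᵇ G (gain σ i₀) (differ σ τ) A) (lsum-filterᵇ G (gain σ i₀) (differ σ τ) B) ⟩
            lsum G g A + lsum G g B
              ≈⟨ lsum-interleaving G g A∪B ⟩
            lsum G g (allFin n)
              ≈⟨ lsum-filterᵇ G (gain σ i₀) (differ σ τ) (allFin n) ⟨
            lsum G (gain σ i₀) (filterᵇ (differ σ τ) (allFin n)) ∎
            where open import Relation.Binary.Reasoning.Setoid (AbelianGroup.setoid abelianGroup)

open import Data.Bool.Base using (if_then_else_)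
open import Data.Empty using (⊥-elim)
open import Data.List.Base using (List; []; _∷_; length; allFin; filterᵇ)
import Data.List.Properties as List
open import Data.List.Relation.Binary.Permutation.Propositional.Properties using (↭-length)
open import Data.List.Relation.Ternary.Interleaving.Propositional using (Interleaving; toPermutation)
open import Data.List.Relation.Unary.All as All using (All)
open import Data.Maybe.Base using (Maybe; just; nothing; _<∣>_)
import Data.Maybe.Relation.Unary.All as Maybe using (All; just; nothing)
import Data.Maybe.Relation.Unary.Any as Maybe using (just)
open import Data.Nat.Base as ℕ using (ℕ; zero; suc; z≤n; s≤s; _^_; ⌊_/2⌋; ⌈_/2⌉)
import Data.Nat.Properties as ℕ
open import Data.Nat.Logarithm using (⌊log₂_⌋; ⌊log₂⌋-mono-≤; ⌊log₂[2^n]⌋≡n)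
open import Data.Nat.Tactic.RingSolver using (solve-∀)
open import Data.Product.Base using (∃; Σ; _×_; _,_; proj₁; proj₂)
open import Data.Rational.Base as ℚ using (ℚ; 0ℚ; 1ℚ)
import Data.Rational.Properties as ℚ
open import Data.Sum.Base using (_⊎_; inj₁; inj₂)
open import Data.Vec.Functional using (Vector)
open import Relation.Binary.PropositionalEquality.Core using (_≡_; refl; sym; trans; cong; cong₂; subst)
open import Relation.Binary.Structures using (IsStrictTotalOrder)
open import Relation.Nullary.Decidable.Core using (does)
open import Relation.Nullary.Decidable using (dec-true)
open Arithmetic
open Probability
open Schedules
open Routines
open Runs

-- Step bounds for one run and for the whole procedure

n<2^[1+⌊log₂n⌋] : ∀ n → n ℕ.< 2 ^ suc ⌊log₂ n ⌋
n<2^[1+⌊log₂n⌋] n = ℕ.≰⇒> λ 2^≤n →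
  ℕ.1+n≰n (ℕ.≤-trans (ℕ.≤-reflexive (sym (⌊log₂[2^n]⌋≡n (suc ⌊log₂ n ⌋)))) (⌊log₂⌋-mono-≤ 2^≤n))

interleaving-length : ∀ {a} {A : Set a} {as bs xs : List A} → Interleaving as bs xs →
                      length as ℕ.≤ length xs × length bs ℕ.≤ length xs
interleaving-length {as = as} {bs} {xs} i =
  ℕ.≤-trans (ℕ.m≤m+n (length as) (length bs)) (ℕ.≤-reflexive eq) , ℕ.≤-trans (ℕ.m≤n+m (length bs) (length as)) (ℕ.≤-reflexive eq)
  where
  eq : length as ℕ.+ length bs ≡ length xs
  eq = trans (sym (List.length-++ as)) (sym (↭-length (toPermutation i)))

module Cost {c ℓ₁ ℓ₂} (G : OrderedAbelianGroup c ℓ₁ ℓ₂)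
            {n : ℕ} (p : Vector (OrderedAbelianGroup.Carrier G) n) (2≤n : 2 ℕ.≤ n) where

  open OrderedAbelianGroup G using (Carrier)
  open Scheduling G p
  open Search G p
  open KSwap G p
  open Timed using (value; cost; subsets; toArray)
  open import Data.Nat.Base using (_+_; _*_; _≤_; _<_)

  instance
    n≢0 : ℕ.NonZero n
    n≢0 = ℕ.>-nonZero (ℕ.≤-trans (s≤s z≤n) 2≤n)

  lg : ℕ
  lg = ⌊log₂ n ⌋

  -- From n ≥ 2 the logarithm is at least 1, so terms without a logarithmic factor can be absorbed
  -- into `size`.
  1≤lg : 1 ≤ lg
  1≤lg = ⌊log₂⌋-mono-≤ 2≤n

  -- A run with parameter k is only shown to take O (size k) steps, a
  -- factor k more than available on average; the geometric growth of
  -- n ^ ⌈ k /2⌉ absorbs this factor in the sum over k.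
  size : ℕ → ℕ
  size k = k * n ^ ⌈ k /2⌉ * lg

  module _ (σ : Schedule n) (k : ℕ) (1≤k : 1 ≤ k) {A B : List Job} (A∪B : Interleaving A B (allFin n)) where

    open Run σ k A∪B
    open ℕ.≤-Reasoning

    private
      H K W Z R : ℕ
      H = ⌈ k /2⌉
      K = ⌊ k /2⌋
      W = n ^ H
      Z = size k
      -- An exponent with n^H < 2^R; it bounds the rounds of the sort and the probes of each binary
      -- search.
      R = suc lg * H

      |A|≤n : length A ≤ n
      |A|≤n = ℕ.≤-trans (proj₁ (interleaving-length A∪B)) (ℕ.≤-reflexive (List.length-tabulate {n = n} (λ j → j)))

      |B|≤n : length B ≤ n
      |B|≤n = ℕ.≤-trans (proj₂ (interleaving-length A∪B)) (ℕ.≤-reflexive (List.length-tabulate {n = n} (λ j → j)))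

      1≤H : 1 ≤ H
      1≤H = ℕ.⌈n/2⌉-mono 1≤k

      H≤k : H ≤ k
      H≤k = ℕ.⌈n/2⌉≤n k

      K≤H : K ≤ H
      K≤H = ℕ.⌊n/2⌋≤⌈n/2⌉ k

      1≤W : 1 ≤ W
      1≤W = ℕ.m^n>0 n H

      n^K≤W : n ^ K ≤ W
      n^K≤W = ℕ.^-monoʳ-≤ n K≤H

      n≤W : n ≤ W
      n≤W = ℕ.≤-trans (ℕ.≤-reflexive (sym (ℕ.^-identityʳ n))) (ℕ.^-monoʳ-≤ n 1≤H)

      H*W≤Z : H * W ≤ Z
      H*W≤Z = ℕ.≤-trans (ℕ.*-monoˡ-≤ W H≤k) (ℕ.≤-trans (ℕ.≤-reflexive (sym (ℕ.*-identityʳ (k * W)))) (ℕ.*-monoʳ-≤ (k * W) 1≤lg))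

      W≤Z : W ≤ Z
      W≤Z = ℕ.≤-trans (ℕ.≤-trans (ℕ.≤-reflexive (sym (ℕ.*-identityˡ W))) (ℕ.*-monoˡ-≤ W 1≤H)) H*W≤Z

      H≤Z : H ≤ Z
      H≤Z = ℕ.≤-trans (ℕ.≤-trans (ℕ.≤-reflexive (sym (ℕ.*-identityʳ H))) (ℕ.*-monoʳ-≤ H 1≤W)) H*W≤Z

      n≤Z : n ≤ Z
      n≤Z = ℕ.≤-trans n≤W W≤Z

      1≤Z : 1 ≤ Z
      1≤Z = ℕ.≤-trans 1≤W W≤Z

      W*R≤2Z : W * R ≤ 2 * Z
      W*R≤2Z = begin
        W * (suc lg * H)         ≤⟨ ℕ.*-monoʳ-≤ W (ℕ.*-mono-≤ (ℕ.+-monoˡ-≤ lg 1≤lg) H≤k) ⟩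
        W * ((lg + lg) * k)      ≡⟨ lemma W lg k ⟩
        2 * Z                    ∎
        where
        lemma : ∀ W l k → W * ((l + l) * k) ≡ 2 * (k * W * l)
        lemma = solve-∀

      R≤2Z : R ≤ 2 * Z
      R≤2Z = ℕ.≤-trans (ℕ.≤-trans (ℕ.≤-reflexive (sym (ℕ.*-identityˡ R))) (ℕ.*-monoˡ-≤ R 1≤W)) W*R≤2Z

      W<2^R : W < 2 ^ R
      W<2^R = begin-strict
        n ^ H                  <⟨ ℕ.^-monoˡ-< H {{ℕ.>-nonZero 1≤H}} (n<2^[1+⌊log₂n⌋] n) ⟩
        (2 ^ suc lg) ^ H       ≡⟨ ℕ.^-*-assoc 2 (suc lg) H ⟩
        2 ^ R                  ∎

      |AΣ|≤W : length AΣ ≤ W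
      |AΣ|≤W = ℕ.≤-trans (ℕ.≤-reflexive (#entries σ i₀ H A)) (#subsets≤n^h H A |A|≤n)

      |BΣ|≤W : length BΣ ≤ W
      |BΣ|≤W = ℕ.≤-trans (ℕ.≤-reflexive (#entries σ i₀ K B)) (ℕ.≤-trans (#subsets≤n^h K B |B|≤n) n^K≤W)

      |BΣ′|≤W : length BΣ′ ≤ W
      |BΣ′|≤W = ℕ.≤-trans (ℕ.≤-reflexive (↭-length (sort-↭ BΣ))) |BΣ|≤W

      sumOn≤ : ∀ i → cost (sumOn σ i (allFin n)) ≤ 3 * Z
      sumOn≤ i = begin
        cost (sumOn σ i (allFin n))   ≡⟨ sumOn-cost σ i (allFin n) ⟩
        2 * length (allFin n) + 1
          ≡⟨ cong (λ l → 2 * l + 1) (List.length-tabulate {n = n} (λ j → j)) ⟩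
        2 * n + 1                     ≤⟨ ℕ.+-mono-≤ (ℕ.*-monoʳ-≤ 2 n≤Z) 1≤Z ⟩
        2 * Z + Z                     ≡⟨ lemma Z ⟩
        3 * Z                         ∎
        where
        lemma : ∀ Z → 2 * Z + Z ≡ 3 * Z
        lemma = solve-∀

      entries≤ : ∀ h X → h ≤ H → length X ≤ n → cost (entries σ i₀ h X) ≤ 22 * Z
      entries≤ h X h≤H |X|≤n = begin
        cost (entries σ i₀ h X)                                      ≤⟨ entries-cost σ i₀ h X ⟩
        cost (subsets h X) + (#subsets h X * (4 * h + 4) + 1)
          ≤⟨ ℕ.+-mono-≤ (subsets-cost h X |X|≤n)
             (ℕ.+-monoˡ-≤ 1 (ℕ.*-mono-≤ (#subsets≤n^h h X |X|≤n) (ℕ.+-monoˡ-≤ 4 (ℕ.*-monoʳ-≤ 4 h≤H)))) ⟩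
        12 * h * n ^ h + 1 + (n ^ h * (4 * H + 4) + 1)
          ≤⟨ ℕ.+-mono-≤ (ℕ.+-monoˡ-≤ 1 (ℕ.*-mono-≤ (ℕ.*-monoʳ-≤ 12 h≤H) (ℕ.^-monoʳ-≤ n h≤H)))
             (ℕ.+-monoˡ-≤ 1 (ℕ.*-monoˡ-≤ (4 * H + 4) (ℕ.^-monoʳ-≤ n h≤H))) ⟩
        12 * H * W + 1 + (W * (4 * H + 4) + 1)                       ≡⟨ lemma H W ⟩
        16 * (H * W) + 4 * W + 1 + 1
          ≤⟨ ℕ.+-mono-≤ (ℕ.+-mono-≤ (ℕ.+-mono-≤ (ℕ.*-monoʳ-≤ 16 H*W≤Z) (ℕ.*-monoʳ-≤ 4 W≤Z)) 1≤Z) 1≤Z ⟩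
        16 * Z + 4 * Z + Z + Z                                       ≡⟨ lemma₂ Z ⟩
        22 * Z                                                       ∎
        where
        lemma : ∀ H W → 12 * H * W + 1 + (W * (4 * H + 4) + 1) ≡ 16 * (H * W) + 4 * W + 1 + 1
        lemma = solve-∀
        lemma₂ : ∀ Z → 16 * Z + 4 * Z + Z + Z ≡ 22 * Z
        lemma₂ = solve-∀

      sort≤ : cost (sort BΣ) ≤ 14 * Z
      sort≤ = begin
        cost (sort BΣ)
          ≤⟨ sort-cost R BΣ (ℕ.≤-trans |BΣ|≤W (ℕ.<⇒≤ W<2^R)) ⟩
        2 * length BΣ + 2 + R * (4 * length BΣ + 1)
          ≤⟨ ℕ.+-mono-≤ (ℕ.+-monoˡ-≤ 2 (ℕ.*-monoʳ-≤ 2 |BΣ|≤W)) (ℕ.*-monoʳ-≤ R (ℕ.+-monoˡ-≤ 1 (ℕ.*-monoʳ-≤ 4 |BΣ|≤W))) ⟩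
        2 * W + 2 + R * (4 * W + 1)                            ≡⟨ lemma W R ⟩
        2 * W + 2 * 1 + 4 * (W * R) + R
          ≤⟨ ℕ.+-mono-≤ (ℕ.+-mono-≤ (ℕ.+-mono-≤ (ℕ.*-monoʳ-≤ 2 W≤Z) (ℕ.*-monoʳ-≤ 2 1≤Z)) (ℕ.*-monoʳ-≤ 4 W*R≤2Z)) R≤2Z ⟩
        2 * Z + 2 * Z + 4 * (2 * Z) + 2 * Z                    ≡⟨ lemma₂ Z ⟩
        14 * Z                                                 ∎
        where
        lemma : ∀ W R → 2 * W + 2 + R * (4 * W + 1) ≡ 2 * W + 2 * 1 + 4 * (W * R) + R
        lemma = solve-∀
        lemma₂ : ∀ Z → 2 * Z + 2 * Z + 4 * (2 * Z) + 2 * Z ≡ 14 * Z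
        lemma₂ = solve-∀

      scan≤ : cost (scan σ Δ₀ AΣ (value (toArray BΣ′))) ≤ 13 * Z
      scan≤ = begin
        cost (scan σ Δ₀ AΣ (value (toArray BΣ′)))
          ≤⟨ scan-cost σ Δ₀ (value (toArray BΣ′)) H R (ℕ.≤-<-trans |BΣ′|≤W W<2^R)
               (lookup-fromList-All (All.map (λ (_ , |S| , _) → ℕ.≤-trans (ℕ.≤-reflexive |S|) K≤H) BΣ′-sound))
               (All.map (λ (_ , |S| , _) → ℕ.≤-reflexive |S|) (entries-sound σ i₀ H A)) ⟩
        length AΣ * (3 * R + 2) + (2 * H + 3)
          ≤⟨ ℕ.+-monoˡ-≤ (2 * H + 3) (ℕ.*-monoˡ-≤ (3 * R + 2) |AΣ|≤W) ⟩
        W * (3 * R + 2) + (2 * H + 3)                          ≡⟨ lemma W R H ⟩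
        3 * (W * R) + 2 * W + 2 * H + 3 * 1
          ≤⟨ ℕ.+-mono-≤ (ℕ.+-mono-≤ (ℕ.+-mono-≤ (ℕ.*-monoʳ-≤ 3 W*R≤2Z) (ℕ.*-monoʳ-≤ 2 W≤Z)) (ℕ.*-monoʳ-≤ 2 H≤Z)) (ℕ.*-monoʳ-≤ 3 1≤Z) ⟩
        3 * (2 * Z) + 2 * Z + 2 * Z + 3 * Z                    ≡⟨ lemma₂ Z ⟩
        13 * Z                                                 ∎
        where
        lemma : ∀ W R H → W * (3 * R + 2) + (2 * H + 3) ≡ 3 * (W * R) + 2 * W + 2 * H + 3 * 1
        lemma = solve-∀
        lemma₂ : ∀ Z → 3 * (2 * Z) + 2 * Z + 2 * Z + 3 * Z ≡ 13 * Z
        lemma₂ = solve-∀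

    kSwapOn-cost : cost (kSwapOn k σ A B) ≤ 80 * Z
    kSwapOn-cost = begin
      cost (kSwapOn k σ A B)
        -- The summands follow `kSwapOn`: two loads, their comparison, the two lists, the sort, the
        -- array and the scan.
        ≤⟨ ℕ.+-mono-≤ (sumOn≤ m₁) (ℕ.+-mono-≤ (sumOn≤ m₂) (ℕ.+-mono-≤ 1≤Z (ℕ.+-mono-≤ (entries≤ H A ℕ.≤-refl |A|≤n)
             (ℕ.+-mono-≤ (entries≤ K B K≤H |B|≤n) (ℕ.+-mono-≤ sort≤ (ℕ.+-mono-≤ (ℕ.+-mono-≤ 1≤Z (ℕ.≤-trans |BΣ′|≤W W≤Z)) scan≤)))))) ⟩
      3 * Z + (3 * Z + (Z + (22 * Z + (22 * Z + (14 * Z + (Z + Z + 13 * Z))))))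
        ≡⟨ lemma Z ⟩
      80 * Z ∎
      where
      lemma : ∀ Z → 3 * Z + (3 * Z + (Z + (22 * Z + (22 * Z + (14 * Z + (Z + Z + 13 * Z)))))) ≡ 80 * Z
      lemma = solve-∀

  open Randomized

  size-mono : ∀ {j k} → j ≤ k → size j ≤ size k
  size-mono j≤k = ℕ.*-monoˡ-≤ lg (ℕ.*-mono-≤ j≤k (ℕ.^-monoʳ-≤ n (ℕ.⌈n/2⌉-mono j≤k)))

  n≤size : ∀ k → n ≤ size (suc k)
  n≤size k = begin
    n                                  ≡⟨ lemma n ⟩
    1 * n ^ 1 * 1
      ≤⟨ ℕ.*-mono-≤ (ℕ.*-mono-≤ {1} {suc k} (s≤s z≤n) (ℕ.^-monoʳ-≤ n (ℕ.⌈n/2⌉-mono {1} {suc k} (s≤s z≤n)))) 1≤lg ⟩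
    size (suc k)                       ∎
    where
    open ℕ.≤-Reasoning
    lemma : ∀ n → n ≡ 1 * (n * 1) * 1
    lemma = solve-∀

  1≤size : ∀ k → 1 ≤ size (suc k)
  1≤size k = ℕ.≤-trans (ℕ.≤-trans (s≤s z≤n) 2≤n) (n≤size k)

  kSwap-steps : ∀ σ k → steps (kSwap (suc k) σ) ≤ 83 * size (suc k)
  kSwap-steps σ k = begin
    steps (kSwap (suc k) σ)
      -- The bound for the deterministic part needs A and B to split the jobs, which `Surely`
      -- supplies at every leaf.
      ≤⟨ steps->>= (split (allFin n)) (Surely-map (split (allFin n))
           (λ {(A , B)} i → ℕ.≤-trans (ℕ.≤-reflexive (ℕ.+-identityʳ _)) (kSwapOn-cost σ (suc k) (s≤s z≤n) i))
           (split-interleaving (allFin n))) ⟩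
    steps (split (allFin n)) + 80 * Z      ≤⟨ ℕ.+-monoˡ-≤ (80 * Z) (steps-split (allFin n)) ⟩
    2 * length (allFin n) + 1 + 80 * Z
      ≡⟨ cong (λ l → 2 * l + 1 + 80 * Z) (List.length-tabulate {n = n} (λ j → j)) ⟩
    2 * n + 1 + 80 * Z
      ≤⟨ ℕ.+-monoˡ-≤ (80 * Z) (ℕ.+-mono-≤ (ℕ.*-monoʳ-≤ 2 (n≤size k)) (1≤size k)) ⟩
    2 * Z + Z + 80 * Z                     ≡⟨ lemma Z ⟩
    83 * Z                                 ∎
    where
    open ℕ.≤-Reasoning
    Z : ℕ
    Z = size (suc k)
    lemma : ∀ Z → 2 * Z + Z + 80 * Z ≡ 83 * Z
    lemma = solve-∀

  <∣>-steps : ∀ {a} {A : Set a} (t u : Alg (Maybe A)) →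
              steps (t >>= λ x → u >>= λ y → tick >>= λ _ → return (x <∣> y)) ≤ steps t + (steps u + 1)
  <∣>-steps t u = steps->>= t (always (λ x → steps->>= u (always (λ y → ℕ.≤-refl) u)) t)

  repeat-steps : ∀ {a} {A : Set a} r (t : Alg (Maybe A)) → steps (repeat r t) ≤ r * (steps t + 1) + 1
  repeat-steps zero    t = ℕ.≤-refl
  repeat-steps (suc r) t = ℕ.≤-trans (<∣>-steps t (repeat r t))
    (ℕ.≤-trans (ℕ.+-monoʳ-≤ (steps t) (ℕ.+-monoˡ-≤ 1 (repeat-steps r t))) (ℕ.≤-reflexive (lemma r (steps t))))
    where
    lemma : ∀ r s → s + (r * (s + 1) + 1 + 1) ≡ suc r * (s + 1) + 1
    lemma = solve-∀

  module _ (σ : Schedule n) (r : ℕ) (1≤r : 1 ≤ r) where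

    -- Each of the r runs takes 83 Z steps and one for combining, rounded up to Z. The last step of
    -- `repeat` and the tick of `procedure` are rounded up to r Z each.
    procedure-step : ∀ k → steps (procedure r (suc k) σ) ≤ steps (procedure r k σ) + 86 * (r * size (suc k))
    procedure-step k = ℕ.≤-trans (<∣>-steps (procedure r k σ) (repeat r t)) (ℕ.+-monoʳ-≤ (steps (procedure r k σ)) (begin
      steps (repeat r t) + 1                ≤⟨ ℕ.+-monoˡ-≤ 1 (repeat-steps r t) ⟩
      r * (steps t + 1) + 1 + 1
        ≤⟨ ℕ.+-mono-≤ (ℕ.+-mono-≤ (ℕ.*-monoʳ-≤ r (ℕ.+-mono-≤ (kSwap-steps σ k) (1≤size k))) 1≤rZ) 1≤rZ ⟩
      r * (83 * Z + Z) + r * Z + r * Z      ≡⟨ lemma r Z ⟩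
      86 * (r * Z)                          ∎))
      where
      open ℕ.≤-Reasoning
      t : Alg (Maybe (Schedule n))
      t = kSwap (suc k) σ
      Z : ℕ
      Z = size (suc k)
      1≤rZ : 1 ≤ r * Z
      1≤rZ = ℕ.*-mono-≤ 1≤r (1≤size k)
      lemma : ∀ r Z → r * (83 * Z + Z) + r * Z + r * Z ≡ 86 * (r * Z)
      lemma = solve-∀

    -- Raising k by two adds one to ⌈k/2⌉, which brings a factor n ≥ 2.
    2*size≤ : ∀ k → 2 * size k ≤ k * n ^ suc ⌈ k /2⌉ * lg
    2*size≤ k = begin
      2 * (k * W * lg)       ≡⟨ lemma k W lg ⟩
      k * (2 * W) * lg       ≤⟨ ℕ.*-monoˡ-≤ lg (ℕ.*-monoʳ-≤ k (ℕ.*-monoˡ-≤ W 2≤n)) ⟩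
      k * (n * W) * lg       ∎
      where
      open ℕ.≤-Reasoning
      W : ℕ
      W = n ^ ⌈ k /2⌉
      lemma : ∀ k W l → 2 * (k * W * l) ≡ k * (2 * W) * l
      lemma = solve-∀

    -- The exponent ⌈k/2⌉ grows only at every second step, so the geometric sum is taken two
    -- parameters at a time. Of the constant 344 = 4 · 86, one half covers all earlier parameters,
    -- since `size` at least doubles, and the other half the two new ones.
    procedure-steps : ∀ k → steps (procedure r k σ) ≤ 1 + 344 * (r * size k)
    procedure-steps zero          = s≤s z≤n
    procedure-steps (suc zero)    = ℕ.≤-trans (procedure-step zero) (s≤s (ℕ.*-monoˡ-≤ (r * size 1) {86} {344} (ℕ.m≤m+n 86 258)))
    procedure-steps (suc (suc k)) = begin
      steps (procedure r (2 + k) σ)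
        ≤⟨ ℕ.≤-trans (procedure-step (suc k)) (ℕ.+-monoˡ-≤ _ (procedure-step k)) ⟩
      steps (procedure r k σ) + 86 * (r * size (suc k)) + 86 * (r * size (2 + k))
        ≤⟨ ℕ.+-monoˡ-≤ _ (ℕ.+-mono-≤ (procedure-steps k) (ℕ.*-monoʳ-≤ 86 (ℕ.*-monoʳ-≤ r (size-mono (ℕ.n≤1+n (suc k)))))) ⟩
      1 + 344 * (r * size k) + 86 * (r * size (2 + k)) + 86 * (r * size (2 + k))
        ≡⟨ lemma₁ r (size k) (size (2 + k)) ⟩
      1 + 172 * (r * (2 * size k + size (2 + k)))
        ≤⟨ s≤s (ℕ.*-monoʳ-≤ 172 (ℕ.*-monoʳ-≤ r (ℕ.+-monoˡ-≤ (size (2 + k)) (ℕ.≤-trans (2*size≤ k)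
             (ℕ.*-monoˡ-≤ lg (ℕ.*-monoˡ-≤ (n ^ suc ⌈ k /2⌉) (ℕ.m≤n+m k 2))))))) ⟩
      1 + 172 * (r * (size (2 + k) + size (2 + k)))
        ≡⟨ lemma₂ r (size (2 + k)) ⟩
      1 + 344 * (r * size (2 + k)) ∎
      where
      open ℕ.≤-Reasoning
      lemma₁ : ∀ r s t → 1 + 344 * (r * s) + 86 * (r * t) + 86 * (r * t) ≡ 1 + 172 * (r * (2 * s + t))
      lemma₁ = solve-∀
      lemma₂ : ∀ r t → 1 + 172 * (r * (t + t)) ≡ 1 + 344 * (r * t)
      lemma₂ = solve-∀

-- Success probability of the procedure

module Success {c ℓ₁ ℓ₂} (G : OrderedAbelianGroup c ℓ₁ ℓ₂)
               {n : ℕ} (p : Vector (OrderedAbelianGroup.Carrier G) n) where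

  open OrderedAbelianGroup G
  open Scheduling G p
  open KSwap G p
  open Timed using (value)
  open Randomized
  open import Data.Rational.Base using (_≤_) renaming (_+_ to _+ℚ_; _*_ to _*ℚ_)

  module _ (σ : Schedule n) (k : ℕ) where

    ok? = improvingNeighbor? k σ

    Sound-kSwap : ∀ {j} → j ℕ.≤ k → Sound ok? (kSwap j σ)
    Sound-kSwap {j} j≤k = Surely->>= (split (allFin n)) (split-interleaving (allFin n))
      (λ {(A , B)} i → Run.sound σ j i j≤k)

    Sound-procedure : ∀ r m → m ℕ.≤ k → Sound ok? (procedure r m σ)
    Sound-procedure r zero    _   = Maybe.nothing
    Sound-procedure r (suc m) m<k = Sound-<∣> ok? (procedure r m σ) (repeat r (kSwap (suc m) σ))
      (Sound-procedure r m (ℕ.<⇒≤ m<k)) (Sound-repeat ok? r (Sound-kSwap m<k))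

    misses : Alg (Maybe (Schedule n)) → ℚ
    misses t = E t (missAny ok?)

    misses-nonNeg : ∀ t → 0ℚ ≤ misses t
    misses-nonNeg t = E-nonNeg t (miss-nonNeg (success? k σ))

    -- The failure probability of the procedure is a product of factors in [0, 1], one per
    -- parameter, so it is at most the factor of j.
    misses-procedure : ∀ r m j → m ℕ.≤ k → 1 ℕ.≤ j → j ℕ.≤ m →
                       misses (procedure r m σ) ≤ misses (repeat r (kSwap j σ))
    misses-procedure r zero    j m≤k 1≤j j≤0 = ⊥-elim (ℕ.<⇒≱ 1≤j j≤0)
    misses-procedure r (suc m) j m<k 1≤j j≤m = ℚ.≤-trans
      (ℚ.≤-reflexive (E-miss-<∣> ok? (procedure r m σ) u (Sound-procedure r m (ℕ.<⇒≤ m<k)))) (go (ℕ.m≤n⇒m<n∨m≡n j≤m))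
      where
      open ℚ.≤-Reasoning
      u : Alg (Maybe (Schedule n))
      u = repeat r (kSwap (suc m) σ)
      go : (j ℕ.< suc m) ⊎ (j ≡ suc m) → misses (procedure r m σ) *ℚ misses u ≤ misses (repeat r (kSwap j σ))
      go (inj₁ j<1+m) = begin
        misses (procedure r m σ) *ℚ misses u
          ≤⟨ ℚ.*-monoˡ-≤-nonNeg (misses (procedure r m σ))
              {{ℚ.nonNegative (misses-nonNeg (procedure r m σ))}} (E-miss≤1 (success? k σ) u) ⟩
        misses (procedure r m σ) *ℚ 1ℚ       ≡⟨ ℚ.*-identityʳ _ ⟩
        misses (procedure r m σ)
          ≤⟨ misses-procedure r m j (ℕ.<⇒≤ m<k) 1≤j (ℕ.≤-pred j<1+m) ⟩
        misses (repeat r (kSwap j σ))        ∎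
      go (inj₂ refl) = begin
        misses (procedure r m σ) *ℚ misses u
          ≤⟨ ℚ.*-monoʳ-≤-nonNeg (misses u) {{ℚ.nonNegative (misses-nonNeg u)}} (E-miss≤1 (success? k σ) (procedure r m σ)) ⟩
        1ℚ *ℚ misses u                       ≡⟨ ℚ.*-identityˡ _ ⟩
        misses u                             ∎

    module _ {τ} (improving : ImprovingNeighbor k σ τ) where

      j : ℕ
      j = #marked (differ σ τ) (allFin n)

      j≤k : j ℕ.≤ k
      j≤k = #differ≤k σ τ (proj₁ improving)

      -- With no differing job the transferred load would be 0, but an improvement transfers a
      -- positive amount.
      1≤j : 1 ℕ.≤ j
      1≤j with filterᵇ (differ σ τ) (allFin n)
             | improves-transfers σ (filterᵇ (differ σ τ) (allFin n))
                 (differ-transfers σ τ) (proj₁ (critical σ)) (critical-correct σ) (proj₂ improving)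
      ... | []    | 0<0 , _ = ⊥-elim (IsStrictTotalOrder.irrefl isStrictTotalOrder (IsStrictTotalOrder.Eq.refl isStrictTotalOrder) 0<0)
      ... | _ ∷ _ | _       = s≤s z≤n

      q : ℚ
      q = Pr (success? k σ) (kSwap j σ)

      paths≤2^jq : paths ⌈ j /2⌉ ⌊ j /2⌋ ⋆ 1ℚ ≤ (2 ^ j) ⋆ q
      paths≤2^jq = begin
        paths ⌈ j /2⌉ ⌊ j /2⌋ ⋆ 1ℚ
          ≤⟨ E-split (differ σ τ) (allFin n) ⌈ j /2⌉ ⌊ j /2⌋ hit hit-nonNeg covered halves ⟩
        (2 ^ (⌈ j /2⌉ ℕ.+ ⌊ j /2⌋)) ⋆ E (split (allFin n)) hit
          ≡⟨ cong₂ (λ m x → (2 ^ m) ⋆ x) halves (sym q≡E) ⟩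
        (2 ^ j) ⋆ q ∎
        where
        open ℚ.≤-Reasoning
        found : List Job × List Job → Maybe (Schedule n)
        found (A , B) = value (kSwapOn j σ A B)
        hit : List Job × List Job → ℚ
        hit z = if does (success? k σ (found z)) then 1ℚ else 0ℚ
        hit-nonNeg : ∀ z → 0ℚ ≤ hit z
        hit-nonNeg z = Pr-nonNeg (success? k σ) (return (found z))
        halves : ⌈ j /2⌉ ℕ.+ ⌊ j /2⌋ ≡ j
        halves = trans (ℕ.+-comm ⌈ j /2⌉ ⌊ j /2⌋) (ℕ.⌊n/2⌋+⌈n/2⌉≡n j)
        q≡E : q ≡ E (split (allFin n)) hit
        q≡E = trans (Pr≡E (success? k σ) (kSwap j σ)) (E->>= (split (allFin n)))
        covered : ∀ {A B} → Interleaving A B (allFin n) → #marked (differ σ τ) A ≡ ⌈ j /2⌉ →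
                  #marked (differ σ τ) B ≡ ⌊ j /2⌋ → 1ℚ ≤ hit (A , B)
        covered {A} {B} i |A| |B|
          -- The run may report a schedule other than τ; soundness makes that one an improving
          -- neighbor too.
          with σ′ , eq ← Run.complete σ j i τ (proj₂ improving) |A| |B|
          with Maybe.just improving′ ← subst (Maybe.All _) eq (Run.sound σ j i j≤k)
          rewrite eq | dec-true (success? k σ (just σ′)) (Maybe.just improving′) = ℚ.≤-refl

      -- Multiplying by 2^j replaces the division in the probability of an even split, and the
      -- binomial bound then chains with `paths≤2^jq`.
      1≤2sq : 1ℚ ≤ (2 ℕ.* ⌈√ k ⌉) ⋆ q
      1≤2sq = ⋆-cancel-≤ (2 ^ j) {{ℕ.m^n≢0 2 j}} (begin
        (2 ^ j) ⋆ 1ℚ                 ≤⟨ ⋆-monoˡ-≤ (ℚ.nonNegative⁻¹ 1ℚ) (2^k≤2s·paths j k 1≤j j≤k) ⟩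
        (s ℕ.* P) ⋆ 1ℚ               ≡⟨ ⋆-assocˡ 1ℚ s P ⟨
        s ⋆ (P ⋆ 1ℚ)                 ≤⟨ ⋆-mono-≤ s paths≤2^jq ⟩
        s ⋆ ((2 ^ j) ⋆ q)            ≡⟨ ⋆-assocˡ q s (2 ^ j) ⟩
        (s ℕ.* 2 ^ j) ⋆ q            ≡⟨ cong (_⋆ q) (ℕ.*-comm s (2 ^ j)) ⟩
        (2 ^ j ℕ.* s) ⋆ q            ≡⟨ ⋆-assocˡ q (2 ^ j) s ⟨
        (2 ^ j) ⋆ (s ⋆ q)            ∎)
        where
        open ℚ.≤-Reasoning
        s P : ℕ
        s = 2 ℕ.* ⌈√ k ⌉
        P = paths ⌈ j /2⌉ ⌊ j /2⌋

      -- Among 2 ⌈√k⌉ runs at least one success is expected by `1≤2sq`; three times as many give 3 ≤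
      -- `runs ⋆ q`.
      runs : ℕ
      runs = 3 ℕ.* (2 ℕ.* ⌈√ k ⌉)

      procedure-success : Pr (success? k σ) (procedure runs k σ) ≥1-1/e
      procedure-success =
          subst _≥1-1/e (sym (Pr≡1-E-miss (success? k σ) (procedure runs k σ)))
              (4x≤1⇒1-x≥1-1/e {misses (procedure runs k σ)} (begin
        misses (procedure runs k σ) *ℚ (4 ⋆ 1ℚ)
          ≤⟨ ℚ.*-monoʳ-≤-nonNeg (4 ⋆ 1ℚ) (misses-procedure runs k j ℕ.≤-refl 1≤j j≤k) ⟩
        -- `4 ⋆ 1ℚ` unfolds to this sum, the shape expected by `E-miss-repeat`.
        misses t *ℚ (1ℚ +ℚ 3 ⋆ 1ℚ)
          ≤⟨ ℚ.*-monoˡ-≤-nonNeg (misses t) {{ℚ.nonNegative (misses-nonNeg t)}}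
              (ℚ.+-monoʳ-≤ 1ℚ (ℚ.≤-trans (⋆-mono-≤ 3 1≤2sq) (ℚ.≤-reflexive (⋆-assocˡ q 3 (2 ℕ.* ⌈√ k ⌉))))) ⟩
        misses t *ℚ (1ℚ +ℚ runs ⋆ q)                   ≤⟨ E-miss-repeat ok? runs (Sound-kSwap j≤k) ⟩
        1ℚ                                             ∎))
        where
        open ℚ.≤-Reasoning
        t : Alg (Maybe (Schedule n))
        t = repeat runs (kSwap j σ)

open import Data.Nat.Base using (_*_; _≤_; _+_)

-- The squared step bound and the final assembly

-- Squaring turns the exponent 3/2 of k into 3: one factor k comes from r² and two from k².
square-bound : ∀ {x r k} c b w → x ≤ c * (r * (k * w)) → r ^ 2 ≤ b * k → x ^ 2 ≤ c ^ 2 * b * (k ^ 3 * w ^ 2)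
square-bound {x} {r} {k} c b w x≤ r²≤ = begin
  x ^ 2                                 ≤⟨ ℕ.^-monoˡ-≤ 2 x≤ ⟩
  (c * (r * (k * w))) ^ 2               ≡⟨ lemma₁ c r k w ⟩
  c ^ 2 * (r ^ 2 * (k ^ 2 * w ^ 2))     ≤⟨ ℕ.*-monoʳ-≤ (c ^ 2) (ℕ.*-monoˡ-≤ (k ^ 2 * w ^ 2) r²≤) ⟩
  c ^ 2 * (b * k * (k ^ 2 * w ^ 2))     ≡⟨ lemma₂ (c ^ 2) b k (w ^ 2) ⟩
  c ^ 2 * b * (k ^ 3 * w ^ 2)           ∎
  where
  open ℕ.≤-Reasoning
  lemma₁ : ∀ c r k w → (c * (r * (k * w))) * ((c * (r * (k * w))) * 1) ≡
           c * (c * 1) * (r * (r * 1) * (k * (k * 1) * (w * (w * 1))))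
  lemma₁ = solve-∀
  lemma₂ : ∀ a b k x → a * (b * k * (k * (k * 1) * x)) ≡ a * b * (k * (k * (k * 1)) * x)
  lemma₂ = solve-∀

theorem1 : ∀ {c ℓ₁ ℓ₂} →
    Σ (ℕ → ℕ) λ r → Σ ℕ λ a → Σ ℕ λ C →
    (∀ k → 1 ≤ k → r k ^ 2 ≤ a * k) ×
    (∀ (G : OrderedAbelianGroup c ℓ₁ ℓ₂) (let open OrderedAbelianGroup G)
    (n : ℕ) (p : Vector Carrier n) (let open Scheduling G p) →
    (∀ j → 0# < p j) →
    ∀ (σ : Schedule n) (k : ℕ) → 1 ≤ k →
    (2 ≤ n →
    Randomized.steps (procedure (r k) k σ) ^ 2
    ≤ C * (k ^ 3 * (n ^ ⌈ k /2⌉ * ⌊log₂ n ⌋) ^ 2)) ×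
    (∃ (ImprovingNeighbor k σ) →
    Randomized.Pr (success? k σ) (procedure (r k) k σ) ≥1-1/e))
-- 144 = 36 · 4 comes from squaring 6 ⌈√k⌉, and the last constant is the square of the step constant
-- 345 times 144.
theorem1 = runs , 144 , 345 ^ 2 * 144 , runs² , λ G n p _ σ k 1≤k →
  (λ 2≤n → square-bound {r = runs k} {k} 345 144 (n ^ ⌈ k /2⌉ * ⌊log₂ n ⌋) (steps≤ G n p σ k 1≤k 2≤n) (runs² k 1≤k)) ,
  λ (τ , improving) → Success.procedure-success G p σ k improving
  where
  open ℕ.≤-Reasoning
  runs : ℕ → ℕ
  -- Agrees by unfolding with `runs` in `Success`, so that the bound proved there applies as it
  -- stands.
  runs k = 3 * (2 * ⌈√ k ⌉)
  runs² : ∀ k → 1 ≤ k → runs k ^ 2 ≤ 144 * k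
  runs² k _ = begin
    runs k ^ 2         ≡⟨ lemma₁ ⌈√ k ⌉ ⟩
    36 * ⌈√ k ⌉ ^ 2    ≤⟨ ℕ.*-monoʳ-≤ 36 (⌈√k⌉²≤4k k) ⟩
    36 * (4 * k)       ≡⟨ ℕ.*-assoc 36 4 k ⟨
    144 * k            ∎
    where
    lemma₁ : ∀ s → (3 * (2 * s)) * ((3 * (2 * s)) * 1) ≡ 36 * (s * (s * 1))
    lemma₁ = solve-∀
  runs>0 : ∀ k → 1 ≤ k → 1 ≤ runs k
  runs>0 k 1≤k with ⌈√ k ⌉ | k≤⌈√k⌉² k
  ... | zero  | k≤0 = ⊥-elim (ℕ.<⇒≱ 1≤k k≤0)
  ... | suc s | _   = s≤s z≤n
  steps≤ : ∀ G n p (let open Scheduling G p) σ k → 1 ≤ k → 2 ≤ n →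
           Randomized.steps (procedure (runs k) k σ) ≤ 345 * (runs k * (k * (n ^ ⌈ k /2⌉ * ⌊log₂ n ⌋)))
  steps≤ G n p σ k@(suc k-1) 1≤k 2≤n = begin
    Randomized.steps (procedure (runs k) k σ)
      ≤⟨ procedure-steps σ (runs k) (runs>0 k 1≤k) k ⟩
    -- The leading 1 is at most `runs k * size k`, which makes the constant 345.
    1 + 344 * (runs k * size k)
      ≤⟨ ℕ.+-monoˡ-≤ (344 * (runs k * size k)) (ℕ.*-mono-≤ (runs>0 k 1≤k) (1≤size k-1)) ⟩
    345 * (runs k * size k)
      ≡⟨ cong (λ s → 345 * (runs k * s)) (ℕ.*-assoc k (n ^ ⌈ k /2⌉) ⌊log₂ n ⌋) ⟩
    345 * (runs k * (k * (n ^ ⌈ k /2⌉ * ⌊log₂ n ⌋)))       ∎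
    where
    open Scheduling G p
    open Cost G p 2≤n
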